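{- All of the following problems are in $\mathsf{FPT}$: (i) LoadCVRP parameterized by $k+\ell$; (ii) GasCVRP parameterized by $k+g$; (iii) LoadGasCVRP parameterized by $k+\ell$. Here $k$ is the number of vehicles, $\ell$ the load capacity and $g$ the gas capacity.
   Context: All graphs are finite and undirected, and $\mathbb N = \{0,1,2,\dots\}$, $\mathbb N^+=\{1,2,\dots\}$. A walk in $G$ is a sequence of vertices $(v_1,\dots,v_m)$ with consecutive vertices adjacent; vertices and edges may be repeated. It is closed if $v_1 = v_m$. The weight of a walk is $w(p)=\sum_{i=1}^{m-1} w(v_i,v_{i+1})$. Common setting: an instance contains a graph $G$ with edge weights $w\colon E(G)\to\mathbb N$, a nonempty set of depots $D\subseteq V(G)$, a set of clients $C\subseteq V(G)$, a number of vehicles $k\in\mathbb N$, and a bound $r\in\mathbb N$. A routing is a set of $k'$ walks $R=\{p_1,\dots,p_{k'}\}$ (one walk per vehicle) together with an assignment $A\colon C\to[k']$ such that $k'\le k$, every walk starts at a vertex of $D$, every client $c\in C$ is a vertex of $p_{A(c)}$, every walk in $R$ is closed, and the additional constraints below hold. Its weight is $w(R)=\sum_{p\in R}w(p)$. The question is whether there exists a routing with $w(R)\le r$. LoadCVRP (Load-Capacitated Vehicle Routing Problem): the instance additionally contains a load capacity $\ell\in\mathbb N$ and demands $\Lambda\colon C\to\mathbb N^+$; the additional constraint is $\sum_{c\in A^{ -1}(i)}\Lambda(c)\le\ell$ for every $i\in[k']$. GasCVRP (Gas-Capacitated Vehicle Routing Problem): the instance additionally contains a gas capacity $g\in\mathbb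 N$; the additional constraint is $w(p)\le g$ for every $p\in R$. LoadGasCVRP: the instance additionally contains $\ell$, $\Lambda$ and $g$, and both constraints are imposed. -}

module Defs where

open import Data.Bool.Base using (Bool; true; false; if_then_else_; T)
open import Data.Bool.Properties using (T?)
open import Data.Fin.Base using (Fin)
open import Data.Fin.Properties using (_≟_)
open import Data.Fin.Subset using (Subset; _∈_; Nonempty)
open import Data.Fin.Subset.Properties using (_∈?_)
open import Data.List.Base using (List; []; _∷_; tabulate)
import Data.List.Membership.Propositional as List
open import Data.Nat.Base using (ℕ; suc; _+_; _*_; _^_; _≤_; _<_)
open import Data.Nat.Binary.Base using (ℕᵇ; zero; 2[1+_]; 1+[2_]; fromℕ)
open import Data.Nat.Properties using (+-0-monoid)
open import Data.Product.Base using (Σ-syntax; ∃-syntax; _×_)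
open import Data.Vec.Base using (lookup)
open import Relation.Binary.Construct.Closure.ReflexiveTransitive using (Star; ε; _◅_)
open import Relation.Binary.PropositionalEquality.Core using (_≡_)
open import Relation.Nullary.Decidable.Core using (Dec; yes; no; does)
open import Relation.Nullary.Negation.Core using (¬_)
open import Relation.Nullary.Reflects using (Reflects)

open import Algebra.Properties.Monoid.Sum +-0-monoid using (sum)

------------------------------------------------------------------------
-- Model of computation: while-programs over binary trees (Jones' language
-- WHILE, see "Computability and Complexity from a Programming Perspective"),
-- written without variables, as programs transforming a single tree.
--
-- Every evaluation step has cost one.  Since subtrees can be shared, each
-- step takes constant time on a pointer machine and allocates at most one
-- node, so running times agree with those of Turing machines up to a
-- polynomial.

infixr 5 _∙_

data Tree : Set where
  leaf : Tree
  _∙_  : Tree → Tree → Tree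

size : Tree → ℕ
size leaf    = 1
size (x ∙ y) = suc (size x + size y)

infixr 4 _⨾_

data Program : Set where
  self       : Program
  nil        : Program
  left right : Program
  cons       : Program → Program → Program
  _⨾_        : Program → Program → Program
  cond       : Program → Program → Program → Program
  while      : Program → Program → Program

private
  variable
    b p q         : Program
    x y z u v     : Tree
    m n o         : ℕ

infix 3 _⊢_⇓_[_]

-- p ⊢ x ⇓ y [ t ]: on input x, the program p halts with output y after
-- exactly t steps.  As a test, leaf counts as false and any other tree as
-- true.

data _⊢_⇓_[_] : Program → Tree → Tree → ℕ → Set where

  self : self ⊢ x ⇓ x [ 1 ]

  nil : nil ⊢ x ⇓ leaf [ 1 ]

  left-∙    : left ⊢ x ∙ y ⇓ x [ 1 ]
  left-leaf : left ⊢ leaf ⇓ leaf [ 1 ]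

  right-∙    : right ⊢ x ∙ y ⇓ y [ 1 ]
  right-leaf : right ⊢ leaf ⇓ leaf [ 1 ]

  cons : p ⊢ x ⇓ y [ m ] → q ⊢ x ⇓ z [ n ] →
         cons p q ⊢ x ⇓ y ∙ z [ suc (m + n) ]

  _⨾_ : p ⊢ x ⇓ y [ m ] → q ⊢ y ⇓ z [ n ] →
        (p ⨾ q) ⊢ x ⇓ z [ suc (m + n) ]

  cond-true : b ⊢ x ⇓ u ∙ v [ m ] → p ⊢ x ⇓ y [ n ] →
              cond b p q ⊢ x ⇓ y [ suc (m + n) ]

  cond-false : b ⊢ x ⇓ leaf [ m ] → q ⊢ x ⇓ y [ n ] →
               cond b p q ⊢ x ⇓ y [ suc (m + n) ]

  while-true : b ⊢ x ⇓ u ∙ v [ m ] → p ⊢ x ⇓ y [ n ] →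
               while b p ⊢ y ⇓ z [ o ] →
               while b p ⊢ x ⇓ z [ suc (m + n + o) ]

  while-false : b ⊢ x ⇓ leaf [ m ] →
                while b p ⊢ x ⇓ x [ suc m ]

------------------------------------------------------------------------
-- Encodings as trees

encodeBool : Bool → Tree
encodeBool false = leaf
encodeBool true  = leaf ∙ leaf

-- Numbers are written in (bijective) binary, least significant digit first,
-- so the size of the encoding is logarithmic in the number.

encodeℕᵇ : ℕᵇ → Tree
encodeℕᵇ zero     = leaf
encodeℕᵇ 2[1+ n ] = encodeBool false ∙ encodeℕᵇ n
encodeℕᵇ 1+[2 n ] = encodeBool true ∙ encodeℕᵇ n

encodeℕ : ℕ → Tree
encodeℕ n = encodeℕᵇ (fromℕ n)

encodeList : List Tree → Tree
encodeList []       = leaf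
encodeList (x ∷ xs) = x ∙ encodeList xs

encodeTable : ∀ {n} → (Fin n → Tree) → Tree
encodeTable f = encodeList (tabulate f)

encodeSubset : ∀ {n} → Subset n → Tree
encodeSubset S = encodeTable λ i → encodeBool (lookup S i)

-- A number that is present only if A holds.
encodeOptional : {A : Set} → Dec A → (A → ℕ) → Tree
encodeOptional (yes a) f = leaf ∙ encodeℕ (f a)
encodeOptional (no _)  f = leaf

------------------------------------------------------------------------
-- Decision problems and fixed-parameter tractability

record Problem : Set₁ where
  field
    Instance : Set
    encode   : Instance → Tree
    Yes      : Instance → Set

open Problem

Computable : (ℕ → ℕ) → Set
Computable f = ∃[ p ] ∀ n → ∃[ t ] (p ⊢ encodeℕ n ⇓ encodeℕ (f n) [ t ])

FPT : (P : Problem) → (Instance P → ℕ) → Set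
FPT P κ =
  ∃[ p ] ∃[ f ] ∃[ c ] Computable f ×
  (∀ (I : Instance P) → ∃[ answer ] ∃[ t ]
    (p ⊢ encode P I ⇓ encodeBool answer [ t ]) ×
    Reflects (Yes P I) answer ×
    t ≤ f (κ I) * size (encode P I) ^ c)

------------------------------------------------------------------------
-- Finite simple undirected graphs with edge weights

record Graph : Set where
  field
    order : ℕ

  V : Set
  V = Fin order

  field
    adjacent : V → V → Bool

  infix 4 _~_
  _~_ : V → V → Set
  u ~ v = T (adjacent u v)

  field
    ~-sym    : ∀ {u v} → u ~ v → v ~ u
    ~-irrefl : ∀ {v} → ¬ v ~ v

  Walk : V → V → Set
  Walk = Star _~_

  vertices : ∀ {u v} → Walk u v → List V
  vertices {u} ε       = u ∷ []
  vertices {u} (_ ◅ p) = u ∷ vertices p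

  infix 4 _on_
  _on_ : ∀ {u v} → V → Walk u v → Set
  c on p = c List.∈ vertices p

record WeightedGraph : Set where
  field
    graph : Graph

  open Graph graph public

  field
    weight     : ∀ {u v} → u ~ v → ℕ
    weight-sym : ∀ {u v} (e : u ~ v) → weight (~-sym e) ≡ weight e

  walkWeight : ∀ {u v} → Walk u v → ℕ
  walkWeight ε       = 0
  walkWeight (e ◅ p) = weight e + walkWeight p

  -- The adjacency matrix, with the weight attached to each edge.
  encodeGraph : Tree
  encodeGraph = encodeTable λ u → encodeTable λ v →
    encodeOptional (T? (adjacent u v)) weight

------------------------------------------------------------------------
-- Vehicle routing

record CVRPInstance : Set where
  field
    weightedGraph : WeightedGraph

  open WeightedGraph weightedGraph public

  field
    D          : Subset order
    D-nonempty : Nonempty D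
    C          : Subset order
    k          : ℕ
    r          : ℕ

  encodeCVRP : Tree
  encodeCVRP = encodeList
    (encodeGraph ∷ encodeSubset D ∷ encodeSubset C ∷ encodeℕ k ∷ encodeℕ r ∷ [])

-- Routings, without any capacity constraints.  The walks form a family, so
-- that two vehicles may use the same walk.
record Routing (I : CVRPInstance) : Set where
  open CVRPInstance I
  field
    k′       : ℕ
    k′≤k     : k′ ≤ k
    start    : Fin k′ → V
    start∈D  : ∀ i → start i ∈ D
    walk     : ∀ i → Walk (start i) (start i)
    A        : ∀ c → c ∈ C → Fin k′
    A-visits : ∀ c (c∈C : c ∈ C) → c on walk (A c c∈C)

  totalWeight : ℕ
  totalWeight = sum λ i → walkWeight (walk i)

  RespectsGas : ℕ → Set
  RespectsGas g = ∀ i → walkWeight (walk i) ≤ g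

  load : (∀ c → c ∈ C → ℕ) → Fin k′ → ℕ
  load Λ i = sum λ c → contribution c (c ∈? C)
    where
    contribution : ∀ c → Dec (c ∈ C) → ℕ
    contribution c (yes c∈C) = if does (A c c∈C ≟ i) then Λ c c∈C else 0
    contribution c (no _)    = 0

  RespectsLoad : (∀ c → c ∈ C → ℕ) → ℕ → Set
  RespectsLoad Λ ℓ = ∀ i → load Λ i ≤ ℓ

record LoadCVRPInstance : Set where
  field
    cvrp : CVRPInstance

  open CVRPInstance cvrp public

  field
    ℓ   : ℕ
    Λ   : ∀ c → c ∈ C → ℕ
    Λ>0 : ∀ c (c∈C : c ∈ C) → 0 < Λ c c∈C

  encodeLoadCVRP : Tree
  encodeLoadCVRP = encodeList
    (encodeCVRP ∷ encodeℕ ℓ ∷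
     encodeTable (λ c → encodeOptional (c ∈? C) (Λ c)) ∷ [])

record GasCVRPInstance : Set where
  field
    cvrp : CVRPInstance
    g    : ℕ

  open CVRPInstance cvrp public

  encodeGasCVRP : Tree
  encodeGasCVRP = encodeList (encodeCVRP ∷ encodeℕ g ∷ [])

record LoadGasCVRPInstance : Set where
  field
    loadCVRP : LoadCVRPInstance
    g        : ℕ

  open LoadCVRPInstance loadCVRP public

  encodeLoadGasCVRP : Tree
  encodeLoadGasCVRP = encodeList (encodeLoadCVRP ∷ encodeℕ g ∷ [])

LoadCVRP : Problem
LoadCVRP = record
  { Instance = LoadCVRPInstance
  ; encode   = LoadCVRPInstance.encodeLoadCVRP
  ; Yes      = λ I → let open LoadCVRPInstance I; open Routing in
      Σ[ R ∈ Routing cvrp ] RespectsLoad R Λ ℓ × totalWeight R ≤ r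
  }

GasCVRP : Problem
GasCVRP = record
  { Instance = GasCVRPInstance
  ; encode   = GasCVRPInstance.encodeGasCVRP
  ; Yes      = λ I → let open GasCVRPInstance I; open Routing in
      Σ[ R ∈ Routing cvrp ] RespectsGas R g × totalWeight R ≤ r
  }

LoadGasCVRP : Problem
LoadGasCVRP = record
  { Instance = LoadGasCVRPInstance
  ; encode   = LoadGasCVRPInstance.encodeLoadGasCVRP
  ; Yes      = λ I → let open LoadGasCVRPInstance I; open Routing in
      Σ[ R ∈ Routing cvrp ]
        RespectsLoad R Λ ℓ × RespectsGas R g × totalWeight R ≤ r
  }

{-# OPTIONS --safe #-}
-- Distances are computed by the Floyd–Warshall algorithm. A feasible routing only matters through the order in
-- which each vehicle first visits the stops assigned to it, so it may be replaced by shortest walks between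
-- consecutive stops, and brute force over all sequences of stops finds it. For a load capacity all clients
-- are stops; as demands are positive, a vehicle serves at most ℓ of them. For a gas capacity, clients at distance
-- 0 from each other can be served by a free detour, so it suffices to visit representatives at pairwise positive
-- distance, of which a vehicle visits at most g + 1. In either case the number of candidates is bounded in terms
-- of the parameter. Since gas capacities above the total budget r are no restriction, LoadCVRP is the case g = r
-- of LoadGasCVRP.
--
-- Running in time polynomial in a given measure, with polynomially large outputs, is a property closed under
-- composition, case distinction and folds whose accumulators stay small. With a measure exponential in the
-- parameter this covers the brute-force search.
module Submission where

open import Data.Bool.Base using (Bool; true; false; if_then_else_; _∧_; _∨_; T)
open import Data.Bool.ListAction using (any; all)
open import Data.Bool.Properties using (T?; T-∧; T-≡; T-irrelevant; if-float; ∧-assoc; ∨-assoc; ∧-identityʳ; ∨-identityʳ)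
open import Data.Empty using (⊥; ⊥-elim)
open import Data.Fin.Base using (Fin; zero; suc; toℕ)
open import Data.Fin.Properties as Fin using (all?; toℕ≤pred[n]; toℕ<n; toℕ-injective)
open import Data.Fin.Subset using (Subset) renaming (_∈_ to _∈ˢ_)
open import Data.Fin.Subset.Properties using (_∈?_)
open import Data.List.Base using (List; []; _∷_; _++_; _ʳ++_; allFin; applyUpTo; cartesianProductWith; concatMap; drop; filterᵇ; foldl; foldr; length; lookup; map; replicate; reverse; tabulate; upTo)
open import Data.List.Membership.Propositional using (_∈_; find)
open import Data.List.Membership.Propositional.Properties using (∈-allFin; ∈-cartesianProductWith⁺; ∈-cartesianProductWith⁻; ∈-filter⁺; ∈-filter⁻; ∈-lookup; ∈-tabulate⁺)
open import Data.List.Properties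
open import Data.List.Relation.Binary.Permutation.Propositional using (_↭_; ↭-refl; ↭-trans; ↭-sym; ↭⇒↭ₛ; prep)
open import Data.List.Relation.Binary.Permutation.Propositional.Properties using (All-resp-↭; shift; ↭-length; ∈-resp-↭; map⁺; ++⁺ˡ)
open import Data.List.Relation.Binary.Permutation.Setoid.Properties using (AllPairs-resp-↭)
open import Data.List.Relation.Unary.All as All using (All; []; _∷_)
open import Data.List.Relation.Unary.All.Properties as All using (all⁺; all⁻)
open import Data.List.Relation.Unary.AllPairs using (AllPairs; []; _∷_)
import Data.List.Relation.Unary.AllPairs.Properties as AllPairs
open import Data.List.Relation.Unary.Any as Any using (Any; here; there)
open import Data.List.Relation.Unary.Any.Properties as Any using (any⁺; any⁻; lookup-index)
open import Data.Nat.Base using (ℕ; zero; suc; _+_; _*_; _^_; _∸_; _≤_; _<_; _≤ᵇ_; _⊔_; _⊓_; z≤n; s≤s)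
open import Data.Nat.Binary.Base as Bin using (ℕᵇ; 2[1+_]; 1+[2_])
open import Data.Nat.Binary.Properties using (toℕ-fromℕ; fromℕ-toℕ)
open import Data.Nat.ListAction using () renaming (sum to sumᴸ)
open import Data.Nat.ListAction.Properties using (sum-↭)
open import Data.Nat.Properties
open import Data.Nat.Tactic.RingSolver using (solve-∀)
open import Data.Product.Base using (Σ; Σ-syntax; ∃-syntax; _×_; _,_; proj₁; proj₂)
open import Data.Sum.Base using (_⊎_; inj₁; inj₂)
open import Data.Unit.Base using (⊤; tt)
import Data.Vec.Base as Vec
open import Data.Vec.Properties using (lookup⇒[]=; []=⇒lookup)
open import Function.Base using (_∘_; id; flip)
open import Function.Bundles using (Equivalence)
open import Relation.Binary.Construct.Closure.ReflexiveTransitive using (ε; _◅_; _◅◅_)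
open import Relation.Binary.PropositionalEquality
open import Relation.Nullary.Decidable using (Dec; yes; no; does; toWitness; _→-dec_; _⊎-dec_; _×-dec_)
open import Relation.Nullary.Reflects using (Reflects; fromEquivalence)

open import Algebra.Properties.CommutativeMonoid.Sum +-0-commutativeMonoid using (∑-distrib-+)
open import Algebra.Properties.Monoid.Sum +-0-monoid using (sum; sum-cong-≗; sum-replicate-zero)

open import Defs

-- Programs with bounds on time and size

-- A program is fixed before its input γ, so everything a loop body reads from its surroundings has
-- to travel in the same tree; the environments `η` below play the role of closures. The delicate
-- point of every loop is its accumulator: a step that is polynomial in its input may double it, and
-- iterating that is exponential. So each kind of growth gets its own estimate: invariants (minima,
-- truth values), additive growth (lists being built), sums measured by bit length, and iterations
-- whose states are known explicitly (lists of words). The calculus only yields powers of one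
-- measure, whereas FPT asks for a product of a function of the parameter and a power of the input
-- size s. The search is therefore measured in s + 2^e, with e depending on the parameter alone, and
-- the power of this sum is split into a product at the very end. Apart from the enumeration of
-- plans and the conversion of small numbers to unary, every ingredient is polynomial in its own
-- input. Weights, demands, distances and the two capacities are compared in binary; this matters
-- for LoadGasCVRP, whose gas capacity is not part of the parameter.

suc≤2^ : ∀ m → suc m ≤ 2 ^ m
suc≤2^ zero    = ≤-refl
suc≤2^ (suc m) = ≤-trans (+-mono-≤ (m^n>0 2 m) (suc≤2^ m))
    (≤-reflexive (cong (2 ^ m +_) (sym (+-identityʳ _))))

infix 4 _≼_

-- The base 2 + μ γ is at least 2, so constants and sums are absorbed by the exponent.
record _≼_ {Γ : Set} (ν μ : Γ → ℕ) : Set where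
  constructor bounded
  field
    degree : ℕ
    bound  : ∀ γ → ν γ ≤ (2 + μ γ) ^ degree

module _ {Γ : Set} {μ : Γ → ℕ} where

  ≼-mono : {ν ν′ : Γ → ℕ} → (∀ γ → ν γ ≤ ν′ γ) → ν′ ≼ μ → ν ≼ μ
  ≼-mono ν≤ν′ (bounded c h) = bounded c λ γ → ≤-trans (ν≤ν′ γ) (h γ)

  ≼-refl : μ ≼ μ
  ≼-refl = bounded 1 λ γ → ≤-trans (m≤n+m (μ γ) 2) (≤-reflexive (sym (^-identityʳ (2 + μ γ))))

  ≼-* : {ν ν′ : Γ → ℕ} → ν ≼ μ → ν′ ≼ μ → (λ γ → ν γ * ν′ γ) ≼ μ
  ≼-* (bounded c h) (bounded c′ h′) = bounded (c + c′) λ γ →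
    ≤-trans (*-mono-≤ (h γ) (h′ γ)) (≤-reflexive (sym (^-distribˡ-+-* (2 + μ γ) c c′)))

  ≼-+ : {ν ν′ : Γ → ℕ} → ν ≼ μ → ν′ ≼ μ → (λ γ → ν γ + ν′ γ) ≼ μ
  ≼-+ {ν} {ν′} (bounded c h) (bounded c′ h′) = bounded (suc (c + c′)) λ γ → let x = 2 + μ γ in begin
    ν γ + ν′ γ                         ≤⟨ +-mono-≤ (h γ) (h′ γ) ⟩
    x ^ c + x ^ c′                     ≤⟨ +-mono-≤ (^-monoʳ-≤ x (m≤m+n c c′)) (^-monoʳ-≤ x (m≤n+m c′ c)) ⟩
    x ^ (c + c′) + x ^ (c + c′)        ≡⟨ cong (x ^ (c + c′) +_) (+-identityʳ _) ⟨
    2 * x ^ (c + c′)                   ≤⟨ *-monoˡ-≤ (x ^ (c + c′)) (m≤m+n 2 (μ γ)) ⟩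
    x * x ^ (c + c′)                   ∎
    where open ≤-Reasoning

  ≼-const : (n : ℕ) → (λ γ → n) ≼ μ
  ≼-const n = bounded n λ γ → ≤-trans (<⇒≤ (suc≤2^ n)) (^-monoˡ-≤ n (m≤m+n 2 (μ γ)))

  ≼-^ : {ν : Γ → ℕ} → ν ≼ μ → (d : ℕ) → (λ γ → ν γ ^ d) ≼ μ
  ≼-^ {ν} (bounded c h) d = bounded (c * d) λ γ →
    ≤-trans (^-monoˡ-≤ d (h γ)) (≤-reflexive (^-*-assoc (2 + μ γ) c d))

  ≼-suc : {ν : Γ → ℕ} → ν ≼ μ → (λ γ → suc (ν γ)) ≼ μ
  ≼-suc p = ≼-+ (≼-const 1) p

≼-trans : {Γ : Set} {ν μ π : Γ → ℕ} → ν ≼ μ → μ ≼ π → ν ≼ π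
≼-trans (bounded c h) q = ≼-mono h (≼-^ (≼-+ (≼-const 2) q) c)

≼-∘ : {Γ Δ : Set} {ν μ : Γ → ℕ} (s : Δ → Γ) → ν ≼ μ → (ν ∘ s) ≼ (μ ∘ s)
≼-∘ s (bounded c h) = bounded c λ δ → h (s δ)

-- Sizes are bounded separately from times: sharing lets trees grow exponentially in the running time.
record Feasible {Γ : Set} (ρ : Γ → Tree) (μ : Γ → ℕ) (τ : Γ → Tree) : Set where
  constructor feasible
  field
    program : Program
    time    : Γ → ℕ
    runs    : ∀ γ → program ⊢ ρ γ ⇓ τ γ [ time γ ]
    time≼   : time ≼ μ
    size≼   : (λ γ → size (τ γ)) ≼ μ

open Feasible public

-- Measuring a program in the size of its own input makes it a subroutine for any measure: in `_⟫_`,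
-- the size bound of the preceding program converts the time bound of the subroutine.
Poly : {Γ : Set} (ρ τ : Γ → Tree) → Set
Poly ρ τ = Feasible ρ (λ γ → size (ρ γ)) τ

leftT : Tree → Tree
leftT leaf    = leaf
leftT (x ∙ y) = x

rightT : Tree → Tree
rightT leaf    = leaf
rightT (x ∙ y) = y

caseT : Tree → Tree → Tree → Tree
caseT leaf    x y = y
caseT (_ ∙ _) x y = x

size>0 : ∀ t → 1 ≤ size t
size>0 leaf    = s≤s z≤n
size>0 (x ∙ y) = s≤s z≤n

size-leftT : ∀ t → size (leftT t) ≤ size t
size-leftT leaf    = ≤-refl
size-leftT (x ∙ y) = ≤-trans (m≤m+n (size x) (size y)) (n≤1+n _)

size-rightT : ∀ t → size (rightT t) ≤ size t
size-rightT leaf    = ≤-refl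
size-rightT (x ∙ y) = ≤-trans (m≤n+m (size y) (size x)) (n≤1+n _)

module _ {Γ : Set} {ρ : Γ → Tree} {μ : Γ → ℕ} where

  retarget : {τ τ′ : Γ → Tree} → (∀ γ → τ γ ≡ τ′ γ) → Feasible ρ μ τ → Feasible ρ μ τ′
  retarget eq (feasible p t r t≼ s≼) = feasible p t
    (λ γ → subst (λ y → p ⊢ ρ γ ⇓ y [ t γ ]) (eq γ) (r γ)) t≼
    (≼-mono (λ γ → ≤-reflexive (cong size (sym (eq γ)))) s≼)

  selfᶠ : (λ γ → size (ρ γ)) ≼ μ → Feasible ρ μ ρ
  selfᶠ ρ≼μ = feasible self (λ _ → 1) (λ _ → self) (≼-const 1) ρ≼μ

  nilᶠ : Feasible ρ μ (λ _ → leaf)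
  nilᶠ = feasible nil (λ _ → 1) (λ _ → nil) (≼-const 1) (≼-const 1)

  consᶠ : {τ τ′ : Γ → Tree} → Feasible ρ μ τ → Feasible ρ μ τ′ → Feasible ρ μ (λ γ → τ γ ∙ τ′ γ)
  consᶠ (feasible p t r t≼ s≼) (feasible p′ t′ r′ t≼′ s≼′) = feasible (cons p p′)
    (λ γ → suc (t γ + t′ γ)) (λ γ → cons (r γ) (r′ γ)) (≼-suc (≼-+ t≼ t≼′)) (≼-suc (≼-+ s≼ s≼′))

  sequence : {σ τ : Γ → Tree} {ν : Γ → ℕ} → ν ≼ μ → Feasible ρ μ σ → Feasible σ ν τ → Feasible ρ μ τ
  sequence ν≼μ (feasible p t r t≼ s≼) (feasible p′ t′ r′ t≼′ s≼′) = feasible (p ⨾ p′)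
    (λ γ → suc (t γ + t′ γ)) (λ γ → r γ ⨾ r′ γ) (≼-suc (≼-+ t≼ (≼-trans t≼′ ν≼μ))) (≼-trans s≼′ ν≼μ)

  infixl 5 _⟫_
  _⟫_ : {σ τ : Γ → Tree} → Feasible ρ μ σ → Poly σ τ → Feasible ρ μ τ
  p ⟫ q = sequence (size≼ p) p q

  leftᶠ : {τ : Γ → Tree} → Feasible ρ μ τ → Feasible ρ μ (λ γ → leftT (τ γ))
  leftᶠ {τ} p = p ⟫ feasible left (λ _ → 1) (λ γ → run (τ γ)) (≼-const 1)
    (≼-mono (λ γ → size-leftT (τ γ)) ≼-refl)
    where
    run : ∀ x → left ⊢ x ⇓ leftT x [ 1 ]
    run leaf    = left-leaf
    run (_ ∙ _) = left-∙

  rightᶠ : {τ : Γ → Tree} → Feasible ρ μ τ → Feasible ρ μ (λ γ → rightT (τ γ))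
  rightᶠ {τ} p = p ⟫ feasible right (λ _ → 1) (λ γ → run (τ γ)) (≼-const 1)
    (≼-mono (λ γ → size-rightT (τ γ)) ≼-refl)
    where
    run : ∀ x → right ⊢ x ⇓ rightT x [ 1 ]
    run leaf    = right-leaf
    run (_ ∙ _) = right-∙

  caseᶠ : {β τ τ′ : Γ → Tree} → Feasible ρ μ β → Feasible ρ μ τ → Feasible ρ μ τ′ →
          Feasible ρ μ (λ γ → caseT (β γ) (τ γ) (τ′ γ))
  caseᶠ {β} {τ} {τ′} (feasible b u s u≼ _) (feasible p t r t≼ s≼) (feasible p′ t′ r′ t≼′ s≼′) =
    feasible (cond b p p′)
    (λ γ → suc (u γ + pick (β γ) (t γ) (t′ γ)))
    (λ γ → run (β γ) (s γ) (r γ) (r′ γ))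
    (≼-suc (≼-+ u≼ (≼-mono (λ γ → pick≤ (β γ)) (≼-+ t≼ t≼′))))
    (≼-mono (λ γ → size≤ (β γ)) (≼-+ s≼ s≼′))
    where
    pick : Tree → ℕ → ℕ → ℕ
    pick leaf    m n = n
    pick (_ ∙ _) m n = m

    pick≤ : ∀ x {m n} → pick x m n ≤ m + n
    pick≤ leaf    = m≤n+m _ _
    pick≤ (_ ∙ _) = m≤m+n _ _

    size≤ : ∀ x {y z} → size (caseT x y z) ≤ size y + size z
    size≤ leaf    = m≤n+m _ _
    size≤ (_ ∙ _) = m≤m+n _ _

    run : ∀ z {x y y′ m n n′} → b ⊢ x ⇓ z [ m ] → p ⊢ x ⇓ y [ n ] → p′ ⊢ x ⇓ y′ [ n′ ] →
          cond b p p′ ⊢ x ⇓ caseT z y y′ [ suc (m + pick z n n′) ]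
    run leaf    d e e′ = cond-false d e′
    run (_ ∙ _) d e e′ = cond-true d e

-- The program stays the same; only the family of inputs is reindexed. Typically `s` forgets the
-- parts of a context that a subroutine does not read.
pull : {Γ Δ : Set} {ρ τ : Γ → Tree} {μ : Γ → ℕ} (s : Δ → Γ) →
       Feasible ρ μ τ → Feasible (λ δ → ρ (s δ)) (λ δ → μ (s δ)) (λ δ → τ (s δ))
pull s (feasible p t r t≼ s≼) = feasible p (λ δ → t (s δ)) (λ δ → r (s δ)) (≼-∘ s t≼) (≼-∘ s s≼)

constᶠ : {Γ : Set} {ρ : Γ → Tree} {μ : Γ → ℕ} (x : Tree) → Feasible ρ μ (λ _ → x)
constᶠ leaf    = nilᶠ
constᶠ (x ∙ y) = consᶠ (constᶠ x) (constᶠ y)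

encList : {A : Set} → (A → Tree) → List A → Tree
encList enc xs = encodeList (map enc xs)

-- The largest size of an accumulator during the fold. Bounding the final result would not be
-- enough, since every intermediate accumulator is an input of `step`.
peak : {A B : Set} → (B → Tree) → (B → A → B) → B → List A → ℕ
peak enc step b []       = size (enc b)
peak enc step b (x ∷ xs) = size (enc b) ⊔ peak enc step (step b x) xs

head≤peak : {A B : Set} (enc : B → Tree) (step : B → A → B) (b : B) (xs : List A) →
            size (enc b) ≤ peak enc step b xs
head≤peak enc step b []       = ≤-refl
head≤peak enc step b (x ∷ xs) = m≤m⊔n _ _

foldl≤peak : {A B : Set} (enc : B → Tree) (step : B → A → B) (b : B) (xs : List A) →
             size (enc (foldl step b xs)) ≤ peak enc step b xs
foldl≤peak enc step b []       = ≤-refl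
foldl≤peak enc step b (x ∷ xs) = ≤-trans (foldl≤peak enc step (step b x) xs) (m≤n⊔m _ _)

length≤size : {A : Set} (enc : A → Tree) (xs : List A) → length xs ≤ size (encList enc xs)
length≤size enc []       = z≤n
length≤size enc (x ∷ xs) = s≤s (≤-trans (length≤size enc xs) (m≤n+m _ _))

module _ {Γ : Set} {ρ η : Γ → Tree} {μ : Γ → ℕ} {A B : Γ → Set}
         (encA : ∀ γ → A γ → Tree) (encB : ∀ γ → B γ → Tree)
         (step : ∀ γ → B γ → A γ → B γ) (init : ∀ γ → B γ) (xs : ∀ γ → List (A γ)) where

  -- A while loop on trees of the form environment, accumulator, remaining list; the test reads the
  -- remaining list, which is a leaf exactly when it is empty. Every input of the step program is
  -- bounded by the environment, the peak and the whole list, so one polynomial bounds all rounds,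
  -- and there are as many rounds as list entries.
  foldᶠ : Feasible ρ μ η → Feasible ρ μ (λ γ → encB γ (init γ)) →
          Feasible ρ μ (λ γ → encList (encA γ) (xs γ)) →
          Poly {Σ[ γ ∈ Γ ] B γ × A γ} (λ (γ , b , a) → (η γ ∙ encB γ b) ∙ encA γ a)
                                      (λ (γ , b , a) → encB γ (step γ b a)) →
          (λ γ → peak (encB γ) (step γ) (init γ) (xs γ)) ≼ μ →
          Feasible ρ μ (λ γ → encB γ (foldl (step γ) (init γ) (xs γ)))
  foldᶠ env i l (feasible p t r (bounded c t≤) _) peak≼ =
    sequence ≼-refl (consᶠ env (consᶠ i l))
      (feasible (while test body ⨾ right ⨾ left)
        (λ γ → suc (loop γ (init γ) (xs γ) + 3))
        (λ γ → runs-loop γ (init γ) (xs γ) ⨾ (right-∙ ⨾ left-∙))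
        (≼-suc (≼-+ (≼-mono (λ γ → loop≤ γ (init γ) (xs γ)) loopBound≼) (≼-const 3)))
        (≼-mono (λ γ → foldl≤peak (encB γ) (step γ) (init γ) (xs γ)) peak≼))
    where
    test body : Program
    test = right ⨾ right
    body = cons left (cons (cons (cons left (right ⨾ left)) (right ⨾ right ⨾ left) ⨾ p)
        (right ⨾ right ⨾ right))

    state : ∀ γ → B γ → List (A γ) → Tree
    state γ b as = η γ ∙ encB γ b ∙ encList (encA γ) as

    iteration : ∀ γ → B γ → A γ → ℕ
    iteration γ b a = suc (1 + suc (suc (suc (suc (1 + 3) + 5) + t (γ , b , a)) + 5))

    loop : ∀ γ → B γ → List (A γ) → ℕ
    loop γ b []       = 4
    loop γ b (a ∷ as) = suc (3 + iteration γ b a + loop γ (step γ b a) as)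

    runs-loop : ∀ γ b as → while test body ⊢ state γ b as ⇓ state γ (foldl (step γ) b as) [] [ loop γ b as ]
    runs-loop γ b []       = while-false (right-∙ ⨾ right-∙)
    runs-loop γ b (a ∷ as) = while-true (right-∙ ⨾ right-∙)
      (cons left-∙ (cons (cons (cons left-∙ (right-∙ ⨾ left-∙)) (right-∙ ⨾ (right-∙ ⨾ left-∙)) ⨾ r
                         (γ , b , a))
                         (right-∙ ⨾ (right-∙ ⨾ right-∙))))
      (runs-loop γ (step γ b a) as)

    stepBound : ∀ γ → B γ → List (A γ) → ℕ
    stepBound γ b as = (4 + (size (η γ) + peak (encB γ) (step γ) b as + size (encList (encA γ) as))) ^ c

    -- Besides the call of `p`, a round costs 24 steps: 4 for the test and the while rule, 20 for
    -- the rest of `body`. The leading 4 is the cost of the final, failing test.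
    loopBound : ∀ γ → B γ → List (A γ) → ℕ
    loopBound γ b as = 4 + length as * (24 + stepBound γ b as)

    stepBound-head : ∀ γ b a as → t (γ , b , a) ≤ stepBound γ b (a ∷ as)
    stepBound-head γ b a as = ≤-trans (t≤ (γ , b , a)) (^-monoˡ-≤ c (s≤s (s≤s (s≤s (begin
      suc (size (η γ) + size (encB γ b)) + size (encA γ a)
        ≤⟨ s≤s (+-mono-≤ (+-monoʳ-≤ (size (η γ)) (head≤peak (encB γ) (step γ) b (a ∷ as)))
                (≤-trans (m≤m+n _ _) (n≤1+n _))) ⟩
      suc (size (η γ) + peak (encB γ) (step γ) b (a ∷ as) + size (encList (encA γ) (a ∷ as))) ∎)))))
      where open ≤-Reasoning

    stepBound-tail : ∀ γ b a as → stepBound γ (step γ b a) as ≤ stepBound γ b (a ∷ as)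
    stepBound-tail γ b a as = ^-monoˡ-≤ c (+-monoʳ-≤ 4 (+-mono-≤ (+-monoʳ-≤ (size (η γ)) (m≤n⊔m _ _))
      (≤-trans (m≤n+m _ _) (n≤1+n _))))

    loop≤ : ∀ γ b as → loop γ b as ≤ loopBound γ b as
    loop≤ γ b []       = ≤-refl
    loop≤ γ b (a ∷ as) = begin
      suc (3 + iteration γ b a + loop γ (step γ b a) as)
        ≤⟨ s≤s (+-monoʳ-≤ (3 + iteration γ b a) (loop≤ γ (step γ b a) as)) ⟩
      suc (3 + iteration γ b a + (4 + length as * (24 + stepBound γ (step γ b a) as)))
        ≡⟨ arithmetic (t (γ , b , a)) _ ⟩
      4 + (24 + t (γ , b , a) + length as * (24 + stepBound γ (step γ b a) as))
        ≤⟨ +-monoʳ-≤ 4 (+-mono-≤ (+-monoʳ-≤ 24 (stepBound-head γ b a as))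
             (*-monoʳ-≤ (length as) (+-monoʳ-≤ 24 (stepBound-tail γ b a as)))) ⟩
      4 + suc (length as) * (24 + stepBound γ b (a ∷ as)) ∎
      where
      open ≤-Reasoning
      arithmetic : ∀ s w → suc (3 + suc (1 + suc (suc (suc (suc (1 + 3) + 5) + s) + 5)) + (4 + w)) ≡ 4 +
          (24 + s + w)
      arithmetic = solve-∀

    loopBound≼ : (λ γ → loopBound γ (init γ) (xs γ)) ≼ μ
    loopBound≼ = ≼-+ (≼-const 4) (≼-* (≼-mono (λ γ → length≤size (encA γ) (xs γ)) (size≼ l))
      (≼-+ (≼-const 24) (≼-^ (≼-+ (≼-const 4) (≼-+ (≼-+ (size≼ env) peak≼) (size≼ l))) c)))

-- Lists, tables and unary numbers

it : {Γ : Set} {ρ : Γ → Tree} → Poly ρ ρ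
it = selfᶠ ≼-refl

peak-invariant : {A B : Set} (enc : B → Tree) (step : B → A → B) (P : B → Set) (N : ℕ) →
                 (∀ b a → P b → P (step b a)) → (∀ b → P b → size (enc b) ≤ N) →
                 ∀ b xs → P b → peak enc step b xs ≤ N
peak-invariant enc step P N preserved small b []       Pb = small b Pb
peak-invariant enc step P N preserved small b (x ∷ xs) Pb =
  ⊔-lub (small b Pb) (peak-invariant enc step P N preserved small (step b x) xs (preserved b x Pb))

peak-additive : {A B : Set} (enc : B → Tree) (step : B → A → B) (δ : ℕ) (b : B) (xs : List A) →
                All (λ a → ∀ b → size (enc (step b a)) ≤ size (enc b) + δ) xs →
                peak enc step b xs ≤ size (enc b) + length xs * δ
peak-additive enc step δ b []       []       = ≤-reflexive (sym (+-identityʳ _))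
peak-additive enc step δ b (x ∷ xs) (h ∷ hs) = ⊔-lub (m≤m+n _ _) (begin
  peak enc step (step b x) xs                 ≤⟨ peak-additive enc step δ (step b x) xs hs ⟩
  size (enc (step b x)) + length xs * δ       ≤⟨ +-monoˡ-≤ (length xs * δ) (h b) ⟩
  size (enc b) + δ + length xs * δ            ≡⟨ +-assoc (size (enc b)) δ _ ⟩
  size (enc b) + length (x ∷ xs) * δ          ∎)
  where open ≤-Reasoning

all-size≤ : {A : Set} (enc : A → Tree) (xs : List A) → All (λ a → size (enc a) ≤ size (encList enc xs)) xs
all-size≤ enc []       = []
all-size≤ enc (x ∷ xs) = ≤-trans (m≤m+n _ _) (n≤1+n _) ∷
  All.map (λ h → ≤-trans h (≤-trans (m≤n+m _ _) (n≤1+n _))) (all-size≤ enc xs)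

module _ {Γ : Set} {ρ η : Γ → Tree} {μ : Γ → ℕ} {A B : Γ → Set}
         (encA : ∀ γ → A γ → Tree) (encB : ∀ γ → B γ → Tree)
         (step : ∀ γ → B γ → A γ → B γ) (init : ∀ γ → B γ) (xs : ∀ γ → List (A γ)) where

  -- The increment `δ` depends on the list entry but not on the accumulator, so over the whole loop
  -- the increments add up instead of compounding. Entries are no larger than the encoded list,
  -- which gives one increment `Δ` for all of them.
  foldᶠ-additive : Feasible ρ μ η → Feasible ρ μ (λ γ → encB γ (init γ)) →
          Feasible ρ μ (λ γ → encList (encA γ) (xs γ)) →
          Poly {Σ[ γ ∈ Γ ] B γ × A γ} (λ (γ , b , a) → (η γ ∙ encB γ b) ∙ encA γ a)
                                      (λ (γ , b , a) → encB γ (step γ b a)) →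
          {δ : Σ[ γ ∈ Γ ] A γ → ℕ} → δ ≼ (λ (γ , a) → size (η γ ∙ encA γ a)) →
          (∀ γ b a → size (encB γ (step γ b a)) ≤ size (encB γ b) + δ (γ , a)) →
          Feasible ρ μ (λ γ → encB γ (foldl (step γ) (init γ) (xs γ)))
  foldᶠ-additive env i l p {δ} (bounded c δ≤) h =
    foldᶠ encA encB step init xs env i l p
      (≼-mono (λ γ → peak-additive (encB γ) (step γ) (Δ γ) (init γ) (xs γ)
                 (All.map (λ {a} a≤ b → ≤-trans (h γ b a) (+-monoʳ-≤ (size (encB γ b)) (δ≤Δ γ a a≤)))
                   (all-size≤ (encA γ) (xs γ))))
        (≼-+ (size≼ i) (≼-* (≼-mono (λ γ → length≤size (encA γ) (xs γ)) (size≼ l))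
          (≼-^ (≼-+ (≼-const 3) (≼-+ (size≼ env) (size≼ l))) c))))
    where
    Δ : Γ → ℕ
    Δ γ = (3 + (size (η γ) + size (encList (encA γ) (xs γ)))) ^ c

    δ≤Δ : ∀ γ a → size (encA γ a) ≤ size (encList (encA γ) (xs γ)) → δ (γ , a) ≤ Δ γ
    δ≤Δ γ a a≤ = ≤-trans (δ≤ (γ , a)) (^-monoˡ-≤ c (+-monoʳ-≤ 3 (+-monoʳ-≤ (size (η γ)) a≤)))

ʳ++ᶠ : {Γ : Set} {ρ : Γ → Tree} {μ : Γ → ℕ} {A : Γ → Set} (enc : ∀ γ → A γ → Tree)
       (xs ys : ∀ γ → List (A γ)) →
       Feasible ρ μ (λ γ → encList (enc γ) (xs γ)) → Feasible ρ μ (λ γ → encList (enc γ) (ys γ)) →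
       Feasible ρ μ (λ γ → encList (enc γ) (xs γ ʳ++ ys γ))
ʳ++ᶠ enc xs ys p q =
  foldᶠ-additive {η = λ _ → leaf} enc (λ γ → encList (enc γ)) (λ γ → flip _∷_) ys xs nilᶠ q p
  (consᶠ (rightᶠ it) (rightᶠ (leftᶠ it)))
  {δ = λ (γ , a) → suc (size (enc γ a))} (≼-mono (λ _ → n≤1+n _) ≼-refl)
  (λ γ b a → ≤-reflexive (+-comm (suc (size (enc γ a))) _))

reverseᶠ : {Γ : Set} {ρ : Γ → Tree} {μ : Γ → ℕ} {A : Γ → Set} (enc : ∀ γ → A γ → Tree)
           (xs : ∀ γ → List (A γ)) →
           Feasible ρ μ (λ γ → encList (enc γ) (xs γ)) → Feasible ρ μ (λ γ → encList (enc γ) (reverse (xs γ)))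
reverseᶠ enc xs p = ʳ++ᶠ enc xs (λ _ → []) p nilᶠ

encList-id : (ts : List Tree) → encList id ts ≡ encodeList ts
encList-id ts = cong encodeList (map-id ts)

foldl-∷ : {A B : Set} (f : A → B) (xs : List A) (ys : List B) →
            foldl (λ ys x → f x ∷ ys) ys xs ≡ map f xs ʳ++ ys
foldl-∷ f []       ys = refl
foldl-∷ f (x ∷ xs) ys = foldl-∷ f xs (f x ∷ ys)

-- The loop prepends each result to its accumulator, which produces the list backwards; a second
-- pass reverses it. `filterᶠ` and `concatMapᶠ` proceed in the same way.
mapᶠ : {Γ : Set} {ρ η : Γ → Tree} {μ : Γ → ℕ} {A : Γ → Set} (enc : ∀ γ → A γ → Tree) (xs : ∀ γ → List (A γ))
       {τ : Σ Γ A → Tree} →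
       Feasible ρ μ η → Feasible ρ μ (λ γ → encList (enc γ) (xs γ)) →
       Poly {Σ Γ A} (λ (γ , a) → η γ ∙ enc γ a) τ →
       Feasible ρ μ (λ γ → encodeList (map (λ a → τ (γ , a)) (xs γ)))
mapᶠ {Γ} {ρ} {η} {μ} {A} enc xs {τ} env l p =
  retarget (λ γ → trans (encList-id _)
      (cong encodeList (trans (cong reverse (foldl-∷ (λ a → τ (γ , a)) (xs γ) []))
      (reverse-involutive (map (λ a → τ (γ , a)) (xs γ))))))
    (reverseᶠ (λ γ → id) backwards
      (foldᶠ-additive enc (λ γ → encList id) step (λ γ → []) xs env nilᶠ l
        (consᶠ (consᶠ (leftᶠ (leftᶠ it)) (rightᶠ it) ⟫ pull (λ (γ , ts , a) → γ , a) p) (rightᶠ (leftᶠ it)))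
        {δ = λ (γ , a) → suc (size (τ (γ , a)))} (≼-suc (size≼ p))
        (λ γ ts a → ≤-reflexive (+-comm (suc (size (τ (γ , a)))) _))))
  where
  step : ∀ γ → List Tree → A γ → List Tree
  step γ ts a = τ (γ , a) ∷ ts

  backwards : Γ → List Tree
  backwards γ = foldl (step γ) [] (xs γ)

ifᶠ : {Γ : Set} {ρ : Γ → Tree} {μ : Γ → ℕ} {b : Γ → Bool} {τ τ′ : Γ → Tree} →
      Feasible ρ μ (λ γ → encodeBool (b γ)) → Feasible ρ μ τ → Feasible ρ μ τ′ →
      Feasible ρ μ (λ γ → if b γ then τ γ else τ′ γ)
ifᶠ {b = b} p q r = retarget (λ γ → lemma (b γ)) (caseᶠ p q r)
  where
  lemma : ∀ c {x y} → caseT (encodeBool c) x y ≡ (if c then x else y)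
  lemma false = refl
  lemma true  = refl

ifᶠ′ : {Γ : Set} {ρ : Γ → Tree} {μ : Γ → ℕ} {A : Γ → Set} (enc : ∀ γ → A γ → Tree) {b : Γ →
       Bool} {x y : ∀ γ → A γ} →
       Feasible ρ μ (λ γ → encodeBool (b γ)) → Feasible ρ μ (λ γ → enc γ (x γ)) →
       Feasible ρ μ (λ γ → enc γ (y γ)) →
       Feasible ρ μ (λ γ → enc γ (if b γ then x γ else y γ))
ifᶠ′ enc {b} p q r = retarget (λ γ → sym (if-float (enc γ) (b γ))) (ifᶠ p q r)

∧ᶠ : {Γ : Set} {ρ : Γ → Tree} {μ : Γ → ℕ} {b c : Γ → Bool} → Feasible ρ μ (λ γ → encodeBool (b γ)) →
     Feasible ρ μ (λ γ → encodeBool (c γ)) → Feasible ρ μ (λ γ → encodeBool (b γ ∧ c γ))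
∧ᶠ {b = b} p q = retarget (λ γ → lemma (b γ)) (caseᶠ p q nilᶠ)
  where
  lemma : ∀ b {c} → caseT (encodeBool b) (encodeBool c) leaf ≡ encodeBool (b ∧ c)
  lemma false = refl
  lemma true  = refl

∨ᶠ : {Γ : Set} {ρ : Γ → Tree} {μ : Γ → ℕ} {b c : Γ → Bool} → Feasible ρ μ (λ γ → encodeBool (b γ)) →
     Feasible ρ μ (λ γ → encodeBool (c γ)) → Feasible ρ μ (λ γ → encodeBool (b γ ∨ c γ))
∨ᶠ {b = b} p q = retarget (λ γ → lemma (b γ)) (caseᶠ p (constᶠ (leaf ∙ leaf)) q)
  where
  lemma : ∀ b {c} → caseT (encodeBool b) (leaf ∙ leaf) (encodeBool c) ≡ encodeBool (b ∨ c)
  lemma false = refl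
  lemma true  = refl

size-bool : ∀ b → size (encodeBool b) ≤ 3
size-bool false = s≤s z≤n
size-bool true  = ≤-refl

foldl-any : {A : Set} (f : A → Bool) (b : Bool) (xs : List A) → foldl (λ b a → b ∨ f a) b xs ≡ b ∨ any f xs
foldl-any f b []       = sym (∨-identityʳ b)
foldl-any f b (x ∷ xs) = trans (foldl-any f (b ∨ f x) xs) (∨-assoc b (f x) _)

foldl-all : {A : Set} (f : A → Bool) (b : Bool) (xs : List A) → foldl (λ b a → b ∧ f a) b xs ≡ b ∧ all f xs
foldl-all f b []       = sym (∧-identityʳ b)
foldl-all f b (x ∷ xs) = trans (foldl-all f (b ∧ f x) xs) (∧-assoc b (f x) _)

module _ {Γ : Set} {ρ η : Γ → Tree} {μ : Γ → ℕ} {A : Γ → Set} (enc : ∀ γ → A γ → Tree)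
         (f : ∀ γ → A γ → Bool) (xs : ∀ γ → List (A γ)) where

  module _ (env : Feasible ρ μ η) (l : Feasible ρ μ (λ γ → encList (enc γ) (xs γ)))
           (p : Poly {Σ Γ A} (λ (γ , a) → η γ ∙ enc γ a) (λ (γ , a) → encodeBool (f γ a))) where

    anyᶠ : Feasible ρ μ (λ γ → encodeBool (any (f γ) (xs γ)))
    anyᶠ = retarget (λ γ → cong encodeBool (foldl-any (f γ) false (xs γ)))
      (foldᶠ enc (λ _ → encodeBool) (λ γ b a → b ∨ f γ a) (λ _ → false) xs env nilᶠ l
        (∨ᶠ (rightᶠ (leftᶠ it)) (consᶠ (leftᶠ (leftᶠ it)) (rightᶠ it) ⟫ pull (λ (γ , b , a) → γ , a) p))
        (≼-mono (λ γ → peak-invariant encodeBool (λ b a → b ∨ f γ a) (λ _ → ⊤) 3 (λ _ _ _ → tt)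
          (λ b _ → size-bool b) false (xs γ) tt)
          (≼-const 3)))

    allᶠ : Feasible ρ μ (λ γ → encodeBool (all (f γ) (xs γ)))
    allᶠ = retarget (λ γ → cong encodeBool (foldl-all (f γ) true (xs γ)))
      (foldᶠ enc (λ _ → encodeBool) (λ γ b a → b ∧ f γ a) (λ _ → true) xs env (constᶠ (leaf ∙ leaf)) l
        (∧ᶠ (rightᶠ (leftᶠ it)) (consᶠ (leftᶠ (leftᶠ it)) (rightᶠ it) ⟫ pull (λ (γ , b , a) → γ , a) p))
        (≼-mono (λ γ → peak-invariant encodeBool (λ b a → b ∧ f γ a) (λ _ → ⊤) 3 (λ _ _ _ → tt)
          (λ b _ → size-bool b) true (xs γ) tt)
          (≼-const 3)))

    filterᶠ : Feasible ρ μ (λ γ → encList (enc γ) (filterᵇ (f γ) (xs γ)))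
    filterᶠ = retarget (λ γ → cong (encList (enc γ))
      (trans (cong reverse (foldl-filter (f γ) (xs γ) [])) (reverse-involutive _)))
      (reverseᶠ enc (λ γ → foldl (keep (f γ)) [] (xs γ))
        (foldᶠ-additive enc (λ γ → encList (enc γ)) (λ γ → keep (f γ)) (λ _ → []) xs env nilᶠ l
          (ifᶠ′ (λ (γ , _) → encList (enc γ))
            (consᶠ (leftᶠ (leftᶠ it)) (rightᶠ it) ⟫ pull (λ (γ , b , a) → γ , a) p)
            (consᶠ (rightᶠ it) (rightᶠ (leftᶠ it))) (rightᶠ (leftᶠ it)))
          {δ = λ (γ , a) → suc (size (enc γ a))} (≼-mono (λ _ → s≤s (m≤n+m _ _)) ≼-refl)
          (λ γ as a → size-keep (enc γ) (f γ a) a as)))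
      where
      keep : {X : Set} → (X → Bool) → List X → X → List X
      keep g as a = if g a then a ∷ as else as

      size-keep : {X : Set} (e : X → Tree) (b : Bool) (a : X) (as : List X) →
                  size (encList e (if b then a ∷ as else as)) ≤ size (encList e as) + suc (size (e a))
      size-keep e false a as = m≤m+n _ _
      size-keep e true  a as = ≤-reflexive (+-comm (suc (size (e a))) _)

      foldl-filter : {X : Set} (g : X → Bool) (as bs : List X) → foldl (keep g) bs as ≡ filterᵇ g as ʳ++ bs
      foldl-filter g []       bs = refl
      foldl-filter g (a ∷ as) bs with g a
      ... | false = foldl-filter g as bs
      ... | true  = foldl-filter g as (a ∷ bs)

-- Unary numbers, indices and tables

unary : ℕ → Tree
unary n = encodeList (replicate n leaf)

-- Unary is affordable for indices: they are smaller than the number of rows of a table that is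
-- written out in full, and lookup becomes repeated application of `right`.
finᵗ : {n : ℕ} → Fin n → Tree
finᵗ i = unary (toℕ i)

unary-list : ∀ n → encList id (replicate n leaf) ≡ unary n
unary-list n = encList-id (replicate n leaf)

size-unary : ∀ n → size (unary n) ≡ suc (n + n)
size-unary zero    = refl
size-unary (suc n) = cong suc (trans (cong suc (size-unary n)) (cong suc (sym (+-suc n n))))

module _ {Γ : Set} {ρ η : Γ → Tree} {μ : Γ → ℕ} {B : Γ → Set} (encB : ∀ γ → B γ → Tree)
         (step : ∀ γ → B γ → B γ) (init : ∀ γ → B γ) (n : Γ → ℕ) where

  iterate : ∀ γ → B γ
  iterate γ = foldl (λ b _ → step γ b) (init γ) (replicate (n γ) leaf)

  iterateᶠ : Feasible ρ μ η → Feasible ρ μ (λ γ → encB γ (init γ)) → Feasible ρ μ (λ γ → unary (n γ)) →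
             Poly {Σ Γ B} (λ (γ , b) → η γ ∙ encB γ b) (λ (γ , b) → encB γ (step γ b)) →
             (λ γ → peak (encB γ) (λ b _ → step γ b) (init γ) (replicate (n γ) leaf)) ≼ μ →
             Feasible ρ μ (λ γ → encB γ (iterate γ))
  iterateᶠ env i l p =
    foldᶠ {A = λ _ → Tree} (λ _ → id) encB (λ γ b _ → step γ b) init (λ γ → replicate (n γ) leaf)
    env i (retarget (λ γ → sym (unary-list (n γ))) l) (leftᶠ it ⟫ pull (λ (γ , b , _) → γ , b) p)

drops : ℕ → Tree → Tree
drops n t = foldl (λ t _ → rightT t) t (replicate n leaf)

dropsᶠ : {Γ : Set} {ρ : Γ → Tree} {μ : Γ → ℕ} {n : Γ → ℕ} {τ : Γ → Tree} →
         Feasible ρ μ (λ γ → unary (n γ)) → Feasible ρ μ τ → Feasible ρ μ (λ γ → drops (n γ) (τ γ))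
dropsᶠ {n = n} {τ} p q = iterateᶠ {η = λ _ → leaf} {B = λ _ → Tree} (λ _ → id) (λ _ → rightT) τ n nilᶠ q p
  (rightᶠ (rightᶠ it))
  (≼-mono (λ γ → peak-invariant id (λ t _ → rightT t) (λ t → size t ≤ size (τ γ)) (size (τ γ))
      (λ t _ h → ≤-trans (size-rightT t) h) (λ t h → h) (τ γ) (replicate (n γ) leaf) ≤-refl)
    (size≼ q))

drops-table : ∀ {n} (f : Fin n → Tree) i → leftT (drops (toℕ i) (encodeTable f)) ≡ f i
drops-table f zero    = refl
drops-table f (suc i) = drops-table (f ∘ suc) i

indexᶠ : {Γ : Set} {ρ : Γ → Tree} {μ : Γ → ℕ} {n : Γ → ℕ} (f : ∀ γ → Fin (n γ) → Tree) {i : ∀ γ → Fin (n γ)} →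
         Feasible ρ μ (λ γ → encodeTable (f γ)) → Feasible ρ μ (λ γ → finᵗ (i γ)) →
         Feasible ρ μ (λ γ → f γ (i γ))
indexᶠ f {i} p q = retarget (λ γ → drops-table (f γ) (i γ)) (leftᶠ (dropsᶠ {n = λ γ → toℕ (i γ)} q p))

map-finᵗ : ∀ n → encList unary (upTo n) ≡ encList finᵗ (allFin n)
map-finᵗ n = cong encodeList
  (trans (cong (map unary) (sym (toℕ-allFin n id))) (sym (map-∘ {g = unary} {f = toℕ} (allFin n))))
  where
  toℕ-allFin : ∀ n (f : ℕ → ℕ) → map (f ∘ toℕ) (allFin n) ≡ applyUpTo f n
  toℕ-allFin zero    f = refl
  toℕ-allFin (suc n) f =
      cong (f 0 ∷_) (trans
          (trans (map-tabulate {n = n} suc (f ∘ toℕ)) (sym (map-tabulate {n = n} id (f ∘ suc ∘ toℕ))))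
              (toℕ-allFin n (f ∘ suc)))

-- The tails of unary n are unary (n - 1), …, unary 0, so they are the indices in decreasing order.
indicesᶠ : {Γ : Set} {ρ : Γ → Tree} {μ : Γ → ℕ} (n : Γ → ℕ) → Feasible ρ μ (λ γ → unary (n γ)) →
           Feasible ρ μ (λ γ → encList finᵗ (allFin (n γ)))
indicesᶠ {Γ} n p = retarget
    (λ γ → trans (cong (encList id) (trans (cong proj₂ (run (n γ) [])) (++-identityʳ _)))
    (trans (encList-id _) (map-finᵗ (n γ))))
  (rightᶠ (iterateᶠ {η = λ _ → leaf} {B = λ _ → Tree × List Tree} (λ _ → enc) (λ _ → step)
    (λ γ → unary (n γ) , []) n nilᶠ
    (consᶠ p nilᶠ) p
    (consᶠ (rightᶠ (leftᶠ (rightᶠ it))) (consᶠ (rightᶠ (leftᶠ (rightᶠ it))) (rightᶠ (rightᶠ it))))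
    (≼-mono (λ γ → peak≤ (size (unary (n γ))) (replicate (n γ) leaf) (unary (n γ) , []) ≤-refl)
      (≼-+ (≼-suc (≼-+ (size≼ p) (≼-const 1)))
          (≼-* (≼-mono (λ γ → length-replicate≤ (n γ)) (size≼ p)) (≼-suc (size≼ p)))))))
  where
  enc : Tree × List Tree → Tree
  enc (t , ts) = t ∙ encList id ts

  step : Tree × List Tree → Tree × List Tree
  step (t , ts) = rightT t , rightT t ∷ ts

  length-replicate≤ : ∀ m → length (replicate m leaf) ≤ size (unary m)
  length-replicate≤ m =
      ≤-trans (≤-reflexive (length-replicate m)) (≤-trans (m≤n+m m _) (≤-reflexive (sym (size-unary m))))

  peak≤ : ∀ N (us : List Tree) b → size (proj₁ b) ≤ N →
      peak enc (λ b _ → step b) b us ≤ suc (N + size (encList id (proj₂ b))) + length us * suc N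
  peak≤ N []       (t , ts) t≤ = ≤-trans (s≤s (+-monoˡ-≤ _ t≤)) (≤-reflexive (sym (+-identityʳ _)))
  peak≤ N (u ∷ us) (t , ts) t≤ = ⊔-lub (≤-trans (s≤s (+-monoˡ-≤ _ t≤)) (m≤m+n _ _)) (begin
    peak enc (λ b _ → step b) (step (t , ts)) us
      ≤⟨ peak≤ N us (step (t , ts)) (≤-trans (size-rightT t) t≤) ⟩
    suc (N + suc (size (rightT t) + size (encList id ts))) + length us * suc N
      ≤⟨ +-monoˡ-≤ (length us * suc N)
          (s≤s (+-monoʳ-≤ N (s≤s (+-monoˡ-≤ (size (encList id ts)) (≤-trans (size-rightT t) t≤))))) ⟩
    suc (N + suc (N + size (encList id ts))) + length us * suc N
      ≡⟨ cong (λ z → suc z + length us * suc N)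
          (trans (cong (N +_) (sym (+-comm (size (encList id ts)) (suc N)) )) (sym (+-assoc N _ (suc N)))) ⟩
    suc (N + size (encList id ts) + suc N) + length us * suc N
      ≡⟨ +-assoc (suc (N + size (encList id ts))) (suc N) (length us * suc N) ⟩
    suc (N + size (encList id ts)) + suc (length us) * suc N ∎)
    where open ≤-Reasoning

  run : ∀ m ts → foldl (λ b _ → step b) (unary m , ts) (replicate m leaf) ≡ (leaf , map unary (upTo m) ++ ts)
  run zero    ts = refl
  run (suc m) ts = trans (run m (unary m ∷ ts)) (cong (leaf ,_) (trans
    (sym (++-assoc (map unary (upTo m)) (unary m ∷ []) ts))
    (cong (_++ ts) (trans (sym (map-++ unary (upTo m) (m ∷ []))) (cong (map unary) (upTo-∷ʳ m))))))

tableᶠ : {Γ : Set} {ρ η : Γ → Tree} {μ : Γ → ℕ} (n : Γ → ℕ) {τ : Σ[ γ ∈ Γ ] Fin (n γ) → Tree} →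
         Feasible ρ μ (λ γ → unary (n γ)) → Feasible ρ μ η →
         Poly {Σ[ γ ∈ Γ ] Fin (n γ)} (λ (γ , i) → η γ ∙ finᵗ i) τ →
         Feasible ρ μ (λ γ → encodeTable (λ i → τ (γ , i)))
tableᶠ n {τ} p env q = retarget (λ γ → cong encodeList (map-tabulate {n = n γ} id (λ i → τ (γ , i))))
  (mapᶠ (λ _ → finᵗ) (λ γ → allFin (n γ)) env (indicesᶠ n p) q)

lengthᶠ : {Γ : Set} {ρ : Γ → Tree} {μ : Γ → ℕ} {A : Γ → Set} (enc : ∀ γ → A γ → Tree)
          (xs : ∀ γ → List (A γ)) →
          Feasible ρ μ (λ γ → encList (enc γ) (xs γ)) → Feasible ρ μ (λ γ → unary (length (xs γ)))
lengthᶠ enc xs p = retarget (λ γ → cong encodeList (map-const (xs γ)))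
    (mapᶠ {η = λ _ → leaf} enc xs {τ = λ _ → leaf} nilᶠ p nilᶠ)
  where
  map-const : {X : Set} (ys : List X) → map (λ _ → leaf) ys ≡ replicate (length ys) leaf
  map-const []       = refl
  map-const (y ∷ ys) = cong (leaf ∷_) (map-const ys)

-- The encoding of an instance does not mention the order of the graph; it is recovered as the
-- number of rows of the adjacency matrix.
table-sizeᶠ : {Γ : Set} {ρ : Γ → Tree} {μ : Γ → ℕ} {n : Γ → ℕ} (f : ∀ γ → Fin (n γ) → Tree) →
              Feasible ρ μ (λ γ → encodeTable (f γ)) → Feasible ρ μ (λ γ → unary (n γ))
table-sizeᶠ {n = n} f p = retarget (λ γ → cong unary (length-tabulate (f γ)))
  (lengthᶠ (λ _ → id) (λ γ → tabulate (f γ)) (retarget (λ γ → sym (encList-id _)) p))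

-- Binary arithmetic

-- Bijective binary digits, least significant first: true is the digit 1, false the digit 2.

digit : List Bool → Fin 3
digit []          = zero
digit (true ∷ _)  = suc zero
digit (false ∷ _) = suc (suc zero)

value : List Bool → ℕ
value []           = 0
value (true ∷ ds)  = suc (2 * value ds)
value (false ∷ ds) = 2 * suc (value ds)

digits : ℕ → List Bool
digits n = go (Bin.fromℕ n)
  module Digits where
  go : ℕᵇ → List Bool
  go ℕᵇ.zero  = []
  go 2[1+ n ] = false ∷ go n
  go 1+[2 n ] = true ∷ go n

encBits : List Bool → Tree
encBits = encList encodeBool

encBits-digits : ∀ n → encBits (digits n) ≡ encodeℕ n
encBits-digits n = lemma (Bin.fromℕ n)
  where
  lemma : ∀ b → encBits (Digits.go n b) ≡ encodeℕᵇ b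
  lemma ℕᵇ.zero  = refl
  lemma 2[1+ b ] = cong (encodeBool false ∙_) (lemma b)
  lemma 1+[2 b ] = cong (encodeBool true ∙_) (lemma b)

value-digits : ∀ n → value (digits n) ≡ n
value-digits n = trans (lemma (Bin.fromℕ n)) (toℕ-fromℕ n)
  where
  lemma : ∀ b → value (Digits.go n b) ≡ Bin.toℕ b
  lemma ℕᵇ.zero  = refl
  lemma 2[1+ b ] = cong (λ z → 2 * suc z) (lemma b)
  lemma 1+[2 b ] = cong (λ z → suc (2 * z)) (lemma b)

encodeℕ-value : ∀ ds → encodeℕ (value ds) ≡ encBits ds
encodeℕ-value ds = trans (cong encodeℕ (sym (toℕ-bin ds)))
  (trans (cong encodeℕᵇ (fromℕ-toℕ (bin ds))) (enc-bin ds))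
  where
  bin : List Bool → ℕᵇ
  bin []           = ℕᵇ.zero
  bin (true ∷ ds)  = 1+[2 bin ds ]
  bin (false ∷ ds) = 2[1+ bin ds ]

  toℕ-bin : ∀ ds → Bin.toℕ (bin ds) ≡ value ds
  toℕ-bin []           = refl
  toℕ-bin (true ∷ ds)  = cong (λ z → suc (2 * z)) (toℕ-bin ds)
  toℕ-bin (false ∷ ds) = cong (λ z → 2 * suc z) (toℕ-bin ds)

  enc-bin : ∀ ds → encodeℕᵇ (bin ds) ≡ encBits ds
  enc-bin []           = refl
  enc-bin (true ∷ ds)  = cong (encodeBool true ∙_) (enc-bin ds)
  enc-bin (false ∷ ds) = cong (encodeBool false ∙_) (enc-bin ds)

value-digit : ∀ ds → value ds ≡ toℕ (digit ds) + 2 * value (drop 1 ds)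
value-digit []           = refl
value-digit (true ∷ ds)  = refl
value-digit (false ∷ ds) = *-suc 2 (value ds)

length-digit : ∀ ds → length ds ≡ 1 ⊓ toℕ (digit ds) + length (drop 1 ds)
length-digit []           = refl
length-digit (true ∷ ds)  = refl
length-digit (false ∷ ds) = refl

digit≡0 : ∀ ds → toℕ (digit ds) ≡ 0 → value (drop 1 ds) ≡ 0
digit≡0 []          _ = refl
digit≡0 (true ∷ _)  ()
digit≡0 (false ∷ _) ()

-- The digit 0 marks positions beyond the end of a bijective numeral, so it emits nothing. This
-- preserves the value only if nothing but zeros follows, which is the hypothesis of `value-emit`.
emit : Fin 3 → List Bool → List Bool
emit zero             ds = ds
emit (suc zero)       ds = true ∷ ds
emit (suc (suc zero)) ds = false ∷ ds

-- With digits 1 and 2 the carry of an addition can be 2, hence three states.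

module Transducer (next output : Fin 3 → Fin 3 → Fin 3 → Fin 3) where

  State : Set
  State = (List Bool × List Bool) × (Fin 3 × List Bool)

  encState : State → Tree
  encState ((xs , ys) , (c , out)) = (encBits xs ∙ encBits ys) ∙ (finᵗ c ∙ encBits out)

  step : State → State
  step ((xs , ys) , (c , out)) = (drop 1 xs , drop 1 ys) ,
    (next (digit xs) (digit ys) c , emit (output (digit xs) (digit ys) c) out)

  -- Only the length of this list counts. One round per digit of either numeral is enough to consume
  -- both and to flush the final carry.
  rounds : List Bool → List Bool → List Bool
  rounds xs ys = xs ʳ++ ys

  run : List Bool × List Bool → State
  run (xs , ys) = foldl (λ s _ → step s) ((xs , ys) , (zero , [])) (rounds xs ys)

  module _ {Γ : Set} {ρ : Γ → Tree} {μ : Γ → ℕ} where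

    digitᶠ : {ds : Γ → List Bool} → Feasible ρ μ (λ γ → encBits (ds γ)) →
        Feasible ρ μ (λ γ → finᵗ (digit (ds γ)))
    digitᶠ {ds} p = retarget (λ γ → lemma (ds γ))
      (caseᶠ p (caseᶠ (leftᶠ p) (constᶠ (unary 1)) (constᶠ (unary 2))) nilᶠ)
      where
      lemma : ∀ ds → caseT (encBits ds) (caseT (leftT (encBits ds)) (unary 1) (unary 2)) leaf ≡ finᵗ
          (digit ds)
      lemma []           = refl
      lemma (true ∷ ds)  = refl
      lemma (false ∷ ds) = refl

    restᶠ : {ds : Γ → List Bool} → Feasible ρ μ (λ γ → encBits (ds γ)) →
        Feasible ρ μ (λ γ → encBits (drop 1 (ds γ)))
    restᶠ {ds} p = retarget (λ γ → lemma (ds γ)) (rightᶠ p)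
      where
      lemma : ∀ ds → rightT (encBits ds) ≡ encBits (drop 1 ds)
      lemma []       = refl
      lemma (_ ∷ ds) = refl

    emitᶠ : {d : Γ → Fin 3} {ds : Γ → List Bool} → Feasible ρ μ (λ γ → finᵗ (d γ)) →
            Feasible ρ μ (λ γ → encBits (ds γ)) → Feasible ρ μ (λ γ → encBits (emit (d γ) (ds γ)))
    emitᶠ {d} p q = retarget (λ γ → lemma (d γ))
        (caseᶠ p (caseᶠ (rightᶠ p) (consᶠ nilᶠ q) (consᶠ (constᶠ (encodeBool true)) q)) q)
      where
      lemma : ∀ d {ds} → caseT (finᵗ d)
                       (caseT (rightT (finᵗ d)) (leaf ∙ encBits ds) (encodeBool true ∙ encBits ds))
                           (encBits ds)
                       ≡ encBits (emit d ds)
      lemma zero             = refl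
      lemma (suc zero)       = refl
      lemma (suc (suc zero)) = refl

    -- A function of three digits is stored in the program as a constant nested table, so it
    -- suffices to specify `next` and `output` as Agda functions.
    lookup³ᶠ : (f : Fin 3 → Fin 3 → Fin 3 → Fin 3) {x y z : Γ → Fin 3} → Feasible ρ μ (λ γ → finᵗ (x γ)) →
               Feasible ρ μ (λ γ → finᵗ (y γ)) → Feasible ρ μ (λ γ → finᵗ (z γ)) →
               Feasible ρ μ (λ γ → finᵗ (f (x γ) (y γ) (z γ)))
    lookup³ᶠ f {x} {y} p q r =
      indexᶠ {n = λ _ → 3} (λ γ k → finᵗ (f (x γ) (y γ) k))
        (indexᶠ {n = λ _ → 3} (λ γ j → encodeTable (λ k → finᵗ (f (x γ) j k)))
          (indexᶠ {n = λ _ → 3} (λ _ i → encodeTable (λ j → encodeTable (λ k → finᵗ (f i j k))))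
            (constᶠ (encodeTable (λ i → encodeTable (λ j → encodeTable (λ k → finᵗ (f i j k)))))) p) q) r

  stepᶠ : Poly encState (encState ∘ step)
  stepᶠ = consᶠ (consᶠ (restᶠ xsᶠ) (restᶠ ysᶠ))
      (consᶠ (lookup³ᶠ next (digitᶠ xsᶠ) (digitᶠ ysᶠ) cᶠ)
             (emitᶠ (lookup³ᶠ output (digitᶠ xsᶠ) (digitᶠ ysᶠ) cᶠ) (rightᶠ (rightᶠ it))))
    where
    xsᶠ : Poly encState (λ ((xs , ys) , (c , out)) → encBits xs)
    xsᶠ = leftᶠ (leftᶠ it)
    ysᶠ : Poly encState (λ ((xs , ys) , (c , out)) → encBits ys)
    ysᶠ = rightᶠ (leftᶠ it)
    cᶠ : Poly encState (λ ((xs , ys) , (c , out)) → finᵗ c)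
    cᶠ = leftᶠ (rightᶠ it)

  size-step : ∀ s → size (encState (step s)) ≤ size (encState s) + 8
  size-step ((xs , ys) , (c , out)) = begin
    suc (suc (size (encBits (drop 1 xs)) + size (encBits (drop 1 ys))) +
         suc (size (finᵗ (next (digit xs) (digit ys) c)) + size
             (encBits (emit (output (digit xs) (digit ys) c) out))))
      ≤⟨ s≤s (+-mono-≤ (s≤s (+-mono-≤ (size-rest xs) (size-rest ys)))
           (s≤s (+-mono-≤ (size-fin (next (digit xs) (digit ys) c) c)
               (size-emit (output (digit xs) (digit ys) c))))) ⟩
    suc (suc (size (encBits xs) + size (encBits ys)) + suc (size (finᵗ c) + 4 + (size (encBits out) + 4)))
      ≡⟨ arithmetic (size (encBits xs)) (size (encBits ys)) (size (finᵗ c)) (size (encBits out)) ⟩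
    suc (suc (size (encBits xs) + size (encBits ys)) + suc (size (finᵗ c) + size (encBits out))) + 8 ∎
    where
    open ≤-Reasoning
    arithmetic : ∀ x y c o → suc (suc (x + y) + suc (c + 4 + (o + 4))) ≡ suc (suc (x + y) + suc (c + o)) + 8
    arithmetic = solve-∀
    size-rest : ∀ ds → size (encBits (drop 1 ds)) ≤ size (encBits ds)
    size-rest []       = ≤-refl
    size-rest (d ∷ ds) = ≤-trans (m≤n+m _ _) (n≤1+n _)
    size-fin : ∀ (d e : Fin 3) → size (finᵗ d) ≤ size (finᵗ e) + 4
    size-fin = toWitness {a? = all? λ d → all? λ e → size (finᵗ d) ≤? size (finᵗ e) + 4} tt
    size-emit : ∀ d {ds} → size (encBits (emit d ds)) ≤ size (encBits ds) + 4
    size-emit zero             = m≤m+n _ _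
    size-emit (suc zero)       = ≤-reflexive (+-comm 4 _)
    size-emit (suc (suc zero)) = ≤-trans (+-monoˡ-≤ _ (m≤m+n 2 2)) (≤-reflexive (+-comm 4 _))

  runᶠ : Poly {List Bool × List Bool} (λ (xs , ys) → encBits xs ∙ encBits ys) (encState ∘ run)
  runᶠ = foldᶠ-additive {η = λ _ → leaf} {A = λ _ → Bool} {B = λ _ → State} (λ _ → encodeBool)
    (λ _ → encState) (λ _ s _ → step s)
    (λ (xs , ys) → (xs , ys) , (zero , [])) (λ (xs , ys) → rounds xs ys) nilᶠ
    (consᶠ (consᶠ (leftᶠ it) (rightᶠ it)) (constᶠ (leaf ∙ leaf)))
    (ʳ++ᶠ (λ _ → encodeBool) proj₁ proj₂ (leftᶠ it) (rightᶠ it))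
    (rightᶠ (leftᶠ it) ⟫ pull (λ (_ , s , _) → s) stepᶠ)
    {δ = λ _ → 8} (≼-const 8) (λ _ s _ → size-step s)

  final : ℕ → List Bool → List Bool → Fin 3 → Fin 3
  final zero    xs ys c = c
  final (suc n) xs ys c = final n (drop 1 xs) (drop 1 ys) (next (digit xs) (digit ys) c)

  result : ℕ → List Bool → List Bool → Fin 3 → List Bool
  result zero    xs ys c = []
  result (suc n) xs ys c =
      emit (output (digit xs) (digit ys) c) (result n (drop 1 xs) (drop 1 ys) (next (digit xs) (digit ys) c))

  foldl-step : (zs : List Bool) (xs ys out : List Bool) (c : Fin 3) →
               proj₂ (foldl (λ s _ → step s) ((xs , ys) , (c , out)) zs) ≡
               (final (length zs) xs ys c , result (length zs) xs ys c ʳ++ out)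
  foldl-step []       xs ys out c = refl
  foldl-step (_ ∷ zs) xs ys out c = trans (foldl-step zs (drop 1 xs) (drop 1 ys) _ _)
    (cong (final (suc (length zs)) xs ys c ,_) (emit-ʳ++ (output (digit xs) (digit ys) c) _ out))
    where
    emit-ʳ++ : ∀ d as bs → as ʳ++ emit d bs ≡ emit d as ʳ++ bs
    emit-ʳ++ zero             as bs = refl
    emit-ʳ++ (suc zero)       as bs = refl
    emit-ʳ++ (suc (suc zero)) as bs = refl

  length-rounds : ∀ xs ys → length (rounds xs ys) ≡ length xs + length ys
  length-rounds xs ys =
      trans (cong length (ʳ++-defn xs))
          (trans (length-++ (reverse xs)) (cong (_+ length ys) (length-reverse xs)))

  run-final : ∀ xs ys → proj₁ (proj₂ (run (xs , ys))) ≡ final (length xs + length ys) xs ys zero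
  run-final xs ys = trans (cong proj₁ (foldl-step (rounds xs ys) xs ys [] zero))
      (cong (λ n → final n xs ys zero) (length-rounds xs ys))

  run-result : ∀ xs ys → reverse (proj₂ (proj₂ (run (xs , ys)))) ≡ result (length xs + length ys) xs ys zero
  run-result xs ys = trans (cong (reverse ∘ proj₂) (foldl-step (rounds xs ys) xs ys [] zero))
    (trans (reverse-involutive _) (cong (λ n → result n xs ys zero) (length-rounds xs ys)))

value-emit : ∀ d ds → (toℕ d ≡ 0 → value ds ≡ 0) → value (emit d ds) ≡ toℕ d + 2 * value ds
value-emit zero             ds h = trans (h refl) (sym (cong (2 *_) (h refl)))
value-emit (suc zero)       ds _ = refl
value-emit (suc (suc zero)) ds _ = *-suc 2 (value ds)

module Adder where

  -- A digit sum s ≤ 6 is split as output plus twice the carry, with output 1 or 2 unless s = 0.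
  -- Hence 0 is put out only when both numerals and the carry are exhausted.
  carryOf outputOf : ℕ → Fin 3
  carryOf 0 = zero
  carryOf 1 = zero
  carryOf 2 = zero
  carryOf 3 = suc zero
  carryOf 4 = suc zero
  carryOf _ = suc (suc zero)
  outputOf 0 = zero
  outputOf 1 = suc zero
  outputOf 3 = suc zero
  outputOf 5 = suc zero
  outputOf _ = suc (suc zero)

  next output : Fin 3 → Fin 3 → Fin 3 → Fin 3
  next x y c = carryOf (toℕ x + toℕ y + toℕ c)
  output x y c = outputOf (toℕ x + toℕ y + toℕ c)

  open Transducer next output public

  next-output : ∀ x y c → toℕ x + toℕ y + toℕ c ≡ toℕ (output x y c) + 2 * toℕ (next x y c)
  next-output = toWitness {a? = all? λ x → all? λ y → all? λ c → _ ≟ _} tt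

  output≡0 : ∀ x y c → toℕ (output x y c) ≡ 0 → (toℕ x ≡ 0 × toℕ y ≡ 0) × toℕ (next x y c) ≡ 0
  output≡0 = toWitness {a? =
      all? λ x → all? λ y → all? λ c → (_ ≟ _) →-dec (((_ ≟ _) ×-dec (_ ≟ _)) ×-dec (_ ≟ _))} tt

  -- The potential is the number of unread digits plus the carry; `1 ⊓ toℕ x` counts the digit read
  -- from the first numeral. A round with nonzero digit sum lowers the potential by at least 1, and
  -- digit sum 0 means that it is already 0. So `value-result` can use any number of rounds not
  -- below the potential.
  progress : ∀ x y c → 1 ⊓ (toℕ x + toℕ y + toℕ c) + toℕ (next x y c) ≤ 1 ⊓ toℕ x + 1 ⊓ toℕ y + toℕ c
  progress = toWitness {a? = all? λ x → all? λ y → all? λ c → _ ≤? _} tt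

  value-result : ∀ n xs ys c → length xs + length ys + toℕ c ≤ n →
      value (result n xs ys c) ≡ value xs + value ys + toℕ c
  value-result zero    []       []       zero    h = refl
  value-result zero    []       []       (suc _) ()
  value-result zero    []       (_ ∷ _)  c       ()
  value-result zero    (_ ∷ _)  ys       c       ()
  value-result (suc n) xs ys c h = begin
    value (emit (output x y c) rest)                          ≡⟨ value-emit (output x y c) rest rest≡0 ⟩
    toℕ (output x y c) + 2 * value rest                       ≡⟨ cong (λ z → toℕ (output x y c) + 2 * z) ih ⟩
    toℕ (output x y c) + 2 * (value (drop 1 xs) + value (drop 1 ys) + toℕ (next x y c))
      ≡⟨ arithmetic₁ (toℕ (output x y c)) (value (drop 1 xs)) (value (drop 1 ys)) (toℕ (next x y c)) ⟩
    toℕ (output x y c) + 2 * toℕ (next x y c) + (2 * value (drop 1 xs) + 2 * value (drop 1 ys))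
      ≡⟨ cong (_+ (2 * value (drop 1 xs) + 2 * value (drop 1 ys))) (next-output x y c) ⟨
    toℕ x + toℕ y + toℕ c + (2 * value (drop 1 xs) + 2 * value (drop 1 ys))
      ≡⟨ arithmetic₂ (toℕ x) (toℕ y) (toℕ c) (2 * value (drop 1 xs)) (2 * value (drop 1 ys)) ⟩
    (toℕ x + 2 * value (drop 1 xs)) + (toℕ y + 2 * value (drop 1 ys)) + toℕ c
      ≡⟨ cong₂ (λ a b → a + b + toℕ c) (value-digit xs) (value-digit ys) ⟨
    value xs + value ys + toℕ c ∎
    where
    open ≡-Reasoning
    x = digit xs
    y = digit ys
    rest = result n (drop 1 xs) (drop 1 ys) (next x y c)

    arithmetic₁ : ∀ o a b k → o + 2 * (a + b + k) ≡ o + 2 * k + (2 * a + 2 * b)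
    arithmetic₁ = solve-∀
    arithmetic₂ : ∀ x y c a b → x + y + c + (a + b) ≡ (x + a) + (y + b) + c
    arithmetic₂ = solve-∀
    arithmetic₃ : ∀ m k a b → m + (a + b + k) ≡ m + k + (a + b)
    arithmetic₃ = solve-∀

    total : 1 ⊓ (toℕ x + toℕ y + toℕ c) + (length (drop 1 xs) + length (drop 1 ys) + toℕ (next x y c)) ≤ suc n
    total = ≤-trans (≤-reflexive
      (arithmetic₃ (1 ⊓ (toℕ x + toℕ y + toℕ c)) (toℕ (next x y c)) (length (drop 1 xs))
          (length (drop 1 ys))))
      (≤-trans (+-monoˡ-≤ (length (drop 1 xs) + length (drop 1 ys)) (progress x y c))
      (≤-trans (≤-reflexive
         (trans (arithmetic₂ (1 ⊓ toℕ x) (1 ⊓ toℕ y) (toℕ c) (length (drop 1 xs)) (length (drop 1 ys)))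
         (cong₂ (λ a b → a + b + toℕ c) (sym (length-digit xs)) (sym (length-digit ys))))) h))

    smaller : length (drop 1 xs) + length (drop 1 ys) + toℕ (next x y c) ≤ n
    smaller = dichotomy (toℕ x + toℕ y + toℕ c) refl
      where
      dichotomy : ∀ s → toℕ x + toℕ y + toℕ c ≡ s →
          length (drop 1 xs) + length (drop 1 ys) + toℕ (next x y c) ≤ n
      dichotomy zero    eq = ≤-trans (≤-reflexive (zeros xs ys c eq)) z≤n
        where
        zeros : ∀ xs ys c → toℕ (digit xs) + toℕ (digit ys) + toℕ c ≡ 0 →
                length (drop 1 xs) + length (drop 1 ys) + toℕ (next (digit xs) (digit ys) c) ≡ 0
        zeros [] [] zero _ = refl
        zeros [] (true ∷ ys) c ()
        zeros [] (false ∷ ys) c ()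
        zeros (true ∷ xs) ys c ()
        zeros (false ∷ xs) ys c ()
      dichotomy (suc s) eq =
          ≤-pred (subst (λ z → 1 ⊓ z + (length (drop 1 xs) + length (drop 1 ys) + toℕ (next x y c)) ≤ suc n)
              eq total)

    ih : value rest ≡ value (drop 1 xs) + value (drop 1 ys) + toℕ (next x y c)
    ih = value-result n (drop 1 xs) (drop 1 ys) (next x y c) smaller

    rest≡0 : toℕ (output x y c) ≡ 0 → value rest ≡ 0
    rest≡0 o≡0 with output≡0 x y c o≡0
    ... | (x≡0 , y≡0) , k≡0 = trans ih (cong₂ _+_ (cong₂ _+_ (digit≡0 xs x≡0) (digit≡0 ys y≡0)) k≡0)

  value-sum : ∀ m n → value (reverse (proj₂ (proj₂ (run (digits m , digits n))))) ≡ m + n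
  value-sum m n = begin
    value (reverse (proj₂ (proj₂ (run (digits m , digits n)))))             ≡⟨ cong value
        (run-result (digits m) (digits n)) ⟩
    value (result (length (digits m) + length (digits n)) (digits m) (digits n) zero)
      ≡⟨ value-result (length (digits m) + length (digits n)) (digits m) (digits n) zero
          (≤-reflexive (+-identityʳ _)) ⟩
    value (digits m) + value (digits n) + 0                                  ≡⟨ +-identityʳ _ ⟩
    value (digits m) + value (digits n)                                      ≡⟨ cong₂ _+_ (value-digits m)
        (value-digits n) ⟩
    m + n ∎
    where open ≡-Reasoning

module Comparer where

  -- The state c ≤ 1 asserts that the remaining numbers have to satisfy X + c ≤ Y.
  next : Fin 3 → Fin 3 → Fin 3 → Fin 3
  next x y c = if toℕ x + toℕ c ≤ᵇ toℕ y then zero else suc zero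

  open Transducer next (λ _ _ _ → zero) public

  Correct : Fin 3 → Fin 3 → Fin 3 → Set
  Correct x y c = ((toℕ (next x y c) ≡ 0 × toℕ x + toℕ c ≤ toℕ y)) ⊎
      (toℕ (next x y c) ≡ 1 × toℕ y < toℕ x + toℕ c)

  correct : ∀ x y c → Correct x y c
  correct = toWitness {a? = all? λ x → all? λ y → all? λ c →
    ((_ ≟ _) ×-dec (_ ≤? _)) ⊎-dec ((_ ≟ _) ×-dec (_ <? _))} tt

  next≤1 : ∀ x y c → toℕ (next x y c) ≤ 1
  next≤1 = toWitness {a? = all? λ x → all? λ y → all? λ c → _ ≤? _} tt

  -- When no borrow arises, dividing by 2 works as long as y exceeds x + c by at most 1. A
  -- difference of 2 forces x = 0, but then the first numeral has ended and X = 0.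
  forward : ∀ x y c c′ X Y → (toℕ x ≡ 0 → X ≡ 0) → c′ ≡ next x y c →
            toℕ x + 2 * X + toℕ c ≤ toℕ y + 2 * Y → X + toℕ c′ ≤ Y
  forward x y c c′ X Y x≡0 refl h with correct x y c
  ... | inj₂ (eq , y<x) rewrite eq = ≤-trans (≤-reflexive (+-comm X 1))
      (*-cancelˡ-< 2 X Y (+-cancelˡ-< (toℕ y) _ _ (begin-strict
        toℕ y + 2 * X             <⟨ +-monoˡ-< (2 * X) y<x ⟩
        toℕ x + toℕ c + 2 * X     ≡⟨ swap (toℕ x) (toℕ c) (2 * X) ⟩
        toℕ x + 2 * X + toℕ c     ≤⟨ h ⟩
        toℕ y + 2 * Y             ∎)))
      where
      open ≤-Reasoning
      swap : ∀ a b c → a + b + c ≡ a + c + b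
      swap = solve-∀
  ... | inj₁ (eq , x≤y) rewrite eq = ≤-trans (≤-reflexive (+-identityʳ X)) (bound x x≡0 h)
      where
      open ≤-Reasoning
      swap : ∀ a b c → suc a + b + c ≡ suc (a + b + c)
      swap = solve-∀
      bound : ∀ (x : Fin 3) → (toℕ x ≡ 0 → X ≡ 0) → toℕ x + 2 * X + toℕ c ≤ toℕ y + 2 * Y → X ≤ Y
      bound zero    X≡0 _ rewrite X≡0 refl = z≤n
      bound (suc x) _   g = ≤-pred (*-cancelˡ-< 2 X (suc Y) (begin-strict
        2 * X                     <⟨ s≤s (≤-trans (m≤n+m _ (toℕ x)) (m≤m+n _ (toℕ c))) ⟩
        suc (toℕ x) + 2 * X + toℕ c ≤⟨ g ⟩
        toℕ y + 2 * Y             ≤⟨ +-monoˡ-≤ (2 * Y) (toℕ≤pred[n] y) ⟩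
        2 + 2 * Y                 ≡⟨ *-suc 2 Y ⟨
        2 * suc Y                 ∎))

  -- In the borrow case x + c is at most 3, and the two units gained from X < Y together with y ≥ 1
  -- pay for it. If y = 0, the second numeral has ended, which contradicts X < Y.
  backward : ∀ x y c c′ X Y → toℕ c ≤ 1 → (toℕ y ≡ 0 → Y ≡ 0) → c′ ≡ next x y c →
             X + toℕ c′ ≤ Y → toℕ x + 2 * X + toℕ c ≤ toℕ y + 2 * Y
  backward x y c c′ X Y c≤1 y≡0 refl h with correct x y c
  ... | inj₁ (eq , x≤y) rewrite eq = begin
      toℕ x + 2 * X + toℕ c ≡⟨ swap (toℕ x) (2 * X) (toℕ c) ⟩
      toℕ x + toℕ c + 2 * X ≤⟨ +-mono-≤ x≤y (*-monoʳ-≤ 2 (≤-trans (≤-reflexive (sym (+-identityʳ X))) h)) ⟩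
      toℕ y + 2 * Y         ∎
      where
      open ≤-Reasoning
      swap : ∀ a b c → a + b + c ≡ a + c + b
      swap = solve-∀
  ... | inj₂ (eq , y<x) rewrite eq | +-comm X 1 = bound y y≡0
      where
      open ≤-Reasoning
      arithmetic : ∀ a → 2 + a + 1 ≡ 1 + (2 + a)
      arithmetic = solve-∀
      bound : ∀ (y : Fin 3) → (toℕ y ≡ 0 → Y ≡ 0) → toℕ x + 2 * X + toℕ c ≤ toℕ y + 2 * Y
      bound zero    Y≡0 with Y≡0 refl
      ... | Y≡0′ = ⊥-elim (1+n≰n {X} (≤-trans h (≤-trans (≤-reflexive Y≡0′) z≤n)))
      bound (suc y) _ = begin
        toℕ x + 2 * X + toℕ c   ≤⟨ +-mono-≤ (+-monoˡ-≤ (2 * X) (toℕ≤pred[n] x)) c≤1 ⟩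
        2 + 2 * X + 1           ≡⟨ arithmetic (2 * X) ⟩
        1 + (2 + 2 * X)         ≡⟨ cong suc (*-suc 2 X) ⟨
        1 + 2 * suc X           ≤⟨ +-mono-≤ (s≤s (z≤n {toℕ y})) (*-monoʳ-≤ 2 h) ⟩
        suc (toℕ y) + 2 * Y     ∎

  shorter : ∀ {m} (xs ys : List Bool) → length xs + length ys ≤ suc m →
      length (drop 1 xs) + length (drop 1 ys) ≤ m
  shorter []       []       _       = z≤n
  shorter []       (_ ∷ ys) (s≤s p) = p
  shorter (_ ∷ xs) []       (s≤s p) = p
  shorter (_ ∷ xs) (_ ∷ ys) (s≤s p) = ≤-trans (+-monoʳ-≤ (length xs) (n≤1+n _)) p

  final-forward : ∀ n xs ys c → length xs + length ys ≤ n →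
                  value xs + toℕ c ≤ value ys → toℕ (final n xs ys c) ≡ 0
  final-forward zero    []      []      c _ h = n≤0⇒n≡0 h
  final-forward zero    []      (_ ∷ _) c () h
  final-forward zero    (_ ∷ _) ys      c () h
  final-forward (suc n) xs ys c l h =
    final-forward n (drop 1 xs) (drop 1 ys) _ (shorter xs ys l)
      (forward (digit xs) (digit ys) c _ (value (drop 1 xs)) (value (drop 1 ys)) (digit≡0 xs) refl
        (subst₂ (λ a b → a + toℕ c ≤ b) (value-digit xs) (value-digit ys) h))

  final-backward : ∀ n xs ys c → length xs + length ys ≤ n → toℕ c ≤ 1 →
                   toℕ (final n xs ys c) ≡ 0 → value xs + toℕ c ≤ value ys
  final-backward zero    []      []      c _ _ h = ≤-reflexive h
  final-backward zero    []      (_ ∷ _) c () _ h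
  final-backward zero    (_ ∷ _) ys      c () _ h
  final-backward (suc n) xs ys c l c≤1 h =
    subst₂ (λ a b → a + toℕ c ≤ b) (sym (value-digit xs)) (sym (value-digit ys))
    (backward (digit xs) (digit ys) c _ (value (drop 1 xs)) (value (drop 1 ys)) c≤1 (digit≡0 ys) refl
      (final-backward n (drop 1 xs) (drop 1 ys) _ (shorter xs ys l) (next≤1 (digit xs) (digit ys) c) h))

-- Unlike encodeℕ, num does not unfold, so its argument can be inferred by unification.
abstract
  num : ℕ → Tree
  num = encodeℕ

  num≡ : ∀ n → num n ≡ encodeℕ n
  num≡ n = refl

module _ {Γ : Set} {ρ : Γ → Tree} {μ : Γ → ℕ} {m n : Γ → ℕ}
         (p : Feasible ρ μ (λ γ → num (m γ))) (q : Feasible ρ μ (λ γ → num (n γ))) where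

  private
    bitsᶠ : Feasible ρ μ (λ γ → encBits (digits (m γ)) ∙ encBits (digits (n γ)))
    bitsᶠ = consᶠ (retarget (λ γ → trans (num≡ (m γ)) (sym (encBits-digits (m γ)))) p)
        (retarget (λ γ → trans (num≡ (n γ)) (sym (encBits-digits (n γ)))) q)

  +ᶠ : Feasible ρ μ (λ γ → num (m γ + n γ))
  +ᶠ = retarget (λ γ → trans (sym (trans (num≡ _) (encodeℕ-value (addition γ))))
      (cong num (Adder.value-sum (m γ) (n γ))))
      (reverseᶠ (λ _ → encodeBool) (λ γ → proj₂ (proj₂ (Adder.run (digits (m γ) , digits (n γ)))))
        (rightᶠ (rightᶠ (bitsᶠ ⟫ pull (λ γ → digits (m γ) , digits (n γ)) Adder.runᶠ))))
    where
    addition : Γ → List Bool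
    addition γ = reverse (proj₂ (proj₂ (Adder.run (digits (m γ) , digits (n γ)))))

  ≤ᶠ : Feasible ρ μ (λ γ → encodeBool (m γ ≤ᵇ n γ))
  ≤ᶠ = retarget (λ γ → lemma (m γ) (n γ))
      (caseᶠ (leftᶠ (rightᶠ (bitsᶠ ⟫ pull (λ γ → digits (m γ) , digits (n γ)) Comparer.runᶠ))) nilᶠ
          (constᶠ (leaf ∙ leaf)))
    where
    open Comparer
    decide : ∀ (c : Fin 3) b → (toℕ c ≡ 0 → T b) → (T b → toℕ c ≡ 0) →
        caseT (finᵗ c) leaf (leaf ∙ leaf) ≡ encodeBool b
    decide zero    true  f g = refl
    decide zero    false f g = ⊥-elim (f refl)
    decide (suc c) true  f g with g tt
    ... | ()
    decide (suc c) false f g = refl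

    lemma : ∀ a b → caseT (finᵗ (proj₁ (proj₂ (run (digits a , digits b))))) leaf (leaf ∙ leaf) ≡ encodeBool
        (a ≤ᵇ b)
    lemma a b = decide _ (a ≤ᵇ b)
      (λ c≡0 → ≤⇒≤ᵇ (subst₂ _≤_ (trans (+-identityʳ _) (value-digits a)) (value-digits b)
        (final-backward _ (digits a) (digits b) zero ≤-refl z≤n
            (trans (sym (cong toℕ (run-final (digits a) (digits b)))) c≡0))))
      (λ a≤b → trans (cong toℕ (run-final (digits a) (digits b)))
        (final-forward _ (digits a) (digits b) zero ≤-refl
          (subst₂ _≤_ (sym (trans (+-identityʳ _) (value-digits a))) (sym (value-digits b)) (≤ᵇ⇒≤ a b a≤b))))

⊓ᶠ : {Γ : Set} {ρ : Γ → Tree} {μ : Γ → ℕ} {m n : Γ → ℕ} → Feasible ρ μ (λ γ → num (m γ)) →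
     Feasible ρ μ (λ γ → num (n γ)) → Feasible ρ μ (λ γ → num (m γ ⊓ n γ))
⊓ᶠ {m = m} {n} p q = retarget (λ γ → cong num (lemma (m γ) (n γ))) (ifᶠ′ (λ _ → num) (≤ᶠ p q) p q)
  where
  lemma : ∀ a b → (if a ≤ᵇ b then a else b) ≡ a ⊓ b
  lemma a b with a ≤ᵇ b in eq
  ... | true  = sym (m≤n⇒m⊓n≡m (≤ᵇ⇒≤ a b (subst T (sym eq) tt)))
  ... | false = sym (m≥n⇒m⊓n≡n (<⇒≤ (≰⇒> λ a≤b → subst T eq (≤⇒≤ᵇ a≤b))))

-- Bit lengths and sizes of numbers

bits : ℕ → ℕ
bits n = length (digits n)

-- A bijective numeral with d digits has a value between 2^d - 1 (all ones) and 2^(d+1) - 2 (all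
-- twos), so `bits n` is the integer part of the binary logarithm of n + 1.
2^length≤value : ∀ ds → 2 ^ length ds ≤ suc (value ds)
2^length≤value []           = ≤-refl
2^length≤value (true ∷ ds)  = ≤-trans (*-monoʳ-≤ 2 (2^length≤value ds)) (≤-reflexive (*-suc 2 (value ds)))
2^length≤value (false ∷ ds) = ≤-trans (*-monoʳ-≤ 2 (2^length≤value ds)) (n≤1+n _)

value<2^length : ∀ ds → suc (value ds) < 2 ^ suc (length ds)
value<2^length []           = ≤-refl
value<2^length (true ∷ ds)  = ≤-trans (m≤n+m _ 1)
  (≤-trans (≤-reflexive (double (value ds))) (*-monoʳ-≤ 2 (value<2^length ds)))
  where
  double : ∀ v → suc (suc (suc (suc (2 * v)))) ≡ 2 * suc (suc v)
  double = solve-∀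
value<2^length (false ∷ ds) = ≤-trans (≤-reflexive (double (value ds))) (*-monoʳ-≤ 2 (value<2^length ds))
  where
  double : ∀ v → suc (suc (2 * suc v)) ≡ 2 * suc (suc v)
  double = solve-∀

2^bits≤ : ∀ n → 2 ^ bits n ≤ suc n
2^bits≤ n = subst (λ v → 2 ^ bits n ≤ suc v) (value-digits n) (2^length≤value (digits n))

<2^bits : ∀ n → suc n < 2 ^ suc (bits n)
<2^bits n = subst (λ v → suc v < 2 ^ suc (bits n)) (value-digits n) (value<2^length (digits n))

2^-cancel-< : ∀ a b → 2 ^ a < 2 ^ b → a < b
2^-cancel-< a b h = ≰⇒> λ b≤a → <-irrefl refl (<-≤-trans h (^-monoʳ-≤ 2 b≤a))

bits-mono : ∀ {m n} → m ≤ n → bits m ≤ bits n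
bits-mono {m} {n} m≤n =
    ≤-pred (2^-cancel-< (bits m) (suc (bits n)) (≤-<-trans (2^bits≤ m) (≤-<-trans (s≤s m≤n) (<2^bits n))))

-- From 1 + m + n ≤ (1 + m) (1 + n). What matters is that `bits m` occurs with coefficient 1: a
-- running sum then gains only a bounded number of bits per summand.
bits-+ : ∀ m n → bits (m + n) ≤ bits m + suc (bits n)
bits-+ m n = ≤-pred (2^-cancel-< (bits (m + n)) (suc (bits m) + suc (bits n)) (begin-strict
  2 ^ bits (m + n)                       ≤⟨ 2^bits≤ (m + n) ⟩
  suc (m + n)                            ≤⟨ m≤m+n _ (m * n) ⟩
  suc (m + n) + m * n                    ≡⟨ arithmetic m n ⟩
  suc m * suc n                          <⟨ *-mono-< (<2^bits m) (<2^bits n) ⟩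
  2 ^ suc (bits m) * 2 ^ suc (bits n)    ≡⟨ ^-distribˡ-+-* 2 (suc (bits m)) (suc (bits n)) ⟨
  2 ^ (suc (bits m) + suc (bits n))      ∎))
  where
  open ≤-Reasoning
  arithmetic : ∀ m n → suc (m + n) + m * n ≡ suc m * suc n
  arithmetic = solve-∀

size-encBits-upper : ∀ ds → size (encBits ds) ≤ suc (4 * length ds)
size-encBits-upper []       = ≤-refl
size-encBits-upper (d ∷ ds) =
  s≤s (≤-trans (+-mono-≤ (size-bool d) (size-encBits-upper ds)) (≤-reflexive (arithmetic (length ds))))
  where
  arithmetic : ∀ l → 3 + suc (4 * l) ≡ 4 * suc l
  arithmetic = solve-∀

size-encBits-lower : ∀ ds → suc (2 * length ds) ≤ size (encBits ds)
size-encBits-lower []       = ≤-refl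
size-encBits-lower (d ∷ ds) =
  s≤s (≤-trans (≤-reflexive (arithmetic (length ds)))
      (+-mono-≤ (size>0 (encodeBool d)) (size-encBits-lower ds)))
  where
  arithmetic : ∀ l → 2 * suc l ≡ 1 + suc (2 * l)
  arithmetic = solve-∀

num-encBits : ∀ n → num n ≡ encBits (digits n)
num-encBits n = trans (num≡ n) (sym (encBits-digits n))

size-num : ∀ n → size (num n) ≤ suc (4 * bits n)
size-num n = subst (λ t → size t ≤ suc (4 * bits n)) (sym (num-encBits n)) (size-encBits-upper (digits n))

bits≤size : ∀ n → bits n ≤ size (num n)
bits≤size n = ≤-trans (≤-trans (m≤m+n (bits n) (bits n + 0)) (n≤1+n _))
  (subst (λ t → suc (2 * bits n) ≤ size t) (sym (num-encBits n)) (size-encBits-lower (digits n)))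

-- Tree size itself is not monotone, since the digit 1 takes more nodes than the digit 2; the
-- comparison has to pass through the number of digits.
size-num-mono : ∀ {m n} → m ≤ n → size (num m) ≤ suc (4 * size (num n))
size-num-mono {m} {n} m≤n = ≤-trans (size-num m) (s≤s (*-monoʳ-≤ 4 (≤-trans (bits-mono m≤n) (bits≤size n))))

module _ {Γ : Set} {ρ η : Γ → Tree} {μ : Γ → ℕ} {A B : Γ → Set}
         (encA : ∀ γ → A γ → Tree) (encB : ∀ γ → B γ → Tree)
         (step : ∀ γ → B γ → A γ → B γ) (init : ∀ γ → B γ) (xs : ∀ γ → List (A γ)) where

  -- A sum has only additively more bits than its summands, which bounds accumulated weights.
  foldᶠ-weight : Feasible ρ μ η → Feasible ρ μ (λ γ → encB γ (init γ)) →
          Feasible ρ μ (λ γ → encList (encA γ) (xs γ)) →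
          Poly {Σ[ γ ∈ Γ ] B γ × A γ} (λ (γ , b , a) → (η γ ∙ encB γ b) ∙ encA γ a)
                                      (λ (γ , b , a) → encB γ (step γ b a)) →
          (weight : ∀ γ → B γ → ℕ) {M N : Γ → ℕ} → M ≼ μ → N ≼ μ →
          (∀ γ b → size (encB γ b) ≤ M γ + 4 * bits (weight γ b)) →
          (∀ γ → weight γ (init γ) ≡ 0) →
          (∀ γ b a → bits (weight γ (step γ b a)) ≤ bits (weight γ b) + N γ) →
          Feasible ρ μ (λ γ → encB γ (foldl (step γ) (init γ) (xs γ)))
  foldᶠ-weight env i l p weight {M} {N} M≼ N≼ small start grow =
    foldᶠ encA encB step init xs env i l p
      (≼-mono (λ γ → ≤-trans (peak≤ γ (init γ) (xs γ)) (+-monoʳ-≤ (M γ) (*-monoʳ-≤ 4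
                 (+-monoˡ-≤ (length (xs γ) * N γ) (≤-reflexive (cong bits (start γ)))))))
        (≼-+ M≼ (≼-* (≼-const 4) (≼-* (≼-mono (λ γ → length≤size (encA γ) (xs γ)) (size≼ l)) N≼))))
    where
    peak≤ : ∀ γ b as → peak (encB γ) (step γ) b as ≤ M γ + 4 * (bits (weight γ b) + length as * N γ)
    peak≤ γ b []       =
        ≤-trans (small γ b) (≤-reflexive (cong (λ z → M γ + 4 * z) (sym (+-identityʳ (bits (weight γ b))))))
    peak≤ γ b (a ∷ as) = ⊔-lub
      (≤-trans (small γ b)
          (+-monoʳ-≤ (M γ) (*-monoʳ-≤ 4 (m≤m+n (bits (weight γ b)) (length (a ∷ as) * N γ)))))
      (≤-trans (peak≤ γ (step γ b a) as) (+-monoʳ-≤ (M γ) (*-monoʳ-≤ 4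
        (≤-trans (+-monoˡ-≤ (length as * N γ) (grow γ b a))
            (≤-reflexive (+-assoc (bits (weight γ b)) (N γ) _))))))

-- For iterations whose states `s γ i` are known in closed form. It suffices to bound these states,
-- which also covers steps that multiply the size of the accumulator.
recᶠ : {Γ : Set} {ρ η : Γ → Tree} {μ : Γ → ℕ} {B : Γ → Set} (encB : ∀ γ → B γ → Tree)
       (step : ∀ γ → B γ → B γ) (s : ∀ γ → ℕ → B γ) (n : Γ → ℕ) → (∀ γ i → s γ (suc i) ≡ step γ (s γ i)) →
       Feasible ρ μ η → Feasible ρ μ (λ γ → encB γ (s γ 0)) → Feasible ρ μ (λ γ → unary (n γ)) →
       Poly {Σ Γ B} (λ (γ , b) → η γ ∙ encB γ b) (λ (γ , b) → encB γ (step γ b)) →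
       {N : Γ → ℕ} → N ≼ μ → (∀ γ i → i ≤ n γ → size (encB γ (s γ i)) ≤ N γ) →
       Feasible ρ μ (λ γ → encB γ (s γ (n γ)))
recᶠ {η = η} encB step s n s-suc env i l p {N} N≼ small =
  retarget (λ γ → cong (encB γ) (foldl≡ γ 0 (n γ)))
    (iterateᶠ {η = η} encB step (λ γ → s γ 0) n env i l p
      (≼-mono (λ γ → peak≤ γ 0 (n γ) ≤-refl) N≼))
  where
  foldl≡ : ∀ γ i m → foldl (λ b _ → step γ b) (s γ i) (replicate m leaf) ≡ s γ (i + m)
  foldl≡ γ i zero    = cong (s γ) (sym (+-identityʳ i))
  foldl≡ γ i (suc m) = trans (cong (λ b → foldl (λ b _ → step γ b) b (replicate m leaf)) (sym (s-suc γ i)))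
    (trans (foldl≡ γ (suc i) m) (cong (s γ) (sym (+-suc i m))))

  peak≤ : ∀ γ i m → i + m ≤ n γ → peak (encB γ) (λ b _ → step γ b) (s γ i) (replicate m leaf) ≤ N γ
  peak≤ γ i zero    h = small γ i (≤-trans (m≤m+n i 0) h)
  peak≤ γ i (suc m) h = ⊔-lub (small γ i (≤-trans (m≤m+n i (suc m)) h))
    (subst (λ b → peak (encB γ) (λ b _ → step γ b) b (replicate m leaf) ≤ N γ) (s-suc γ i)
      (peak≤ γ (suc i) m (≤-trans (≤-reflexive (sym (+-suc i m))) h)))

size-ʳ++ : {A : Set} (enc : A → Tree) (xs ys : List A) →
           size (encList enc (xs ʳ++ ys)) ≤ size (encList enc ys) + size (encList enc xs)
size-ʳ++ enc []       ys = m≤m+n _ _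
size-ʳ++ enc (x ∷ xs) ys =
  ≤-trans (size-ʳ++ enc xs (x ∷ ys))
      (≤-reflexive (arithmetic (size (enc x)) (size (encList enc ys)) (size (encList enc xs))))
  where
  arithmetic : ∀ a b c → suc (a + b) + c ≡ b + suc (a + c)
  arithmetic = solve-∀

concatMapᶠ : {Γ : Set} {ρ η : Γ → Tree} {μ : Γ → ℕ} {A B : Γ → Set} (encA : ∀ γ → A γ → Tree)
             (encB : ∀ γ → B γ → Tree)
             (f : ∀ γ → A γ → List (B γ)) (xs : ∀ γ → List (A γ)) →
             Feasible ρ μ η → Feasible ρ μ (λ γ → encList (encA γ) (xs γ)) →
             Poly {Σ Γ A} (λ (γ , a) → η γ ∙ encA γ a) (λ (γ , a) → encList (encB γ) (f γ a)) →
             Feasible ρ μ (λ γ → encList (encB γ) (concatMap (f γ) (xs γ)))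
concatMapᶠ encA encB f xs env l p =
  retarget (λ γ → cong (encList (encB γ))
    (trans (cong reverse (foldl-concatMap (f γ) (xs γ) [])) (reverse-involutive _)))
    (reverseᶠ encB (λ γ → foldl (λ out a → f γ a ʳ++ out) [] (xs γ))
      (foldᶠ-additive encA (λ γ → encList (encB γ)) (λ γ out a → f γ a ʳ++ out) (λ _ → []) xs env nilᶠ l
        (ʳ++ᶠ (λ (γ , _) → encB γ) (λ (γ , out , a) → f γ a) (λ (γ , out , a) → out)
          (consᶠ (leftᶠ (leftᶠ it)) (rightᶠ it) ⟫ pull (λ (γ , out , a) → γ , a) p) (rightᶠ (leftᶠ it)))
        {δ = λ (γ , a) → size (encList (encB γ) (f γ a))} (size≼ p)
        (λ γ out a → size-ʳ++ (encB γ) (f γ a) out)))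
  where
  foldl-concatMap : {X Y : Set} (g : X → List Y) (as : List X) (out : List Y) →
                    foldl (λ out a → g a ʳ++ out) out as ≡ concatMap g as ʳ++ out
  foldl-concatMap g []       out = refl
  foldl-concatMap g (a ∷ as) out = trans (foldl-concatMap g as (g a ʳ++ out)) (sym (++-ʳ++ (g a)))

unary-ʳ++ : ∀ m n → encList id (replicate m leaf ʳ++ replicate n leaf) ≡ unary (m + n)
unary-ʳ++ m n = trans (encList-id _) (cong encodeList (lemma m n))
  where
  lemma : ∀ m n → replicate m leaf ʳ++ replicate n leaf ≡ replicate (m + n) leaf
  lemma zero    n = refl
  lemma (suc m) n = trans (lemma m (suc n)) (cong (λ k → replicate k leaf) (+-suc m n))

size-unary-mono : ∀ {m n} → m ≤ n → size (unary m) ≤ size (unary n)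
size-unary-mono {m} {n} m≤n = subst₂ _≤_ (sym (size-unary m)) (sym (size-unary n)) (s≤s (+-mono-≤ m≤n m≤n))

≤size-unary : ∀ n → n ≤ size (unary n)
≤size-unary n = ≤-trans (m≤n+m n (suc n)) (≤-reflexive (sym (size-unary n)))

module _ {Γ : Set} {ρ : Γ → Tree} {μ : Γ → ℕ} {m n : Γ → ℕ}
         (p : Feasible ρ μ (λ γ → unary (m γ))) (q : Feasible ρ μ (λ γ → unary (n γ))) where

  unary-+ᶠ : Feasible ρ μ (λ γ → unary (m γ + n γ))
  unary-+ᶠ = retarget (λ γ → unary-ʳ++ (m γ) (n γ))
    (ʳ++ᶠ (λ _ → id) (λ γ → replicate (m γ) leaf) (λ γ → replicate (n γ) leaf)
      (retarget (λ γ → sym (unary-list (m γ))) p) (retarget (λ γ → sym (unary-list (n γ))) q))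

  unary-≤ᶠ : Feasible ρ μ (λ γ → encodeBool (m γ ≤ᵇ n γ))
  unary-≤ᶠ = retarget (λ γ → trans (cong (λ t → caseT t leaf (leaf ∙ leaf)) (drops-unary (n γ) (m γ)))
      (monus (m γ) (n γ)))
      (caseᶠ (dropsᶠ {n = n} q p) nilᶠ (constᶠ (leaf ∙ leaf)))
    where
    drops-unary : ∀ i j → drops i (unary j) ≡ unary (j ∸ i)
    drops-unary zero    j       = refl
    drops-unary (suc i) zero    = trans (drops-unary i zero) (cong unary (0∸n≡0 i))
    drops-unary (suc i) (suc j) = drops-unary i j

    monus : ∀ i j → caseT (unary (i ∸ j)) leaf (leaf ∙ leaf) ≡ encodeBool (i ≤ᵇ j)
    monus zero    zero    = refl
    monus zero    (suc j) = refl
    monus (suc i) zero    = refl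
    monus (suc zero)    (suc j) = cong (λ z → caseT (unary z) leaf (leaf ∙ leaf)) (0∸n≡0 j)
    monus (suc (suc i)) (suc j) = monus (suc i) j

unary-*ᶠ : {Γ : Set} {ρ : Γ → Tree} {μ : Γ → ℕ} {m n : Γ → ℕ} →
           Feasible ρ μ (λ γ → unary (m γ)) → Feasible ρ μ (λ γ → unary (n γ)) →
           Feasible ρ μ (λ γ → unary (m γ * n γ))
unary-*ᶠ {m = m} {n} p q =
  recᶠ {B = λ _ → ℕ} (λ _ → unary) (λ γ i → n γ + i) (λ γ i → i * n γ) m (λ _ _ → refl) q nilᶠ p
  (unary-+ᶠ (leftᶠ it) (rightᶠ it))
  {N = λ γ → suc (m γ * n γ + m γ * n γ)}
  (≼-suc (≼-+ m*n≼ m*n≼))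
  (λ γ i i≤m → ≤-trans (size-unary-mono (*-monoˡ-≤ (n γ) i≤m)) (≤-reflexive (size-unary (m γ * n γ))))
  where
  m*n≼ = ≼-* (≼-mono (λ γ → ≤size-unary (m γ)) (size≼ p)) (≼-mono (λ γ → ≤size-unary (n γ)) (size≼ q))

infix 4 _==_
_==_ : {n : ℕ} → Fin n → Fin n → Bool
i == j = (toℕ i ≤ᵇ toℕ j) ∧ (toℕ j ≤ᵇ toℕ i)

==⇒≡ : {n : ℕ} (i j : Fin n) → T (i == j) → i ≡ j
==⇒≡ i j h with toℕ i ≤ᵇ toℕ j in eq | toℕ j ≤ᵇ toℕ i in eq′
... | true | true = toℕ-injective
    (≤-antisym (≤ᵇ⇒≤ _ _ (subst T (sym eq) tt)) (≤ᵇ⇒≤ _ _ (subst T (sym eq′) tt)))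

==-refl : {n : ℕ} (i : Fin n) → T (i == i)
==-refl i with toℕ i ≤ᵇ toℕ i in eq
... | true  = tt
... | false = subst T eq (≤⇒≤ᵇ (≤-refl {toℕ i}))

==ᶠ : {Γ : Set} {ρ : Γ → Tree} {μ : Γ → ℕ} {n : Γ → ℕ} {i j : ∀ γ → Fin (n γ)} →
      Feasible ρ μ (λ γ → finᵗ (i γ)) → Feasible ρ μ (λ γ → finᵗ (j γ)) →
      Feasible ρ μ (λ γ → encodeBool (i γ == j γ))
==ᶠ {i = i} {j} p q = ∧ᶠ (unary-≤ᶠ {m = toℕ ∘ i} {toℕ ∘ j} p q) (unary-≤ᶠ {m = toℕ ∘ j} {toℕ ∘ i} q p)

-- Enumeration of words

wordsUpTo : {A : Set} → List A → ℕ → List (List A)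
wordsUpTo as zero    = [] ∷ []
wordsUpTo as (suc n) = [] ∷ cartesianProductWith _∷_ as (wordsUpTo as n)

∈-wordsUpTo⁺ : {A : Set} {as : List A} (n : ℕ) {w : List A} → length w ≤ n → All (_∈ as) w →
    w ∈ wordsUpTo as n
∈-wordsUpTo⁺ zero    {[]} _ _        = here refl
∈-wordsUpTo⁺ (suc n) {[]} _ _        = here refl
∈-wordsUpTo⁺ (suc n) {a ∷ w} (s≤s l) (a∈ ∷ h) = there (∈-cartesianProductWith⁺ _∷_ a∈ (∈-wordsUpTo⁺ n l h))

∈-wordsUpTo⁻ : {A : Set} (as : List A) (n : ℕ) {w : List A} → w ∈ wordsUpTo as n →
    length w ≤ n × All (_∈ as) w
∈-wordsUpTo⁻ as zero    (here refl) = z≤n , []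
∈-wordsUpTo⁻ as (suc n) (here refl) = z≤n , []
∈-wordsUpTo⁻ as (suc n) (there h) with ∈-cartesianProductWith⁻ _∷_ as (wordsUpTo as n) h
... | a , w , a∈ , w∈ , refl with ∈-wordsUpTo⁻ as n w∈
... | l , all = s≤s l , a∈ ∷ all

length-product : {A B C : Set} (f : A → B → C) (xs : List A) (ys : List B) →
                 length (cartesianProductWith f xs ys) ≡ length xs * length ys
length-product f []       ys = refl
length-product f (x ∷ xs) ys =
    trans (length-++ (map (f x) ys)) (cong₂ _+_ (length-map (f x) ys) (length-product f xs ys))

-- Padding short words with a blank turns them into words of length exactly n over an alphabet with
-- one more letter.
length-wordsUpTo : {A : Set} (as : List A) (n : ℕ) → length (wordsUpTo as n) ≤ suc (length as) ^ n
length-wordsUpTo as zero    = ≤-refl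
length-wordsUpTo as (suc n) = +-mono-≤ (m^n>0 (suc (length as)) n)
  (≤-trans (≤-reflexive (length-product _∷_ as (wordsUpTo as n)))
      (*-monoʳ-≤ (length as) (length-wordsUpTo as n)))

size-encList : {A : Set} (enc : A → Tree) (N : ℕ) (xs : List A) → All (λ a → size (enc a) ≤ N) xs →
               size (encList enc xs) ≤ suc (length xs * suc N)
size-encList enc N []       []       = ≤-refl
size-encList enc N (x ∷ xs) (h ∷ hs) =
    s≤s (≤-trans (+-mono-≤ h (size-encList enc N xs hs)) (≤-reflexive (+-suc N _)))

module _ {Γ : Set} {ρ : Γ → Tree} {μ : Γ → ℕ} {A : Γ → Set} (enc : ∀ γ → A γ → Tree)
         (as : ∀ γ → List (A γ)) (n : Γ → ℕ) where

  -- Each step multiplies the list, so no additive estimate applies. The bound on the number of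
  -- words is left as a hypothesis; this is where a measure exponential in the parameter comes in.
  wordsᶠ : Feasible ρ μ (λ γ → encList (enc γ) (as γ)) → Feasible ρ μ (λ γ → unary (n γ)) →
           (λ γ → suc (length (as γ)) ^ n γ) ≼ μ →
           Feasible ρ μ (λ γ → encList (encList (enc γ)) (wordsUpTo (as γ) (n γ)))
  wordsᶠ p q count≼ = recᶠ (λ γ → encList (encList (enc γ))) step (λ γ → wordsUpTo (as γ)) n
    (λ γ i → cong ([] ∷_) (product≡ (as γ) (wordsUpTo (as γ) i)))
    p (constᶠ (leaf ∙ leaf)) q
    (consᶠ nilᶠ (concatMapᶠ (λ (γ , _) → enc γ) (λ (γ , _) → encList (enc γ)) (λ (γ , ws) a → map (a ∷_) ws)
      (λ (γ , ws) → as γ) (rightᶠ it) (leftᶠ it)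
      (retarget (λ ((γ , ws) , a) → cong encodeList (map-∘ ws))
        (mapᶠ (λ ((γ , ws) , a) → encList (enc γ)) (λ ((γ , ws) , a) → ws)
          {τ = λ (((γ , ws) , a) , w) → encList (enc γ) (a ∷ w)} (rightᶠ it) (leftᶠ it)
          (consᶠ (leftᶠ it) (rightᶠ it))))))
    {N = λ γ → suc (suc (length (as γ)) ^ n γ * suc (suc (n γ * suc (size (encList (enc γ) (as γ))))))}
    (≼-suc (≼-* count≼ (≼-suc (≼-suc (≼-* (≼-mono (λ γ → ≤size-unary (n γ)) (size≼ q)) (≼-suc (size≼ p)))))))
    (λ γ i i≤n → ≤-trans
        (size-encList (encList (enc γ)) (suc (n γ * suc (size (encList (enc γ) (as γ))))) (wordsUpTo (as γ) i)
        (All.tabulate λ w∈ → word-size γ (≤-trans (proj₁ (∈-wordsUpTo⁻ (as γ) i w∈)) i≤n)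
            (proj₂ (∈-wordsUpTo⁻ (as γ) i w∈))))
      (s≤s (*-monoˡ-≤ _ (≤-trans (length-wordsUpTo (as γ) i) (^-monoʳ-≤ (suc (length (as γ))) i≤n)))))
    where
    step : ∀ γ → List (List (A γ)) → List (List (A γ))
    step γ ws = [] ∷ concatMap (λ a → map (a ∷_) ws) (as γ)

    product≡ : {X : Set} (xs : List X) (ws : List (List X)) →
        cartesianProductWith _∷_ xs ws ≡ concatMap (λ a → map (a ∷_) ws) xs
    product≡ []       ws = refl
    product≡ (x ∷ xs) ws = cong (map (x ∷_) ws ++_) (product≡ xs ws)

    word-size : ∀ γ {w} → length w ≤ n γ → All (_∈ as γ) w →
                size (encList (enc γ) w) ≤ suc (n γ * suc (size (encList (enc γ) (as γ))))
    word-size γ {w} l all =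
      ≤-trans (size-encList (enc γ) _ w (All.map (All.lookup (all-size≤ (enc γ) (as γ))) all))
      (s≤s (*-monoˡ-≤ (suc (size (encList (enc γ) (as γ)))) l))

-- Brute-force search

foldl-⊓≤ : {A : Set} (f : A → ℕ) (w : ℕ) (xs : List A) → foldl (λ w x → w ⊓ f x) w xs ≤ w
foldl-⊓≤ f w []       = ≤-refl
foldl-⊓≤ f w (x ∷ xs) = ≤-trans (foldl-⊓≤ f _ xs) (m⊓n≤m w _)

-- What remains of the three problems once distances are known: k vehicles have to visit all stops, and
-- no vehicle has more than `limit` of them.
record Core : Set where
  field
    n              : ℕ
    dist           : Fin n → Fin n → ℕ
    demand         : Fin n → ℕ
    depots stops   : List (Fin n)
    vehicles limit : ℕ
    ℓ g r          : ℕ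

  leg : Fin n × ℕ → Fin n → Fin n × ℕ
  leg (u , w) v = v , w + dist u v

  legs : Fin n → List (Fin n) → Fin n × ℕ
  legs d route = foldl leg (d , 0) route

  roundTrip : List (Fin n) → Fin n → ℕ
  roundTrip route d = proj₂ (legs d route) + dist (proj₁ (legs d route)) d

  -- The initial value r + 1 plays the role of infinity: a result within the budget must come from
  -- an actual depot, and all intermediate minima stay small. The depot minimizing the round trip is
  -- best for the gas capacity and for the total weight alike.
  tour : List (Fin n) → ℕ
  tour route = foldl (λ w d → w ⊓ roundTrip route d) (suc r) depots

  load : List (Fin n) → ℕ
  load route = foldl (λ w v → w + demand v) 0 route

  total : List (List (Fin n)) → ℕ
  total plan = foldl (λ w route → w + tour route) 0 plan

  admissible : List (Fin n) → Bool
  admissible route = (load route ≤ᵇ ℓ) ∧ (tour route ≤ᵇ g)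

  serves : List (List (Fin n)) → Fin n → Bool
  serves plan v = any (λ route → any (v ==_) route) plan

  valid : List (List (Fin n)) → Bool
  valid plan = (all (serves plan) stops ∧ all admissible plan) ∧ (total plan ≤ᵇ r)

  -- Too many stops cannot be served within the limits, and then no plan over the empty alphabet is valid.
  alphabet : List (Fin n)
  alphabet = if length stops ≤ᵇ vehicles * limit then stops else []

  plans : List (List (List (Fin n)))
  plans = wordsUpTo (wordsUpTo alphabet limit) vehicles

  answer : Bool
  answer = any valid plans

  -- `vehicles` and `limit` are unary because they control the depth of recursions; in all three
  -- problems they are bounded in terms of the parameter.
  encodeCore : Tree
  encodeCore = encodeTable (λ u → encodeTable (λ v → num (dist u v))) ∙
    (encodeTable (λ v → num (demand v)) ∙ (encList finᵗ depots ∙ (encList finᵗ stops ∙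
    (unary vehicles ∙ (unary limit ∙ (num ℓ ∙ (num g ∙ num r)))))))

module _ where

  open Core

  size-table : ∀ {n} (f : Fin n → Tree) i → size (f i) ≤ size (encodeTable f)
  size-table f zero    = ≤-trans (m≤m+n _ _) (n≤1+n _)
  size-table f (suc i) = ≤-trans (size-table (f ∘ suc) i) (≤-trans (m≤n+m _ _) (n≤1+n _))

  table-length : ∀ {n} (f : Fin n → Tree) → n ≤ size (encodeTable f)
  table-length {zero}  f = z≤n
  table-length {suc n} f = s≤s (≤-trans (table-length (f ∘ suc)) (m≤n+m _ _))

  size-fin : ∀ {n} (i : Fin n) → size (finᵗ i) ≤ suc (n + n)
  size-fin i = ≤-trans (≤-reflexive (size-unary (toℕ i))) (s≤s (+-mono-≤ (<⇒≤ (toℕ<n i)) (<⇒≤ (toℕ<n i))))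

  module _ (P : Core) where

    private
      N = size (encodeCore P)

    n≤core : n P ≤ N
    n≤core = ≤-trans (table-length (λ u → encodeTable (λ v → num (dist P u v)))) (size-leftT (encodeCore P))

    dist≤core : ∀ u v → bits (dist P u v) ≤ N
    dist≤core u v = ≤-trans (bits≤size _) (≤-trans (size-table (λ v → num (dist P u v)) v)
      (≤-trans (size-table (λ u → encodeTable (λ v → num (dist P u v))) u) (size-leftT (encodeCore P))))

    demand≤core : ∀ v → bits (demand P v) ≤ N
    demand≤core v = ≤-trans (bits≤size _) (≤-trans (size-table (λ v → num (demand P v)) v)
      (≤-trans (size-leftT (rightT (encodeCore P))) (size-rightT (encodeCore P))))

  module _ {Γ : Set} {ρ : Γ → Tree} {μ : Γ → ℕ} {P : Γ → Core} (p : Feasible ρ μ (λ γ → encodeCore (P γ)))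
      where

    distᶠ : Feasible ρ μ (λ γ → encodeTable (λ u → encodeTable (λ v → num (dist (P γ) u v))))
    distᶠ = leftᶠ p
    demandᶠ : Feasible ρ μ (λ γ → encodeTable (λ v → num (demand (P γ) v)))
    demandᶠ = leftᶠ (rightᶠ p)
    depotsᶠ : Feasible ρ μ (λ γ → encList finᵗ (depots (P γ)))
    depotsᶠ = leftᶠ (rightᶠ (rightᶠ p))
    stopsᶠ : Feasible ρ μ (λ γ → encList finᵗ (stops (P γ)))
    stopsᶠ = leftᶠ (rightᶠ (rightᶠ (rightᶠ p)))
    vehiclesᶠ : Feasible ρ μ (λ γ → unary (vehicles (P γ)))
    vehiclesᶠ = leftᶠ (rightᶠ (rightᶠ (rightᶠ (rightᶠ p))))
    limitᶠ : Feasible ρ μ (λ γ → unary (limit (P γ)))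
    limitᶠ = leftᶠ (rightᶠ (rightᶠ (rightᶠ (rightᶠ (rightᶠ p)))))
    ℓᶠ : Feasible ρ μ (λ γ → num (ℓ (P γ)))
    ℓᶠ = leftᶠ (rightᶠ (rightᶠ (rightᶠ (rightᶠ (rightᶠ (rightᶠ p))))))
    gᶠ : Feasible ρ μ (λ γ → num (g (P γ)))
    gᶠ = leftᶠ (rightᶠ (rightᶠ (rightᶠ (rightᶠ (rightᶠ (rightᶠ (rightᶠ p)))))))
    rᶠ : Feasible ρ μ (λ γ → num (r (P γ)))
    rᶠ = rightᶠ (rightᶠ (rightᶠ (rightᶠ (rightᶠ (rightᶠ (rightᶠ (rightᶠ p)))))))

    stepᶠ : {u v : ∀ γ → Fin (n (P γ))} → Feasible ρ μ (λ γ → finᵗ (u γ)) → Feasible ρ μ (λ γ → finᵗ (v γ)) →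
            Feasible ρ μ (λ γ → num (dist (P γ) (u γ) (v γ)))
    stepᶠ {u} {v} a b = indexᶠ {n = λ γ → n (P γ)} (λ γ v → num (dist (P γ) (u γ) v))
      (indexᶠ {n = λ γ → n (P γ)} (λ γ u → encodeTable (λ v → num (dist (P γ) u v))) distᶠ a) b

  encRoute : (P : Core) → List (Fin (n P)) → Tree
  encRoute P = encList finᵗ

  encPlan : (P : Core) → List (List (Fin (n P))) → Tree
  encPlan P = encList (encList finᵗ)

  legsᶠ : {Γ : Set} {ρ : Γ → Tree} {μ : Γ → ℕ} {P : Γ → Core} {d : ∀ γ → Fin (n (P γ))}
          {route : ∀ γ → List (Fin (n (P γ)))} →
          Feasible ρ μ (λ γ → encodeCore (P γ)) → Feasible ρ μ (λ γ → finᵗ (d γ)) →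
          Feasible ρ μ (λ γ → encRoute (P γ) (route γ)) →
          Feasible ρ μ (λ γ → finᵗ (proj₁ (legs (P γ) (d γ) (route γ))) ∙ num
              (proj₂ (legs (P γ) (d γ) (route γ))))
  legsᶠ {P = P} {d} {route} p q l =
    foldᶠ-weight (λ γ → finᵗ) (λ γ (u , w) → finᵗ u ∙ num w) (λ γ → leg (P γ)) (λ γ → d γ , 0) route
    p (consᶠ q (constᶠ (num 0))) l
    (consᶠ (rightᶠ it) (+ᶠ (rightᶠ (rightᶠ (leftᶠ it)))
        (stepᶠ {P = λ (γ , _) → P γ} (leftᶠ (leftᶠ it)) (leftᶠ (rightᶠ (leftᶠ it))) (rightᶠ it))))
    (λ γ → proj₂)
    {M = λ γ → suc (suc (n (P γ) + n (P γ)) + 1)} {N = λ γ → suc (size (encodeCore (P γ)))}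
    (≼-suc (≼-+ (≼-suc (≼-+ n≼ n≼)) (≼-const 1))) (≼-suc (size≼ p))
    (λ γ (u , w) → ≤-trans (s≤s (+-mono-≤ (size-fin u) (size-num w)))
        (≤-reflexive (arithmetic (n (P γ)) (4 * bits w))))
    (λ γ → refl)
    (λ γ (u , w) v → ≤-trans (bits-+ w (dist (P γ) u v)) (+-monoʳ-≤ (bits w) (s≤s (dist≤core (P γ) u v))))
    where
    n≼ = ≼-mono (λ γ → n≤core (P γ)) (size≼ p)
    arithmetic : ∀ a b → suc (suc (a + a) + suc b) ≡ suc (suc (a + a) + 1) + b
    arithmetic = solve-∀

  roundTripᶠ : {Γ : Set} {ρ : Γ → Tree} {μ : Γ → ℕ} {P : Γ → Core} {route : ∀ γ → List (Fin (n (P γ)))}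
          {d : ∀ γ → Fin (n (P γ))} →
          Feasible ρ μ (λ γ → encodeCore (P γ)) → Feasible ρ μ (λ γ → encRoute (P γ) (route γ)) →
          Feasible ρ μ (λ γ → finᵗ (d γ)) →
          Feasible ρ μ (λ γ → num (roundTrip (P γ) (route γ) (d γ)))
  roundTripᶠ {P = P} {route} {d} p l q = +ᶠ (rightᶠ (legsᶠ {P = P} {d} {route} p q l))
    (stepᶠ {P = P} p (leftᶠ (legsᶠ {P = P} {d} {route} p q l)) q)

  tour≤ : (P : Core) (route : List (Fin (n P))) → tour P route ≤ suc (r P)
  tour≤ P route = foldl-⊓≤ (roundTrip P route) (suc (r P)) (depots P)

  suc-rᶠ : {Γ : Set} {ρ : Γ → Tree} {μ : Γ → ℕ} {P : Γ → Core} → Feasible ρ μ (λ γ → encodeCore (P γ)) →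
           Feasible ρ μ (λ γ → num (suc (r (P γ))))
  suc-rᶠ {P = P} p = +ᶠ (constᶠ (num 1)) (rᶠ {P = P} p)

  tourᶠ : Poly {Σ[ P ∈ Core ] List (Fin (n P))} (λ (P , route) → encodeCore P ∙ encRoute P route)
      (λ (P , route) → num (tour P route))
  tourᶠ = foldᶠ (λ _ → finᵗ) (λ _ → num) (λ (P , route) w d → w ⊓ roundTrip P route d) (λ (P , _) → suc (r P))
    (λ (P , _) → depots P)
    it r′ᶠ (depotsᶠ {P = proj₁} (leftᶠ it))
    (⊓ᶠ (rightᶠ (leftᶠ it))
        (roundTripᶠ {P = λ ((P , _) , _) → P} (leftᶠ (leftᶠ (leftᶠ it))) (rightᶠ (leftᶠ (leftᶠ it)))
            (rightᶠ it)))
    (≼-mono (λ (P , route) → peak-invariant num (λ w d → w ⊓ roundTrip P route d) (_≤ suc (r P))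
        (suc (4 * size (num (suc (r P)))))
        (λ w d w≤ → ≤-trans (m⊓n≤m w _) w≤) (λ w w≤ → size-num-mono w≤) (suc (r P)) (depots P) ≤-refl)
      (≼-suc (≼-* (≼-const 4) (size≼ r′ᶠ))))
    where
    r′ᶠ = suc-rᶠ {P = proj₁} (leftᶠ it)

  loadᶠ : Poly {Σ[ P ∈ Core ] List (Fin (n P))} (λ (P , route) → encodeCore P ∙ encRoute P route)
      (λ (P , route) → num (load P route))
  loadᶠ = foldᶠ-weight (λ _ → finᵗ) (λ _ → num) (λ (P , _) w v → w + demand P v) (λ _ → 0) proj₂
    (leftᶠ it) (constᶠ (num 0)) (rightᶠ it)
    (+ᶠ (rightᶠ (leftᶠ it))
        (indexᶠ {n = λ ((P , _) , _) → n P} (λ ((P , _) , _) v → num (demand P v))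
            (demandᶠ {P = λ ((P , _) , _) → P} (leftᶠ (leftᶠ it))) (rightᶠ it)))
    (λ _ → id) {M = λ _ → 1} {N = λ (P , _) → suc (size (encodeCore P))} (≼-const 1)
        (≼-suc (≼-mono (λ _ → ≤-trans (m≤m+n _ _) (n≤1+n _)) ≼-refl))
    (λ _ w → size-num w) (λ _ → refl)
    (λ (P , _) w v → ≤-trans (bits-+ w (demand P v)) (+-monoʳ-≤ (bits w) (s≤s (demand≤core P v))))

  -- Since tours are capped at r + 1, the bit length of each summand depends on the budget alone and
  -- not on the route.
  totalᶠ : Poly {Σ[ P ∈ Core ] List (List (Fin (n P)))} (λ (P , plan) → encodeCore P ∙ encPlan P plan)
      (λ (P , plan) → num (total P plan))
  totalᶠ = foldᶠ-weight (λ (P , _) → encRoute P) (λ _ → num) (λ (P , _) w route → w + tour P route)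
    (λ _ → 0) proj₂
    (leftᶠ it) (constᶠ (num 0)) (rightᶠ it)
    (+ᶠ (rightᶠ (leftᶠ it))
        (consᶠ (leftᶠ (leftᶠ it)) (rightᶠ it) ⟫ pull (λ ((P , _) , _ , route) → P , route) tourᶠ))
    (λ _ → id) {M = λ _ → 1} {N = λ (P , _) → suc (size (num (suc (r P))))} (≼-const 1) (≼-suc (size≼ r′ᶠ))
    (λ _ w → size-num w) (λ _ → refl)
    (λ (P , _) w route → ≤-trans (bits-+ w (tour P route))
        (+-monoʳ-≤ (bits w) (s≤s (≤-trans (bits-mono (tour≤ P route)) (bits≤size _)))))
    where
    r′ᶠ : Poly {Σ[ P ∈ Core ] List (List (Fin (n P)))} (λ (P , plan) → encodeCore P ∙ encPlan P plan)
        (λ (P , _) → num (suc (r P)))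
    r′ᶠ = suc-rᶠ {P = proj₁} (leftᶠ it)

  admissibleᶠ : Poly {Σ[ P ∈ Core ] List (Fin (n P))} (λ (P , route) → encodeCore P ∙ encRoute P route)
      (λ (P , route) → encodeBool (admissible P route))
  admissibleᶠ = ∧ᶠ (≤ᶠ loadᶠ (ℓᶠ {P = proj₁} (leftᶠ it))) (≤ᶠ tourᶠ (gᶠ {P = proj₁} (leftᶠ it)))

  servesᶠ : Poly {Σ[ P ∈ Core ] List (List (Fin (n P))) × Fin (n P)}
                 (λ (P , plan , v) → encPlan P plan ∙ finᵗ v)
                 (λ (P , plan , v) → encodeBool (serves P plan v))
  servesᶠ = anyᶠ (λ (P , _) → encRoute P) (λ (P , _ , v) route → any (v ==_) route) (λ (P , plan , v) → plan)
    (rightᶠ it) (leftᶠ it)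
    (anyᶠ (λ _ → finᵗ) (λ ((P , _ , v) , _) u → v == u) (λ (_ , route) → route) (leftᶠ it) (rightᶠ it)
      (==ᶠ {n = λ (((P , _) , _) , _) → n P} (leftᶠ it) (rightᶠ it)))

  validᶠ : Poly {Σ[ P ∈ Core ] List (List (Fin (n P)))} (λ (P , plan) → encodeCore P ∙ encPlan P plan)
      (λ (P , plan) → encodeBool (valid P plan))
  validᶠ = ∧ᶠ (∧ᶠ
      (allᶠ (λ _ → finᵗ) (λ (P , plan) → serves P plan) (λ (P , _) → stops P) (rightᶠ it)
        (stopsᶠ {P = proj₁} (leftᶠ it))
        (pull (λ ((P , plan) , v) → P , plan , v) servesᶠ))
      (allᶠ (λ (P , _) → encRoute P) (λ (P , _) → admissible P) proj₂ (leftᶠ it) (rightᶠ it)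
        (pull (λ ((P , plan) , route) → P , route) admissibleᶠ)))
    (≤ᶠ totalᶠ (rᶠ {P = proj₁} (leftᶠ it)))

  -- With at most k b stops there are at most 2 ^ (k b b) routes of length at most b, and k of them form a plan.
  searchBound : ℕ → ℕ → ℕ
  searchBound k b = 2 ^ (suc (k * b * b) * k)

  module _ (P : Core) where

    length-alphabet : length (alphabet P) ≤ vehicles P * limit P
    length-alphabet with length (stops P) ≤ᵇ vehicles P * limit P in eq
    ... | true  = ≤ᵇ⇒≤ _ _ (subst T (sym eq) tt)
    ... | false = z≤n

    routes-count : suc (length (alphabet P)) ^ limit P ≤ 2 ^ (vehicles P * limit P * limit P)
    routes-count = ≤-trans
      (^-monoˡ-≤ (limit P) (≤-trans (s≤s length-alphabet) (suc≤2^ (vehicles P * limit P))))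
      (≤-reflexive (^-*-assoc 2 (vehicles P * limit P) (limit P)))

    plans-count : suc (length (wordsUpTo (alphabet P) (limit P))) ^ vehicles P ≤ searchBound (vehicles P)
        (limit P)
    plans-count = ≤-trans
        (^-monoˡ-≤ (vehicles P)
            (≤-trans (s≤s (≤-trans (length-wordsUpTo (alphabet P) (limit P)) routes-count))
        (+-mono-≤ (m^n>0 2 e) (m≤m+n (2 ^ e) 0))))
      (≤-reflexive (^-*-assoc 2 (suc e) (vehicles P)))
      where
      e = vehicles P * limit P * limit P

  answerᶠ : {Γ : Set} {ρ : Γ → Tree} {μ : Γ → ℕ} {P : Γ → Core} → Feasible ρ μ (λ γ → encodeCore (P γ)) →
            (λ γ → 2 ^ (vehicles (P γ) * limit (P γ) * limit (P γ))) ≼ μ →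
            (λ γ → searchBound (vehicles (P γ)) (limit (P γ))) ≼ μ →
            Feasible ρ μ (λ γ → encodeBool (answer (P γ)))
  answerᶠ {P = P} p routes≼ plans≼ = anyᶠ (λ γ → encPlan (P γ)) (λ γ → valid (P γ)) (λ γ → plans (P γ)) p
    (wordsᶠ (λ γ → encRoute (P γ)) (λ γ → wordsUpTo (alphabet (P γ)) (limit (P γ))) (λ γ → vehicles (P γ))
      (wordsᶠ (λ γ → finᵗ) (λ γ → alphabet (P γ)) (λ γ → limit (P γ))
        (ifᶠ′ (λ γ → encRoute (P γ))
            (unary-≤ᶠ {m = λ γ → length (stops (P γ))} {n = λ γ → vehicles (P γ) * limit (P γ)}
            (lengthᶠ (λ γ → finᵗ) (λ γ → stops (P γ)) (stopsᶠ {P = P} p))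
            (unary-*ᶠ {m = λ γ → vehicles (P γ)} (vehiclesᶠ {P = P} p) (limitᶠ {P = P} p)))
          (stopsᶠ {P = P} p) nilᶠ)
        (limitᶠ {P = P} p)
        (≼-mono (λ γ → routes-count (P γ)) routes≼))
      (vehiclesᶠ {P = P} p)
      (≼-mono (λ γ → plans-count (P γ)) plans≼))
    (pull (λ (γ , plan) → P γ , plan) validᶠ)

-- All-pairs distances

module _ where

  open CVRPInstance

  optional : {A : Set} → Dec A → (A → ℕ) → ℕ → ℕ
  optional (yes a) f d = f a
  optional (no _)  f d = d

  optionalᶠ : {Γ : Set} {ρ : Γ → Tree} {μ : Γ → ℕ} {A : Γ → Set} (a? : ∀ γ → Dec (A γ)) (f : ∀ γ → A γ → ℕ)
              (d : Γ → ℕ) →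
              Feasible ρ μ (λ γ → encodeOptional (a? γ) (f γ)) → Feasible ρ μ (λ γ → num (d γ)) →
              Feasible ρ μ (λ γ → num (optional (a? γ) (f γ) (d γ)))
  optionalᶠ a? f d p q = retarget (λ γ → lemma (a? γ)) (caseᶠ p (rightᶠ p) q)
    where
    lemma : ∀ {A : Set} (a? : Dec A) {f : A → ℕ} {d} →
        caseT (encodeOptional a? f) (rightT (encodeOptional a? f)) (num d) ≡ num (optional a? f d)
    lemma (yes a) = sym (num≡ _)
    lemma (no _)  = refl

  Matrix : CVRPInstance → Set
  Matrix I = V I → V I → ℕ

  encMatrix : (I : CVRPInstance) → Matrix I → Tree
  encMatrix I D = encodeTable (λ u → encodeTable (λ v → num (D u v)))

  -- Non-edges cost more than the total budget r, which makes infinite distances unnecessary.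
  initial : (I : CVRPInstance) → Matrix I
  initial I u v = if u == v then 0 else optional (T? (adjacent I u v)) (weight I) (suc (r I))

  relax : (I : CVRPInstance) → Matrix I → V I → Matrix I
  relax I D s u v = D u v ⊓ (D u s + D s v)

  distances : (I : CVRPInstance) → Matrix I
  distances I = foldl (relax I) (initial I) (allFin (order I))

  module _ {Γ : Set} {ρ : Γ → Tree} {μ : Γ → ℕ} {I : Γ → CVRPInstance}
      (p : Feasible ρ μ (λ γ → encodeCVRP (I γ))) where

    graphᶠ : Feasible ρ μ
        (λ γ → encodeTable (λ u → encodeTable
            (λ v → encodeOptional (T? (adjacent (I γ) u v)) (weight (I γ)))))
    graphᶠ = leftᶠ p
    orderᶠ : Feasible ρ μ (λ γ → unary (order (I γ)))
    orderᶠ = table-sizeᶠ (λ γ u → encodeTable (λ v → encodeOptional (T? (adjacent (I γ) u v)) (weight (I γ))))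
        graphᶠ
    Dᶠ : Feasible ρ μ (λ γ → encodeSubset (D (I γ)))
    Dᶠ = leftᶠ (rightᶠ p)
    Cᶠ : Feasible ρ μ (λ γ → encodeSubset (C (I γ)))
    Cᶠ = leftᶠ (rightᶠ (rightᶠ p))
    kᶠ : Feasible ρ μ (λ γ → num (k (I γ)))
    kᶠ = retarget (λ γ → sym (num≡ _)) (leftᶠ (rightᶠ (rightᶠ (rightᶠ p))))
    budgetᶠ : Feasible ρ μ (λ γ → num (r (I γ)))
    budgetᶠ = retarget (λ γ → sym (num≡ _)) (leftᶠ (rightᶠ (rightᶠ (rightᶠ (rightᶠ p)))))

  size-table≤ : ∀ {n} (f : Fin n → Tree) N → (∀ i → size (f i) ≤ N) → size (encodeTable f) ≤ suc (n * suc N)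
  size-table≤ {zero}  f N h = ≤-refl
  size-table≤ {suc n} f N h =
      s≤s (≤-trans (+-mono-≤ (h zero) (size-table≤ (f ∘ suc) N (h ∘ suc))) (≤-reflexive (+-suc N _)))

  initialᶠ : Poly encodeCVRP (λ I → encMatrix I (initial I))
  initialᶠ = tableᶠ order (orderᶠ {I = id} it) it
    (tableᶠ (λ (I , u) → order I) (orderᶠ {I = proj₁} (leftᶠ it)) it
      (ifᶠ′ (λ _ → num) (==ᶠ {n = λ ((I , _) , _) → order I} (rightᶠ (leftᶠ it)) (rightᶠ it)) (constᶠ (num 0))
        (optionalᶠ (λ ((I , u) , v) → T? (adjacent I u v)) (λ ((I , u) , v) → weight I)
          (λ ((I , _) , _) → suc (r I))
          (indexᶠ {n = λ ((I , _) , _) → order I}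
            (λ ((I , u) , _) v → encodeOptional (T? (adjacent I u v)) (weight I))
            (indexᶠ {n = λ ((I , _) , _) → order I}
              (λ ((I , _) , _) u → encodeTable (λ v → encodeOptional (T? (adjacent I u v)) (weight I)))
              (graphᶠ {I = λ ((I , _) , _) → I} (leftᶠ (leftᶠ it))) (rightᶠ (leftᶠ it)))
            (rightᶠ it))
          (+ᶠ (constᶠ (num 1)) (budgetᶠ {I = λ ((I , _) , _) → I} (leftᶠ (leftᶠ it)))))))

  entryᶠ : {Γ : Set} {ρ : Γ → Tree} {μ : Γ → ℕ} (I : Γ → CVRPInstance) (D : ∀ γ → Matrix (I γ))
           {u v : ∀ γ → V (I γ)} →
           Feasible ρ μ (λ γ → encMatrix (I γ) (D γ)) → Feasible ρ μ (λ γ → finᵗ (u γ)) →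
           Feasible ρ μ (λ γ → finᵗ (v γ)) →
           Feasible ρ μ (λ γ → num (D γ (u γ) (v γ)))
  entryᶠ I D {u} p a b = indexᶠ {n = λ γ → order (I γ)} (λ γ v → num (D γ (u γ) v))
    (indexᶠ {n = λ γ → order (I γ)} (λ γ u → encodeTable (λ v → num (D γ u v))) p a) b

  relaxᶠ : Poly {Σ[ I ∈ CVRPInstance ] Matrix I × V I} (λ (I , D , s) → encMatrix I D ∙ finᵗ s)
      (λ (I , D , s) → encMatrix I (relax I D s))
  relaxᶠ = tableᶠ (λ (I , _) → order I)
    (table-sizeᶠ (λ (I , D , s) u → encodeTable (λ v → num (D u v))) (leftᶠ it)) it
    (tableᶠ (λ ((I , _) , _) → order I)
      (table-sizeᶠ (λ ((I , D , s) , _) u → encodeTable (λ v → num (D u v))) (leftᶠ (leftᶠ it))) it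
      (⊓ᶠ (entryᶠ inst mat (leftᶠ (leftᶠ (leftᶠ it))) (rightᶠ (leftᶠ it)) (rightᶠ it))
        (+ᶠ (entryᶠ inst mat (leftᶠ (leftᶠ (leftᶠ it))) (rightᶠ (leftᶠ it)) (rightᶠ (leftᶠ (leftᶠ it))))
            (entryᶠ inst mat (leftᶠ (leftᶠ (leftᶠ it))) (rightᶠ (leftᶠ (leftᶠ it))) (rightᶠ it)))))
    where
    Ctx : Set
    Ctx = Σ (Σ (Σ[ I ∈ CVRPInstance ] Matrix I × V I) (λ (I , _) → V I)) (λ ((I , _) , _) → V I)
    inst : Ctx → CVRPInstance
    inst (((I , _) , _) , _) = I
    mat : (γ : Ctx) → Matrix (inst γ)
    mat (((_ , D , _) , _) , _) = D

  -- Relaxation adds entries, but the minimum with the old entry never lets one rise above its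
  -- initial value. This invariant bounds the matrix through all rounds.
  distancesᶠ : Poly encodeCVRP (λ I → encMatrix I (distances I))
  distancesᶠ = foldᶠ {η = λ _ → leaf} (λ _ → finᵗ) encMatrix relax initial
    (λ I → allFin (order I)) nilᶠ initialᶠ (indicesᶠ order (orderᶠ {I = id} it))
    (consᶠ (rightᶠ (leftᶠ it)) (rightᶠ it) ⟫ relaxᶠ)
    (≼-mono (λ I → peak-invariant (encMatrix I) (relax I) (λ D → ∀ u v → D u v ≤ initial I u v) (N I)
        (λ D s h u v → ≤-trans (m⊓n≤m (D u v) _) (h u v)) (small I) (initial I) (allFin (order I))
            (λ u v → ≤-refl))
      (≼-suc (≼-* order≼ (≼-suc (≼-suc (≼-* order≼ (≼-suc (≼-suc (≼-* (≼-const 4) (size≼ initialᶠ))))))))))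
    where
    E : CVRPInstance → ℕ
    E I = suc (4 * size (encMatrix I (initial I)))

    N : CVRPInstance → ℕ
    N I = suc (order I * suc (suc (order I * suc (E I))))

    order≼ : order ≼ (λ I → size (encodeCVRP I))
    order≼ = ≼-mono (λ I → ≤size-unary (order I)) (size≼ (orderᶠ {I = id} it))

    small : ∀ I D → (∀ u v → D u v ≤ initial I u v) → size (encMatrix I D) ≤ N I
    small I D h = size-table≤ (λ u → encodeTable (λ v → num (D u v))) _ λ u → size-table≤ (λ v → num (D u v))
      (E I) λ v →
      ≤-trans (size-num-mono (h u v)) (s≤s (*-monoʳ-≤ 4 (≤-trans (size-table (λ v → num (initial I u v)) v)
        (size-table (λ u → encodeTable (λ v → num (initial I u v))) u))))

  membersᶠ : {Γ : Set} {ρ : Γ → Tree} {μ : Γ → ℕ} (n : Γ → ℕ) (S : ∀ γ → Subset (n γ)) →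
             Feasible ρ μ (λ γ → unary (n γ)) → Feasible ρ μ (λ γ → encodeSubset (S γ)) →
             Feasible ρ μ (λ γ → encList finᵗ (filterᵇ (Vec.lookup (S γ)) (allFin (n γ))))
  membersᶠ n S p q = filterᶠ (λ _ → finᵗ) (λ γ → Vec.lookup (S γ)) (λ γ → allFin (n γ)) q (indicesᶠ n p)
    (indexᶠ {n = λ (γ , _) → n γ} (λ (γ , _) i → encodeBool (Vec.lookup (S γ) i)) (leftᶠ it) (rightᶠ it))

  -- For accumulators that may double in every round, as in Horner's rule, where the size of the
  -- final result is the only useful bound.
  peak-growing : {A B : Set} (enc : B → Tree) (step : B → A → B) →
                 (∀ b a → size (enc b) ≤ size (enc (step b a))) →
                 ∀ b xs → peak enc step b xs ≤ size (enc (foldl step b xs))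
  peak-growing enc step grow b []       = ≤-refl
  peak-growing enc step grow b (x ∷ xs) = ⊔-lub
    (≤-trans (grow b x) (≤-trans (head≤peak enc step (step b x) xs) rest)) rest
    where
    rest = peak-growing enc step grow (step b x) xs

  -- Horner's rule, starting from the most significant digit. The unary form is exponentially longer
  -- than the binary one, so the value itself has to be bounded by the measure; this is how the
  -- parameter enters for k, ℓ and g.
  unaryᶠ : {Γ : Set} {ρ : Γ → Tree} {μ : Γ → ℕ} {n : Γ → ℕ} → Feasible ρ μ (λ γ → num (n γ)) → n ≼ μ →
           Feasible ρ μ (λ γ → unary (n γ))
  unaryᶠ {n = n} p n≼ = retarget (λ γ → cong unary (horner≡ (n γ)))
    (foldᶠ {η = λ _ → leaf} (λ _ → encodeBool) (λ _ → unary) (λ _ → horner) (λ _ → 0)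
      (λ γ → reverse (digits (n γ))) nilᶠ nilᶠ
      (reverseᶠ (λ _ → encodeBool) (λ γ → digits (n γ)) (retarget (λ γ → num-encBits (n γ)) p))
      (retarget (λ (_ , m , b) → sym (if-float unary b))
        (ifᶠ {b = λ (_ , m , b) → b} (rightᶠ it) (consᶠ nilᶠ doubleᶠ) (consᶠ nilᶠ (consᶠ nilᶠ doubleᶠ))))
      (≼-mono (λ γ → ≤-trans (peak-growing unary horner grow 0 (reverse (digits (n γ))))
          (≤-reflexive (trans (cong (size ∘ unary) (horner≡ (n γ))) (size-unary (n γ)))))
        (≼-suc (≼-+ n≼ n≼))))
    where
    horner : ℕ → Bool → ℕ
    horner m b = if b then suc (m + m) else suc (suc (m + m))

    doubleᶠ : ∀ {Γ : Set} → Poly {Σ[ γ ∈ Γ ] ℕ × Bool} (λ (γ , m , b) → (leaf ∙ unary m) ∙ encodeBool b)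
        (λ (γ , m , b) → unary (m + m))
    doubleᶠ = unary-+ᶠ (rightᶠ (leftᶠ it)) (rightᶠ (leftᶠ it))

    grow : ∀ m b → size (unary m) ≤ size (unary (horner m b))
    grow m true  = size-unary-mono (≤-trans (m≤m+n m m) (n≤1+n _))
    grow m false = size-unary-mono (≤-trans (m≤m+n m m) (m≤n+m _ 2))

    foldr-value : ∀ ds → foldr (flip horner) 0 ds ≡ value ds
    foldr-value []           = refl
    foldr-value (true ∷ ds)  rewrite foldr-value ds = cong (λ z → suc (value ds + z)) (sym (+-identityʳ _))
    foldr-value (false ∷ ds) rewrite foldr-value ds =
        sym (trans (*-suc 2 (value ds)) (cong (λ z → suc (suc (value ds + z))) (+-identityʳ _)))

    horner≡ : ∀ m → foldl horner 0 (reverse (digits m)) ≡ m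
    horner≡ m = trans (reverse-foldl horner 0 (digits m)) (trans (foldr-value (digits m)) (value-digits m))

-- Plans and walks

foldl-sum : {A : Set} (f : A → ℕ) (w : ℕ) (xs : List A) → foldl (λ w x → w + f x) w xs ≡ w + sumᴸ (map f xs)
foldl-sum f w []       = sym (+-identityʳ w)
foldl-sum f w (x ∷ xs) = trans (foldl-sum f (w + f x) xs) (+-assoc w (f x) _)

-- What a positive answer means, without the alphabet and the length limit, which only confine the
-- search. Routings are built from this alone; in the converse direction the limits are supplied
-- separately to `answer-complete`.
record Plan (P : Core) : Set where
  open Core P
  field
    routes  : List (List (Fin n))
    few     : length routes ≤ vehicles
    served  : ∀ {v} → v ∈ stops → Any (v ∈_) routes
    light   : All (λ route → sumᴸ (map demand route) ≤ ℓ) routes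
    short   : All (λ route → tour route ≤ g) routes
    cheap   : sumᴸ (map tour routes) ≤ r

module _ (P : Core) where
  open Core P

  answer-sound : T answer → Plan P
  answer-sound h with find (any⁻ valid plans h)
  ... | plan , plan∈ , ok = record
    { routes = plan
    ; few    = proj₁ (∈-wordsUpTo⁻ (wordsUpTo alphabet limit) vehicles plan∈)
    ; served = λ v∈ → Any.map (λ {route} q → Any.map (==⇒≡ _ _) (any⁻ _ route q))
        (any⁻ _ plan (All.lookup (all⁺ (serves plan) stops (proj₁ ok₁)) v∈))
    ; light  = All.map (λ {route} q → ≤-trans (≤-reflexive (sym (foldl-sum demand 0 route)))
        (≤ᵇ⇒≤ _ _ (proj₁ (T-and q)))) ok₂
    ; short  = All.map (λ q → ≤ᵇ⇒≤ _ _ (proj₂ (T-and q))) ok₂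
    ; cheap  = ≤-trans (≤-reflexive (sym (foldl-sum tour 0 plan))) (≤ᵇ⇒≤ _ _ (proj₂ (T-and ok)))
    }
    where
    T-and : ∀ {x y} → T (x ∧ y) → T x × T y
    T-and = Equivalence.to T-∧
    ok₁ = T-and (proj₁ (T-and ok))
    ok₂ = all⁺ admissible plan (proj₂ ok₁)

  answer-complete : (p : Plan P) → length stops ≤ vehicles * limit →
                    All (λ route → length route ≤ limit × All (_∈ stops) route) (Plan.routes p) → T answer
  answer-complete p few-stops bounds =
    any⁺ valid (Any.map (λ { refl → ok })
        (∈-wordsUpTo⁺ vehicles few
            (All.map (λ (l , a) → ∈-wordsUpTo⁺ limit l (subst (λ as → All (_∈ as) _) (sym alphabet≡) a))
                bounds)))
    where
    open Plan p
    and-T : ∀ {x y} → T x → T y → T (x ∧ y)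
    and-T a b = Equivalence.from T-∧ (a , b)
    alphabet≡ : alphabet ≡ stops
    alphabet≡ with length stops ≤ᵇ vehicles * limit in eq
    ... | true  = refl
    ... | false = ⊥-elim (subst T eq (≤⇒≤ᵇ few-stops))
    ok : T (valid routes)
    ok = and-T (and-T
      (all⁻ (serves routes)
          (All.tabulate λ v∈ → any⁺ _
              (Any.map (λ q → any⁺ _ (Any.map (λ { {x} refl → ==-refl x }) q)) (served v∈))))
      (all⁻ admissible (All.zipWith
          (λ {route} (a , b) → and-T (≤⇒≤ᵇ (≤-trans (≤-reflexive (foldl-sum demand 0 route)) a)) (≤⇒≤ᵇ b))
              (light , short))))
      (≤⇒≤ᵇ (≤-trans (≤-reflexive (foldl-sum tour 0 routes)) cheap))

-- Shortest walks and the Floyd-Warshall invariants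

module Walks (I : CVRPInstance) where
  open CVRPInstance I

  weight-◅◅ : ∀ {u v w} (p : Walk u v) (q : Walk v w) → walkWeight (p ◅◅ q) ≡ walkWeight p + walkWeight q
  weight-◅◅ ε       q = refl
  weight-◅◅ (e ◅ p) q = trans (cong (weight e +_) (weight-◅◅ p q)) (sym (+-assoc (weight e) _ _))

  on-start : ∀ {u v} (p : Walk u v) → u on p
  on-start ε       = here refl
  on-start (e ◅ p) = here refl

  on-end : ∀ {u v} (p : Walk u v) → v on p
  on-end ε       = here refl
  on-end (e ◅ p) = there (on-end p)

  on-◅◅ʳ : ∀ {u v w c} (p : Walk u v) {q : Walk v w} → c on q → c on p ◅◅ q
  on-◅◅ʳ ε       c∈ = c∈
  on-◅◅ʳ (e ◅ p) c∈ = there (on-◅◅ʳ p c∈)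

  on-◅◅ˡ : ∀ {u v w c} (p : Walk u v) {q : Walk v w} → c on p → c on p ◅◅ q
  on-◅◅ˡ ε       {q} (here refl) = on-start q
  on-◅◅ˡ (e ◅ p)     (here refl) = here refl
  on-◅◅ˡ (e ◅ p)     (there c∈)  = there (on-◅◅ˡ p c∈)

  backwards : ∀ {u v} → Walk u v → Walk v u
  backwards ε       = ε
  backwards (e ◅ p) = backwards p ◅◅ (~-sym e ◅ ε)

  weight-backwards : ∀ {u v} (p : Walk u v) → walkWeight (backwards p) ≡ walkWeight p
  weight-backwards ε       = refl
  weight-backwards (e ◅ p) = trans (weight-◅◅ (backwards p) _)
    (trans (cong₂ _+_ (weight-backwards p) (trans (+-identityʳ _) (weight-sym e))) (+-comm (walkWeight p) _))

  -- Then D u v is at most the weight of every walk from u to v whose inner vertices lie in S.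
  record Closed (S : V → Set) (D : Matrix I) : Set where
    field
      loop : ∀ u → D u u ≡ 0
      edge : ∀ {u v} (e : u ~ v) → D u v ≤ weight e
      step : ∀ {u x} (e : u ~ x) v → S x → D u v ≤ weight e + D x v
  open Closed

  -- The invariant only speaks of prepending one edge, so no walk has to be split at the pivot `s`
  -- or freed of repeated visits to it. For vertices already in S, the inequality passes to both
  -- arguments of the minimum.
  relax-closed : ∀ {S D} s → Closed S D → Closed (λ x → x ≡ s ⊎ S x) (relax I D s)
  relax-closed {S} {D} s c = record
    { loop = λ u → n≤0⇒n≡0 (≤-trans (m⊓n≤m _ _) (≤-reflexive (loop c u)))
    ; edge = λ e → ≤-trans (m⊓n≤m _ _) (edge c e)
    -- Here x is the pivot. Relaxation does not lower the entry from x to v, because its alternative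
    -- `D x x + D x v` is at least `D x v`.
    ; step = λ { {u} {x} e v (inj₁ refl) → ≤-trans (m⊓n≤n (D u v) _) (≤-trans (+-monoˡ-≤ (D x v) (edge c e))
                   (+-monoʳ-≤ (weight e) (⊓-glb ≤-refl (m≤n+m (D x v) (D x x)))))
               ; {u} {x} e v (inj₂ x∈S) → ≤-trans (⊓-mono-≤ (step c e v x∈S)
                     (≤-trans (+-monoˡ-≤ (D s v) (step c e s x∈S)) (≤-reflexive (+-assoc (weight e) _ _))))
                   (≤-reflexive (sym (+-distribˡ-⊓ (weight e) (D x v) (D x s + D s v)))) }
    }

  foldl-closed : ∀ {S D} xs → Closed S D → Closed (λ x → x ∈ xs ⊎ S x) (foldl (relax I) D xs)
  foldl-closed []       c =
      record { loop = loop c ; edge = edge c ; step = λ { e v (inj₂ x∈S) → step c e v x∈S } }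
  foldl-closed {S} (s ∷ xs) c =
    record { loop = loop c′ ; edge = edge c′ ; step = λ e v → step c′ e v ∘ reassociate }
    where
    c′ = foldl-closed xs (relax-closed s c)
    reassociate : ∀ {x} → x ∈ s ∷ xs ⊎ S x → x ∈ xs ⊎ (x ≡ s ⊎ S x)
    reassociate (inj₁ (here eq))  = inj₂ (inj₁ eq)
    reassociate (inj₁ (there x∈)) = inj₁ x∈
    reassociate (inj₂ x∈S)        = inj₂ (inj₂ x∈S)

  initial-closed : Closed (λ _ → ⊥) (initial I)
  initial-closed = record { loop = λ u → loop′ u (u == u) (==-refl u) ; edge =
    λ {u} {v} e → edge′ (u == v) (T? (adjacent u v)) e ; step = λ _ _ () }
    where
    loop′ : ∀ u b → T b → (if b then 0 else optional (T? (adjacent u u)) weight (suc r)) ≡ 0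
    loop′ u true _ = refl
    edge′ : ∀ {u v} b (a? : Dec (u ~ v)) (e : u ~ v) →
        (if b then 0 else optional a? weight (suc r)) ≤ weight e
    edge′ true  a?       e = z≤n
    edge′ false (yes e′) e = ≤-reflexive (cong weight (T-irrelevant e′ e))
    edge′ false (no ¬e)  e = ⊥-elim (¬e e)

  dist : Matrix I
  dist = distances I

  closed : Closed (λ x → x ∈ allFin order ⊎ ⊥) dist
  closed = foldl-closed (allFin order) initial-closed

  dist-loop : ∀ u → dist u u ≡ 0
  dist-loop = loop closed

  dist-step : ∀ {u x} (e : u ~ x) v → dist u v ≤ weight e + dist x v
  dist-step {x = x} e v = step closed e v (inj₁ (∈-allFin x))

  dist≤walk : ∀ {u v} (p : Walk u v) → dist u v ≤ walkWeight p
  dist≤walk {u} ε = ≤-reflexive (dist-loop u)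
  dist≤walk {v = v} (e ◅ p) = ≤-trans (dist-step e v) (+-monoʳ-≤ (weight e) (dist≤walk p))

  -- Only entries within the budget are promised a walk; larger ones may stem from the placeholder r
  -- + 1 of a non-edge.
  Realized : Matrix I → Set
  Realized D = ∀ u v → D u v ≤ r → Σ[ p ∈ Walk u v ] walkWeight p ≤ D u v

  initial-realized : Realized (initial I)
  initial-realized u v = lemma (u == v) (==⇒≡ u v) (T? (adjacent u v))
    where
    lemma : ∀ {u v} b → (T b → u ≡ v) → (a? : Dec (u ~ v)) →
            (if b then 0 else optional a? weight (suc r)) ≤ r →
            Σ[ p ∈ Walk u v ] walkWeight p ≤ (if b then 0 else optional a? weight (suc r))
    lemma true  eq a?      h rewrite eq tt = ε , z≤n
    lemma false eq (yes e) h = e ◅ ε , ≤-reflexive (+-identityʳ _)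
    lemma false eq (no _)  h = ⊥-elim (1+n≰n h)

  relax-realized : ∀ {D} s → Realized D → Realized (relax I D s)
  relax-realized {D} s real u v h with ⊓-sel (D u v) (D u s + D s v)
  ... | inj₁ eq rewrite eq = real u v h
  ... | inj₂ eq rewrite eq with real u s (≤-trans (m≤m+n _ _) h) | real s v (≤-trans (m≤n+m _ _) h)
  ... | p , p≤ | q , q≤ = p ◅◅ q , ≤-trans (≤-reflexive (weight-◅◅ p q)) (+-mono-≤ p≤ q≤)

  foldl-realized : ∀ {D} xs → Realized D → Realized (foldl (relax I) D xs)
  foldl-realized []       real = real
  foldl-realized (s ∷ xs) real = foldl-realized xs (relax-realized s real)

  shortest : ∀ u v → dist u v ≤ r → Σ[ p ∈ Walk u v ] walkWeight p ≤ dist u v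
  shortest = foldl-realized (allFin order) initial-realized

  -- The quantity that `Core.roundTrip` accumulates from the left, written recursively and with
  -- independent end points so that induction on walks applies.
  trip : V → List V → V → ℕ
  trip u []       v = dist u v
  trip u (c ∷ cs) v = dist u c + trip c cs v

  trip-walk : ∀ u cs v → trip u cs v ≤ r → Σ[ p ∈ Walk u v ] walkWeight p ≤ trip u cs v × All (_on p) cs
  trip-walk u []       v h with shortest u v h
  ... | p , p≤ = p , p≤ , []
  trip-walk u (c ∷ cs) v h with shortest u c (≤-trans (m≤m+n _ _) h) | trip-walk c cs v
      (≤-trans (m≤n+m _ _) h)
  ... | p , p≤ | q , q≤ , cs-on = p ◅◅ q , ≤-trans (≤-reflexive (weight-◅◅ p q)) (+-mono-≤ p≤ q≤) ,
    on-◅◅ˡ p (on-end p) ∷ All.map (on-◅◅ʳ p) cs-on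

  trip-step : ∀ {u x} (e : u ~ x) cs v → trip u cs v ≤ weight e + trip x cs v
  trip-step e []       v = dist-step e v
  trip-step e (c ∷ cs) v =
      ≤-trans (+-monoˡ-≤ (trip c cs v) (dist-step e c)) (≤-reflexive (+-assoc (weight e) _ _))

  trip-here : ∀ u cs ds v → All (u ≡_) cs → trip u (cs ++ ds) v ≡ trip u ds v
  trip-here u []       ds v []         = refl
  trip-here u (c ∷ cs) ds v (refl ∷ h) = cong₂ _+_ (dist-loop u) (trip-here u cs ds v h)

  split : ∀ {u x v} (e : u ~ x) (p : Walk x v) cs → All (_on e ◅ p) cs →
          ∃[ as ] ∃[ bs ] (cs ↭ as ++ bs) × All (u ≡_) as × All (_on p) bs
  split e p []       []       = [] , [] , ↭-refl , [] , []
  split e p (c ∷ cs) (h ∷ hs) with split e p cs hs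
  split e p (c ∷ cs) (here refl ∷ hs) | as , bs , perm , h₁ , h₂ = c ∷ as , bs , prep c perm , refl ∷ h₁ , h₂
  split e p (c ∷ cs) (there c∈ ∷ hs)  | as , bs , perm , h₁ , h₂ =
    as , c ∷ bs , ↭-trans (prep c perm) (↭-sym (shift c as bs)) , h₁ , c∈ ∷ h₂

  -- Visiting the stops in the order of their first occurrence on the walk.
  visiting-order : ∀ {u v} (p : Walk u v) cs → All (_on p) cs → ∃[ ds ] (cs ↭ ds) × trip u ds v ≤ walkWeight p
  visiting-order {u} ε cs hs =
      cs , ↭-refl , ≤-reflexive (trans (cong (λ ds → trip u ds u) (sym (++-identityʳ cs)))
      (trans (trip-here u cs [] u (All.map (λ { (here refl) → refl }) hs)) (dist-loop u)))
  visiting-order {u} {v} (e ◅ p) cs hs with split e p cs hs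
  ... | as , bs , perm , h₁ , h₂ with visiting-order p bs h₂
  ... | ds , perm′ , ds≤ = as ++ ds , ↭-trans perm (++⁺ˡ as perm′) , (begin
    trip u (as ++ ds) v           ≡⟨ trip-here u as ds v h₁ ⟩
    trip u ds v                   ≤⟨ trip-step e ds v ⟩
    weight e + trip _ ds v        ≤⟨ +-monoʳ-≤ (weight e) ds≤ ⟩
    weight e + walkWeight p       ∎)
    where
    open ≤-Reasoning

-- From plans to routings and back

sum-mono : ∀ {n} {f h : Fin n → ℕ} → (∀ i → f i ≤ h i) → sum f ≤ sum h
sum-mono {zero}  f≤h = z≤n
sum-mono {suc n} f≤h = +-mono-≤ (f≤h zero) (sum-mono (f≤h ∘ suc))

≤sum : ∀ {n} (f : Fin n → ℕ) i → f i ≤ sum f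
≤sum f zero    = m≤m+n _ _
≤sum f (suc i) = ≤-trans (≤sum (f ∘ suc) i) (m≤n+m _ _)

sum≤* : ∀ {n} (f : Fin n → ℕ) b → (∀ i → f i ≤ b) → sum f ≤ n * b
sum≤* {zero}  f b h = z≤n
sum≤* {suc n} f b h = +-mono-≤ (h zero) (sum≤* (f ∘ suc) b (h ∘ suc))

sum-lookup : {A : Set} (f : A → ℕ) (xs : List A) → sum (λ i → f (lookup xs i)) ≡ sumᴸ (map f xs)
sum-lookup f []       = refl
sum-lookup f (x ∷ xs) = cong (f x +_) (sum-lookup f xs)

sum-tabulate : ∀ {n} (f : Fin n → ℕ) → sumᴸ (tabulate f) ≡ sum f
sum-tabulate {zero}  f = refl
sum-tabulate {suc n} f = cong (f zero +_) (sum-tabulate (f ∘ suc))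

sum-indicator : ∀ {n} (x : Fin n) a → sum (λ c → if does (c Fin.≟ x) then a else 0) ≡ a
sum-indicator {suc n} zero    a = trans (cong (a +_) (sum-replicate-zero n)) (+-identityʳ a)
sum-indicator {suc n} (suc x) a = sum-indicator x a

-- Every nonzero `h c` is charged to an occurrence of c in the route. The head x absorbs the whole
-- share of x, which is then set to 0 for the tail, so repeated entries only make the right-hand
-- side larger.
sum≤sum-route : ∀ {n} (h demand : Fin n → ℕ) (route : List (Fin n)) →
                (∀ c → h c ≡ 0 ⊎ (c ∈ route × h c ≤ demand c)) → sum h ≤ sumᴸ (map demand route)
sum≤sum-route {n} h demand [] cover = ≤-trans (sum-mono zeros) (≤-reflexive (sum-replicate-zero n))
  where
  zeros : ∀ c → h c ≤ 0
  zeros c with cover c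
  ... | inj₁ eq       = ≤-reflexive eq
  ... | inj₂ (() , _)
sum≤sum-route h demand (x ∷ route) cover = begin
  sum h                                       ≤⟨ sum-mono divide ⟩
  sum (λ c → at-x c + elsewhere c)            ≡⟨ ∑-distrib-+ at-x elsewhere ⟩
  sum at-x + sum elsewhere                    ≤⟨ +-mono-≤ (≤-reflexive (sum-indicator x (demand x)))
      (sum≤sum-route elsewhere demand route cover′) ⟩
  demand x + sumᴸ (map demand route)          ∎
  where
  open ≤-Reasoning
  at-x elsewhere : Fin _ → ℕ
  at-x c = if does (c Fin.≟ x) then demand x else 0
  elsewhere c = if does (c Fin.≟ x) then 0 else h c

  divide : ∀ c → h c ≤ at-x c + elsewhere c
  divide c with c Fin.≟ x | cover c
  ... | no _     | _             = ≤-refl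
  ... | yes refl | inj₁ eq       = ≤-trans (≤-reflexive eq) z≤n
  ... | yes refl | inj₂ (_ , le) = ≤-trans le (m≤m+n _ _)

  cover′ : ∀ c → elsewhere c ≡ 0 ⊎ (c ∈ route × elsewhere c ≤ demand c)
  cover′ c with c Fin.≟ x | cover c
  ... | yes _  | _                        = inj₁ refl
  ... | no _   | inj₁ eq                  = inj₁ eq
  ... | no c≢x | inj₂ (here c≡x , _)      = ⊥-elim (c≢x c≡x)
  ... | no _   | inj₂ (there c∈ , le)     = inj₂ (c∈ , le)

sum-filter≤ : {A : Set} (b : A → Bool) (f h : A → ℕ) (xs : List A) → (∀ x → T (b x) → f x ≤ h x) →
              sumᴸ (map f (filterᵇ b xs)) ≤ sumᴸ (map h xs)
sum-filter≤ b f h []       le = z≤n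
sum-filter≤ b f h (x ∷ xs) le with b x in eq
... | true  = +-mono-≤ (le x (subst T (sym eq) tt)) (sum-filter≤ b f h xs le)
... | false = ≤-trans (sum-filter≤ b f h xs le) (m≤n+m _ _)

-- Double counting. Applied to the stops assigned to each vehicle, it shows that a solvable instance
-- has at most `vehicles * limit` stops, so that the cut-off in `alphabet` loses nothing.
length≤sum-filter : ∀ {m} {A : Set} (b : Fin m → A → Bool) (xs : List A) → All (λ x → ∃[ i ] T (b i x)) xs →
                    length xs ≤ sum (λ i → length (filterᵇ (b i) xs))
length≤sum-filter b []       []             = z≤n
length≤sum-filter b (x ∷ xs) ((i , bix) ∷ h) = begin
  1 + length xs
    ≤⟨ +-mono-≤ (≤-trans (≤-reflexive (sym (indicator≡1 (b i x) bix))) (≤sum indicator i))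
        (length≤sum-filter b xs h) ⟩
  sum indicator + sum (λ i → length (filterᵇ (b i) xs))
    ≡⟨ ∑-distrib-+ indicator (λ i → length (filterᵇ (b i) xs)) ⟨
  sum (λ i → indicator i + length (filterᵇ (b i) xs))
    ≡⟨ sum-cong-≗ (λ i → length-∷ (b i) x xs) ⟩
  sum (λ i → length (filterᵇ (b i) (x ∷ xs))) ∎
  where
  open ≤-Reasoning
  indicator : Fin _ → ℕ
  indicator i = if b i x then 1 else 0

  indicator≡1 : ∀ b → T b → (if b then 1 else 0) ≡ 1
  indicator≡1 true _ = refl

  length-∷ : {A : Set} (b : A → Bool) (x : A) (xs : List A) →
      (if b x then 1 else 0) + length (filterᵇ b xs) ≡ length (filterᵇ b (x ∷ xs))
  length-∷ b x xs with b x
  ... | true  = refl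
  ... | false = refl

members : ∀ {n} → Subset n → List (Fin n)
members {n} S = filterᵇ (Vec.lookup S) (allFin n)

∈-members⁺ : ∀ {n} (S : Subset n) {v} → v ∈ˢ S → v ∈ members S
∈-members⁺ S {v} v∈S = ∈-filter⁺ (T? ∘ Vec.lookup S) (∈-allFin v) (Equivalence.from T-≡ ([]=⇒lookup v∈S))

∈-members⁻ : ∀ {n} (S : Subset n) {v} → v ∈ members S → v ∈ˢ S
∈-members⁻ {n} S {v} v∈ =
    lookup⇒[]= v S (Equivalence.to T-≡ (proj₂ (∈-filter⁻ (T? ∘ Vec.lookup S) {xs = allFin n} v∈)))

module _ (I : CVRPInstance) where
  open CVRPInstance I

  coreOf : (stops : List V) (demand : V → ℕ) (limit ℓ g : ℕ) → Core
  coreOf stops demand limit ℓ g = record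
    { n = order ; dist = distances I ; demand = demand ; depots = members D ; stops = stops
    ; vehicles = k ; limit = limit ; ℓ = ℓ ; g = g ; r = r }

module CoreOf (I : CVRPInstance) (stops : List (CVRPInstance.V I)) (demand : CVRPInstance.V I → ℕ)
  (limit ℓ g : ℕ) where
  open CVRPInstance I
  open Walks I

  P : Core
  P = coreOf I stops demand limit ℓ g

  roundTrip≡trip : ∀ route d → Core.roundTrip P route d ≡ trip d route d
  roundTrip≡trip route d = lemma d 0 route
    where
    lemma : ∀ u w cs → proj₂ (foldl (Core.leg P) (u , w) cs) + dist (proj₁ (foldl (Core.leg P) (u , w) cs)) d
        ≡ w + trip u cs d
    lemma u w []       = refl
    lemma u w (c ∷ cs) = trans (lemma c (w + dist u c) cs) (+-assoc w (dist u c) _)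

  tour-witness : ∀ route → Core.tour P route ≤ r → ∃[ d ] d ∈ˢ D × trip d route d ≤ Core.tour P route
  tour-witness route h with lemma (suc r) (members D)
    where
    lemma : ∀ w ds → let t = foldl (λ w d → w ⊓ Core.roundTrip P route d) w ds in
            t ≡ w ⊎ ∃[ d ] d ∈ ds × Core.roundTrip P route d ≤ t
    lemma w []       = inj₁ refl
    lemma w (d ∷ ds) with lemma (w ⊓ Core.roundTrip P route d) ds
    ... | inj₂ (d′ , d′∈ , le) = inj₂ (d′ , there d′∈ , le)
    ... | inj₁ eq with ⊓-sel w (Core.roundTrip P route d)
    ...   | inj₁ eq′ = inj₁ (trans eq eq′)
    ...   | inj₂ eq′ = inj₂ (d , here refl , ≤-reflexive (sym (trans eq eq′)))
  ... | inj₁ eq            = ⊥-elim (1+n≰n (≤-trans (≤-reflexive (sym eq)) h))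
  ... | inj₂ (d , d∈ , le) = d , ∈-members⁻ D d∈ , ≤-trans (≤-reflexive (sym (roundTrip≡trip route d))) le

  tour≤trip : ∀ route {d} → d ∈ˢ D → Core.tour P route ≤ trip d route d
  tour≤trip route {d} d∈D =
    ≤-trans (lemma (suc r) (members D) (∈-members⁺ D d∈D)) (≤-reflexive (roundTrip≡trip route d))
    where
    lemma : ∀ w ds → d ∈ ds → foldl (λ w d → w ⊓ Core.roundTrip P route d) w ds ≤ Core.roundTrip P route d
    lemma w (x ∷ ds) (here refl) = ≤-trans (foldl-⊓≤ (Core.roundTrip P route) _ ds) (m⊓n≤n w _)
    lemma w (x ∷ ds) (there d∈)  = lemma _ ds d∈

  module FromPlan (plan : Plan P) where
    open Plan plan

    route : Fin (length routes) → List V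
    route = lookup routes

    tours≤r : sum (λ i → Core.tour P (route i)) ≤ r
    tours≤r = ≤-trans (≤-reflexive (sum-lookup (Core.tour P) routes)) cheap

    tour≤r : ∀ i → Core.tour P (route i) ≤ r
    tour≤r i = ≤-trans (≤sum (λ i → Core.tour P (route i)) i) tours≤r

    start : Fin (length routes) → V
    start i = proj₁ (tour-witness (route i) (tour≤r i))

    start∈D : ∀ i → start i ∈ˢ D
    start∈D i = proj₁ (proj₂ (tour-witness (route i) (tour≤r i)))

    trip≤tour : ∀ i → trip (start i) (route i) (start i) ≤ Core.tour P (route i)
    trip≤tour i = proj₂ (proj₂ (tour-witness (route i) (tour≤r i)))

    private
      walks : ∀ i → Σ[ p ∈ Walk (start i) (start i) ] walkWeight p ≤ trip (start i) (route i) (start i) ×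
          All (_on p) (route i)
      walks i = trip-walk (start i) (route i) (start i) (≤-trans (trip≤tour i) (tour≤r i))

    walk : ∀ i → Walk (start i) (start i)
    walk i = proj₁ (walks i)

    walk≤tour : ∀ i → walkWeight (walk i) ≤ Core.tour P (route i)
    walk≤tour i = ≤-trans (proj₁ (proj₂ (walks i))) (trip≤tour i)

    on-walk : ∀ i {v} → v ∈ route i → v on walk i
    on-walk i = All.lookup (proj₂ (proj₂ (walks i)))

    tour≤g : ∀ i → Core.tour P (route i) ≤ g
    tour≤g i = All.lookup short (∈-lookup i)

    load≤ℓ : ∀ i → sumᴸ (map demand (route i)) ≤ ℓ
    load≤ℓ i = All.lookup light (∈-lookup i)

    vehicle : ∀ {v} → v ∈ stops → Fin (length routes)
    vehicle v∈ = Any.index (served v∈)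

    vehicle-serves : ∀ {v} (v∈ : v ∈ stops) → v ∈ route (vehicle v∈)
    vehicle-serves v∈ = lookup-index (served v∈)

  module FromRouting (R : Routing I) (stops⊆C : ∀ {v} → v ∈ stops → v ∈ˢ C) where
    open Routing R

    -- The assignment takes a proof of membership as an argument. The proof used here is the one
    -- given by `c ∈? C`, as in `Routing.load`, so that loads can be compared summand by summand.
    assigned : Fin k′ → V → Bool
    assigned i c with c ∈? C
    ... | yes c∈C = does (A c c∈C Fin.≟ i)
    ... | no _    = false

    assigned-on : ∀ i c → T (assigned i c) → c on walk i
    assigned-on i c h with c ∈? C
    ... | yes c∈C with A c c∈C Fin.≟ i
    ...   | yes refl = A-visits c c∈C

    assigned-some : ∀ c → c ∈ˢ C → ∃[ i ] T (assigned i c)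
    assigned-some c c∈ with c ∈? C
    ... | no c∉C  = ⊥-elim (c∉C c∈)
    ... | yes c∈C = A c c∈C , lemma (A c c∈C)
      where
      lemma : ∀ {m} (i : Fin m) → T (does (i Fin.≟ i))
      lemma i with i Fin.≟ i
      ... | yes _   = tt
      ... | no i≢i = i≢i refl

    stopsOf : Fin k′ → List V
    stopsOf i = filterᵇ (assigned i) stops

    private
      orders : ∀ i → ∃[ ds ] (stopsOf i ↭ ds) × trip (start i) ds (start i) ≤ walkWeight (walk i)
      orders i = visiting-order (walk i) (stopsOf i)
        (All.map (λ {c} → assigned-on i c) (All.all-filter (T? ∘ assigned i) stops))

    route : Fin k′ → List V
    route i = proj₁ (orders i)

    route-↭ : ∀ i → stopsOf i ↭ route i
    route-↭ i = proj₁ (proj₂ (orders i))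

    trip≤walk : ∀ i → trip (start i) (route i) (start i) ≤ walkWeight (walk i)
    trip≤walk i = proj₂ (proj₂ (orders i))

    tour≤walk : ∀ i → Core.tour P (route i) ≤ walkWeight (walk i)
    tour≤walk i = ≤-trans (tour≤trip (route i) (start∈D i)) (trip≤walk i)

    answer-yes : totalWeight ≤ r → RespectsGas g → (∀ i → sumᴸ (map demand (stopsOf i)) ≤ ℓ) →
                 (∀ i → length (route i) ≤ limit) → T (Core.answer P)
    answer-yes cheap gas light few = answer-complete P
      (record
        { routes = tabulate route
        ; few    = ≤-trans (≤-reflexive (length-tabulate route)) k′≤k
        ; served = λ {v} v∈ → let i , vi = assigned-some v (stops⊆C v∈) in
            Any.map (λ { refl → ∈-resp-↭ (route-↭ i) (∈-filter⁺ (T? ∘ assigned i) v∈ vi) })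
                (∈-tabulate⁺ {f = route} i)
        ; light  = All.tabulate⁺ λ i → ≤-trans (≤-reflexive (sym (sum-↭ (map⁺ demand (route-↭ i))))) (light i)
        ; short  = All.tabulate⁺ λ i → ≤-trans (tour≤walk i) (gas i)
        ; cheap  = ≤-trans (≤-reflexive
            (trans (cong sumᴸ (map-tabulate route (Core.tour P))) (sum-tabulate (Core.tour P ∘ route))))
            (≤-trans (sum-mono tour≤walk) cheap)
        })
      (≤-trans (length≤sum-filter assigned stops (All.tabulate λ v∈ → assigned-some _ (stops⊆C v∈)))
        (≤-trans (sum≤* (λ i → length (stopsOf i)) limit
          (λ i → ≤-trans (≤-reflexive (↭-length (route-↭ i))) (few i)))
          (*-monoˡ-≤ limit k′≤k)))
      (All.tabulate⁺ λ i → few i ,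
        All-resp-↭ (route-↭ i) (All.tabulate λ v∈ → proj₁ (∈-filter⁻ (T? ∘ assigned i) {xs = stops} v∈)))

-- Correctness for load capacities

module LoadRouting (I : LoadCVRPInstance) (g : ℕ) where
  open LoadCVRPInstance I
  open Routing using (RespectsLoad; RespectsGas; totalWeight)

  demand : V → ℕ
  demand c = optional (c ∈? C) (Λ c) 0

  open CoreOf cvrp (members C) demand ℓ ℓ g public

  Solution : Set
  Solution = Σ[ R ∈ Routing cvrp ] RespectsLoad R Λ ℓ × RespectsGas R g × totalWeight R ≤ r

  private
    -- The summands of a load are only available by unification.
    summands : (R : Routing cvrp) (i : Fin (Routing.k′ R)) → Σ[ h ∈ (V → ℕ) ] Routing.load R Λ i ≡ sum h
    summands R i = _ , refl

    summand : (R : Routing cvrp) → Fin (Routing.k′ R) → V → ℕ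
    summand R i = proj₁ (summands R i)

  routing : Plan P → Solution
  routing plan = R , light , (λ i → ≤-trans (walk≤tour i) (tour≤g i)) , ≤-trans (sum-mono walk≤tour) tours≤r
    where
    open FromPlan plan

    R : Routing cvrp
    R = record
      { k′ = _ ; k′≤k = Plan.few plan ; start = start ; start∈D = start∈D ; walk = walk
      ; A = λ c c∈C → vehicle (∈-members⁺ C c∈C)
      ; A-visits = λ c c∈C → on-walk _ (vehicle-serves (∈-members⁺ C c∈C)) }

    light : RespectsLoad R Λ ℓ
    light i = ≤-trans (sum≤sum-route (summand R i) demand (route i) cover) (load≤ℓ i)
      where
      -- A client may occur on several routes of the plan, but it contributes to the load of the
      -- chosen vehicle only, and the route of that vehicle contains it.
      cover : ∀ c → summand R i c ≡ 0 ⊎ (c ∈ route i × summand R i c ≤ demand c)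
      cover c with c ∈? C
      ... | no _    = inj₁ refl
      ... | yes c∈C with vehicle (∈-members⁺ C c∈C) Fin.≟ i | vehicle-serves (∈-members⁺ C c∈C)
      ...   | no _     | _  = inj₁ refl
      ...   | yes refl | c∈ = inj₂ (c∈ , ≤-refl)

  sound : T (Core.answer P) → Solution
  sound yes! = routing (answer-sound P yes!)

  complete : Solution → T (Core.answer P)
  complete (R , light , gas , cheap) = answer-yes cheap gas demand≤ℓ λ i →
    ≤-trans (≤-reflexive (sym (↭-length (route-↭ i))))
        (≤-trans (length≤demand (stopsOf i) (stopsOf-⊆ i)) (demand≤ℓ i))
    where
    open FromRouting R (∈-members⁻ C)
    open Routing R using (A)

    demand≤ℓ : ∀ i → sumᴸ (map demand (stopsOf i)) ≤ ℓ
    demand≤ℓ i = begin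
      sumᴸ (map demand (stopsOf i))             ≤⟨ sum-filter≤ (assigned i) demand (summand R i)
          (members C) demand≤summand ⟩
      sumᴸ (map (summand R i) (members C))      ≤⟨ sum-filter≤ (Vec.lookup C) (summand R i) (summand R i)
          (allFin order) (λ _ _ → ≤-refl) ⟩
      sumᴸ (map (summand R i) (allFin order))   ≡⟨ cong sumᴸ (map-tabulate id (summand R i)) ⟩
      sumᴸ (tabulate (summand R i))             ≡⟨ sum-tabulate (summand R i) ⟩
      sum (summand R i)                         ≤⟨ light i ⟩
      ℓ                                         ∎
      where
      open ≤-Reasoning
      demand≤summand : ∀ c → T (assigned i c) → demand c ≤ summand R i c
      demand≤summand c h with c ∈? C
      ... | yes c∈C with A c c∈C Fin.≟ i
      ...   | yes _ = ≤-refl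

    stopsOf-⊆ : ∀ i → All (_∈ˢ C) (stopsOf i)
    stopsOf-⊆ i = All.tabulate λ c∈ → ∈-members⁻ C (proj₁ (∈-filter⁻ (T? ∘ assigned i) {xs = members C} c∈))

    length≤demand : ∀ cs → All (_∈ˢ C) cs → length cs ≤ sumᴸ (map demand cs)
    length≤demand []       []       = z≤n
    length≤demand (c ∷ cs) (h ∷ hs) = +-mono-≤ (positive c h) (length≤demand cs hs)
      where
      positive : ∀ c → c ∈ˢ C → 1 ≤ demand c
      positive c h with c ∈? C
      ... | yes c∈C = Λ>0 c c∈C
      ... | no c∉C  = ⊥-elim (c∉C h)

-- Correctness for gas capacities: representatives and free detours

separate : (I : CVRPInstance) → List (CVRPInstance.V I) → CVRPInstance.V I → List (CVRPInstance.V I)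
separate I reps c = if any (λ x → distances I c x ≤ᵇ 0) reps then reps else c ∷ reps

-- Clients at pairwise positive distance, of which a vehicle with gas g can visit at most g + 1; every other
-- client is at distance 0 from one of them.
representatives : (I : CVRPInstance) → List (CVRPInstance.V I)
representatives I = foldl (separate I) [] (members (CVRPInstance.C I))

module GasRouting (I : CVRPInstance) (g : ℕ) where
  open CVRPInstance I
  open Walks I
  open Routing using (RespectsGas; totalWeight)

  reps : List V
  reps = representatives I

  open CoreOf I reps (λ _ → 0) (suc g) 0 g public

  Solution : Set
  Solution = Σ[ R ∈ Routing I ] RespectsGas R g × totalWeight R ≤ r

  Apart : V → V → Set
  Apart x y = 0 < dist x y

  Close : V → V → Set
  Close c x = dist c x ≡ 0

  -- A distance 0 is within every budget, hence realized by a walk, which can be reversed. Symmetry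
  -- lets pairwise separation survive the reordering of stops along a walk.
  apart-sym : ∀ {x y} → Apart x y → Apart y x
  apart-sym {x} {y} 0<xy = n≢0⇒n>0 λ yx≡0 → <⇒≢ 0<xy (sym (n≤0⇒n≡0 (begin
    dist x y                                   ≤⟨ dist≤walk (backwards (proj₁ (near yx≡0))) ⟩
    walkWeight (backwards (proj₁ (near yx≡0)))  ≡⟨ weight-backwards (proj₁ (near yx≡0)) ⟩
    walkWeight (proj₁ (near yx≡0))              ≤⟨ proj₂ (near yx≡0) ⟩
    dist y x                                   ≡⟨ yx≡0 ⟩
    0                                          ∎)))
    where
    open ≤-Reasoning
    near : dist y x ≡ 0 → Σ[ p ∈ Walk y x ] walkWeight p ≤ dist y x
    near eq = shortest y x (≤-trans (≤-reflexive eq) z≤n)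

  record Separated (cs xs : List V) : Set where
    field
      chosen : ∀ {x} → x ∈ xs → x ∈ˢ C
      apart  : AllPairs Apart xs
      covers : ∀ {c} → c ∈ cs → Any (Close c) xs

  extend : ∀ {cs xs} c → c ∈ˢ C → Separated cs xs → Separated (c ∷ cs) (separate I xs c)
  extend {cs} {xs} c c∈C s with any (λ x → dist c x ≤ᵇ 0) xs in eq
  ... | true  = record
    { chosen = chosen ; apart = apart
    ; covers = λ { (here refl) → Any.map (λ {x} h → n≤0⇒n≡0 (≤ᵇ⇒≤ _ _ h))
                 (any⁻ (λ x → dist c x ≤ᵇ 0) xs (subst T (sym eq) tt))
                 ; (there c∈) → covers c∈ } }
    where open Separated s
  ... | false = record
    { chosen = λ { (here refl) → c∈C ; (there x∈) → chosen x∈ }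
    ; apart  = All.tabulate (λ {x} x∈ → n≢0⇒n>0 λ cx≡0 → subst T eq (any⁺ (λ x → dist c x ≤ᵇ 0)
                 (Any.map (λ { refl → ≤⇒≤ᵇ (≤-reflexive cx≡0) }) x∈))) ∷ apart
    ; covers = λ { (here refl) → here (dist-loop c) ; (there c∈) → there (covers c∈) } }
    where open Separated s

  separated : Separated (members C) reps
  separated = record { chosen = chosen ; apart = apart ; covers = λ c∈ → covers (Any.reverse⁺ c∈) }
    where
    foldl-separated : ∀ {cs xs} ds → All (_∈ˢ C) ds → Separated cs xs →
        Separated (ds ʳ++ cs) (foldl (separate I) xs ds)
    foldl-separated []       []       s = s
    foldl-separated (d ∷ ds) (h ∷ hs) s = foldl-separated ds hs (extend d h s)
    nothing : Separated [] []
    nothing = record { chosen = λ () ; apart = [] ; covers = λ () }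
    open Separated (foldl-separated (members C) (All.tabulate (∈-members⁻ C)) nothing)

  open Separated separated

  trip≥length : ∀ c cs v → AllPairs Apart (c ∷ cs) → length cs ≤ trip c cs v
  trip≥length c []       v _                = z≤n
  trip≥length c (d ∷ cs) v ((c-d ∷ _) ∷ ds) = +-mono-≤ c-d (trip≥length d cs v ds)

  -- Each leg between consecutive stops costs at least 1, but the leg from the depot to the first
  -- stop may be free. This is the origin of the limit g + 1.
  length≤ : ∀ u cs v → AllPairs Apart cs → trip u cs v ≤ g → length cs ≤ suc g
  length≤ u []       v _ _ = z≤n
  length≤ u (c ∷ cs) v a h = s≤s (≤-trans (trip≥length c cs v a) (≤-trans (m≤n+m _ _) h))

  complete : Solution → T (Core.answer P)
  complete (R , gas , cheap) = answer-yes cheap gas (λ i → ≤-reflexive (zero-demand (stopsOf i))) λ i →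
    length≤ (start i) (route i) (start i)
      (AllPairs-resp-↭ (setoid V) (λ {x} {y} → apart-sym {x} {y}) (resp₂ Apart) (↭⇒↭ₛ (route-↭ i))
          (AllPairs.filter⁺ (T? ∘ assigned i) apart))
      (≤-trans (trip≤walk i) (gas i))
    where
    open FromRouting R chosen
    open Routing R using (start)
    zero-demand : (cs : List V) → sumᴸ (map (λ _ → 0) cs) ≡ 0
    zero-demand []       = refl
    zero-demand (_ ∷ cs) = zero-demand cs

  detour : ∀ {u v x} (p : Walk u v) → x on p → (q : Walk x x) → walkWeight q ≡ 0 →
           Σ[ p′ ∈ Walk u v ] walkWeight p′ ≡ walkWeight p × (∀ {c} → c on p → c on p′) × (∀ {c} → c on q →
           c on p′)
  detour ε (here refl) q q≡0 = q , q≡0 , (λ { (here refl) → on-start q }) , id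
  detour (e ◅ p) (here refl) q q≡0 = q ◅◅ (e ◅ p) , trans (weight-◅◅ q _) (cong (_+ _) q≡0) , on-◅◅ʳ q ,
      on-◅◅ˡ q
  detour (e ◅ p) (there x∈) q q≡0 with detour p x∈ q q≡0
  ... | p′ , eq , keep , new =
      e ◅ p′ , cong (weight e +_) eq , (λ { (here refl) → here refl ; (there c∈) → there (keep c∈) }) ,
          there ∘ new

  Excursion : V → V → Set
  Excursion c x = Σ[ q ∈ Walk x x ] walkWeight q ≡ 0 × c on q

  -- A walk of weight 0 from c to x, traversed backwards and then forwards, is a free closed walk at
  -- x through c.
  excursion : ∀ {c x} → Close c x → Excursion c x
  excursion {c} {x} cx≡0 with shortest c x (≤-trans (≤-reflexive cx≡0) z≤n)
  ... | p , p≤ = backwards p ◅◅ p , trans (weight-◅◅ (backwards p) p)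
    (cong₂ _+_ (trans (weight-backwards p) p≡0) p≡0) , on-◅◅ʳ (backwards p) (on-start p)
    where
    p≡0 : walkWeight p ≡ 0
    p≡0 = n≤0⇒n≡0 (≤-trans p≤ (≤-reflexive cx≡0))

  detours : ∀ {u v} (p : Walk u v) (cs : List V) → All (λ c → Σ[ x ∈ V ] x on p × Excursion c x) cs →
            Σ[ p′ ∈ Walk u v ] walkWeight p′ ≡ walkWeight p × (∀ {c} → c on p → c on p′) × All (_on p′) cs
  detours p []       []                            = p , refl , id , []
  detours p (c ∷ cs) ((x , x∈ , q , q≡0 , c∈q) ∷ h) with detours p cs h
  ... | p₁ , eq₁ , keep₁ , new₁ with detour p₁ (keep₁ x∈) q q≡0
  ... | p₂ , eq₂ , keep₂ , new₂ = p₂ , trans eq₂ eq₁ , keep₂ ∘ keep₁ , new₂ c∈q ∷ All.map keep₂ new₁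

  routing : Plan P → Solution
  routing plan = record
      { k′ = _ ; k′≤k = Plan.few plan ; start = start ; start∈D = start∈D
      ; walk = λ i → proj₁ (extended i)
      ; A = λ c c∈C → vehicleOf c∈C
      ; A-visits = λ c c∈C → All.lookup (proj₂ (proj₂ (proj₂ (extended (vehicleOf c∈C)))))
          (∈-filter⁺ (T? ∘ near (vehicleOf c∈C)) (∈-members⁺ C c∈C) (vehicleOf-near c∈C)) }
    , (λ i → ≤-trans (extended≤tour i) (tour≤g i)) , ≤-trans (sum-mono extended≤tour) tours≤r
    where
    open FromPlan plan

    representative : ∀ {c} → c ∈ˢ C → Σ[ x ∈ V ] x ∈ reps × Close c x
    representative c∈C = find (covers (∈-members⁺ C c∈C))

    vehicleOf : ∀ {c} → c ∈ˢ C → Fin (length (Plan.routes plan))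
    vehicleOf c∈C = vehicle (proj₁ (proj₂ (representative c∈C)))

    -- Vehicle i makes excursions to all clients at distance 0 from some stop of its route. These
    -- include the clients assigned to it, and the others do no harm, as all excursions are free.
    near : Fin (length (Plan.routes plan)) → V → Bool
    near i c = any (λ x → dist c x ≤ᵇ 0) (route i)

    close-near : ∀ {i c x} → x ∈ route i → Close c x → T (near i c)
    close-near {c = c} x∈ close =
        any⁺ (λ x → dist c x ≤ᵇ 0) (Any.map (λ { refl → ≤⇒≤ᵇ (≤-reflexive close) }) x∈)

    vehicleOf-near : ∀ {c} (c∈C : c ∈ˢ C) → T (near (vehicleOf c∈C) c)
    vehicleOf-near c∈C =
        close-near (vehicle-serves (proj₁ (proj₂ (representative c∈C)))) (proj₂ (proj₂ (representative c∈C)))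

    detourFor : ∀ i {c} → T (near i c) → Σ[ x ∈ V ] x on walk i × Excursion c x
    detourFor i {c} h = witness (find (any⁻ (λ x → dist c x ≤ᵇ 0) (route i) h))
      where
      witness : Σ[ x ∈ V ] x ∈ route i × T (dist c x ≤ᵇ 0) → Σ[ x ∈ V ] x on walk i × Excursion c x
      witness (x , x∈ , close) = x , on-walk i x∈ , excursion (n≤0⇒n≡0 (≤ᵇ⇒≤ _ _ close))

    extended : ∀ i → Σ[ p ∈ Walk (start i) (start i) ] walkWeight p ≡ walkWeight (walk i) ×
               (∀ {c} → c on walk i → c on p) × All (_on p) (filterᵇ (near i) (members C))
    extended i = detours (walk i) (filterᵇ (near i) (members C))
      (All.map (detourFor i) (All.all-filter (T? ∘ near i) (members C)))

    extended≤tour : ∀ i → walkWeight (proj₁ (extended i)) ≤ Core.tour P (route i)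
    extended≤tour i = ≤-trans (≤-reflexive (proj₁ (proj₂ (extended i)))) (walk≤tour i)

  sound : T (Core.answer P) → Solution
  sound yes! = routing (answer-sound P yes!)

-- Fixed-parameter tractability

representativesᶠ : Poly CVRPInstance.encodeCVRP (λ I → encList finᵗ (representatives I))
representativesᶠ = foldᶠ-additive (λ _ → finᵗ) (λ _ → encList finᵗ) separate (λ _ → [])
  (λ I → members (CVRPInstance.C I))
  distancesᶠ nilᶠ (membersᶠ CVRPInstance.order CVRPInstance.C (orderᶠ {I = id} it) (Cᶠ {I = id} it))
  (ifᶠ′ (λ _ → encList finᵗ)
    (anyᶠ (λ _ → finᵗ) (λ (I , reps , c) x → distances I c x ≤ᵇ 0) (λ (I , reps , c) → reps) it
      (rightᶠ (leftᶠ it))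
      (≤ᶠ (entryᶠ (λ ((I , _) , _) → I) (λ ((I , _) , _) → distances I) (leftᶠ (leftᶠ (leftᶠ it)))
          (rightᶠ (leftᶠ it)) (rightᶠ it)) (constᶠ (num 0))))
    (rightᶠ (leftᶠ it)) (consᶠ (rightᶠ it) (rightᶠ (leftᶠ it))))
  {δ = λ (I , c) → suc (size (finᵗ c))} (≼-mono (λ _ → s≤s (m≤n+m _ _)) ≼-refl)
  (λ I reps c → grow (any (λ x → distances I c x ≤ᵇ 0) reps) reps c)
  where
  grow : ∀ {n} b (xs : List (Fin n)) c →
      size (encList finᵗ (if b then xs else c ∷ xs)) ≤ size (encList finᵗ xs) + suc (size (finᵗ c))
  grow true  xs c = m≤m+n _ _
  grow false xs c = ≤-reflexive (+-comm (suc (size (finᵗ c))) _)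

coreᶠ : {Γ : Set} {ρ : Γ → Tree} {μ : Γ → ℕ} (I : Γ → CVRPInstance)
        (stops : ∀ γ → List (CVRPInstance.V (I γ)))
        (demand : ∀ γ → CVRPInstance.V (I γ) → ℕ) (limit ℓ g : Γ → ℕ) →
        Feasible ρ μ (λ γ → CVRPInstance.encodeCVRP (I γ)) → (λ γ → CVRPInstance.k (I γ)) ≼ μ →
        Feasible ρ μ (λ γ → encList finᵗ (stops γ)) →
        Feasible ρ μ (λ γ → encodeTable (λ v → num (demand γ v))) →
        Feasible ρ μ (λ γ → unary (limit γ)) → Feasible ρ μ (λ γ → num (ℓ γ)) →
        Feasible ρ μ (λ γ → num (g γ)) →
        Feasible ρ μ (λ γ → Core.encodeCore (coreOf (I γ) (stops γ) (demand γ) (limit γ) (ℓ γ) (g γ)))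
coreᶠ I stops demand limit ℓ g p k≼ stopsᶠ demandᶠ limitᶠ ℓᶠ gᶠ =
  consᶠ (p ⟫ pull I distancesᶠ) (consᶠ demandᶠ (consᶠ
    (membersᶠ (λ γ → CVRPInstance.order (I γ)) (λ γ → CVRPInstance.D (I γ)) (orderᶠ {I = I} p) (Dᶠ {I = I} p))
    (consᶠ stopsᶠ (consᶠ (unaryᶠ (kᶠ {I = I} p) k≼)
        (consᶠ limitᶠ (consᶠ ℓᶠ (consᶠ gᶠ (budgetᶠ {I = I} p))))))))

-- The exponent of `searchBound` with κ + 1 in place of both arguments; there are at most κ
-- vehicles, and the limit is ℓ or g + 1, hence at most κ + 1.
exponent : ℕ → ℕ
exponent κ = suc (suc κ * suc κ * suc κ) * suc κ

module _ {Γ : Set} (ρ : Γ → Tree) (κ : Γ → ℕ) where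

  -- A sum, so that it bounds both the input size and the number of candidates directly; `fpt` turns
  -- its powers into products.
  measure : Γ → ℕ
  measure γ = size (ρ γ) + 2 ^ exponent (κ γ)

  size≼measure : (λ γ → size (ρ γ)) ≼ measure
  size≼measure = ≼-mono (λ γ → m≤m+n _ _) ≼-refl

  2^≼measure : (e : Γ → ℕ) → (∀ γ → e γ ≤ exponent (κ γ)) → (λ γ → 2 ^ e γ) ≼ measure
  2^≼measure e e≤ = ≼-mono (λ γ → ≤-trans (^-monoʳ-≤ 2 (e≤ γ)) (m≤n+m _ (size (ρ γ)))) ≼-refl

  κ≼measure : (n : Γ → ℕ) → (∀ γ → n γ ≤ suc (κ γ)) → n ≼ measure
  κ≼measure n n≤ = ≼-mono
    (λ γ → ≤-trans (n≤ γ) (≤-trans (m≤m+n (suc (κ γ)) _) (<⇒≤ (suc≤2^ (exponent (κ γ))))))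
    (2^≼measure (λ γ → exponent (κ γ)) (λ γ → ≤-refl))

  searchᶠ : (P : Γ → Core) → (∀ γ → Core.vehicles (P γ) ≤ κ γ) → (∀ γ → Core.limit (P γ) ≤ suc (κ γ)) →
            Feasible ρ measure (λ γ → Core.encodeCore (P γ)) →
            Feasible ρ measure (λ γ → encodeBool (Core.answer (P γ)))
  searchᶠ P k≤ b≤ p = answerᶠ p
    (2^≼measure _ λ γ → ≤-trans (kbb≤ γ) (≤-trans (n≤1+n _) (m≤m*n _ (suc (κ γ)))))
    (2^≼measure _ λ γ → *-mono-≤ (s≤s (kbb≤ γ)) (≤-trans (k≤ γ) (n≤1+n _)))
    where
    kbb≤ : ∀ γ → Core.vehicles (P γ) * Core.limit (P γ) * Core.limit (P γ) ≤ suc (κ γ) * suc (κ γ) * suc (κ γ)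
    kbb≤ γ = *-mono-≤ (*-mono-≤ (≤-trans (k≤ γ) (n≤1+n _)) (b≤ γ)) (b≤ γ)

loadCoreᶠ : {Γ : Set} {ρ : Γ → Tree} {μ : Γ → ℕ} (I : Γ → LoadCVRPInstance) (g : Γ → ℕ) →
            Feasible ρ μ (λ γ → LoadCVRPInstance.encodeLoadCVRP (I γ)) → Feasible ρ μ (λ γ → num (g γ)) →
            (λ γ → LoadCVRPInstance.k (I γ)) ≼ μ → (λ γ → LoadCVRPInstance.ℓ (I γ)) ≼ μ →
            Feasible ρ μ (λ γ → Core.encodeCore (LoadRouting.P (I γ) (g γ)))
loadCoreᶠ I g p q k≼ ℓ≼ =
    coreᶠ (λ γ → cvrp (I γ)) (λ γ → members (C (I γ))) (λ γ → LoadRouting.demand (I γ) (g γ)) (λ γ → ℓ (I γ))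
        (λ γ → ℓ (I γ)) g
    cvrpᶠ k≼ (membersᶠ (λ γ → order (I γ)) (λ γ → C (I γ)) orderᶠ′ (Cᶠ {I = λ γ → cvrp (I γ)} cvrpᶠ))
    (tableᶠ (λ γ → order (I γ)) orderᶠ′ p
      (optionalᶠ (λ (γ , c) → c ∈? C (I γ)) (λ (γ , c) → Λ (I γ) c) (λ _ → 0)
        (indexᶠ {n = λ (γ , _) → order (I γ)} (λ (γ , _) c → encodeOptional (c ∈? C (I γ)) (Λ (I γ) c))
            (leftᶠ (rightᶠ (rightᶠ (leftᶠ it)))) (rightᶠ it))
        (constᶠ (num 0))))
    (unaryᶠ ℓᶠ′ ℓ≼) ℓᶠ′ q
  where
  open LoadCVRPInstance
  cvrpᶠ = leftᶠ p
  orderᶠ′ = orderᶠ {I = λ γ → cvrp (I γ)} cvrpᶠ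
  ℓᶠ′ = retarget (λ γ → sym (num≡ (ℓ (I γ)))) (leftᶠ (rightᶠ p))

gasCoreᶠ : {Γ : Set} {ρ : Γ → Tree} {μ : Γ → ℕ} (I : Γ → CVRPInstance) (g : Γ → ℕ) →
           Feasible ρ μ (λ γ → CVRPInstance.encodeCVRP (I γ)) → Feasible ρ μ (λ γ → num (g γ)) →
           (λ γ → CVRPInstance.k (I γ)) ≼ μ → g ≼ μ →
           Feasible ρ μ (λ γ → Core.encodeCore (GasRouting.P (I γ) (g γ)))
gasCoreᶠ I g p q k≼ g≼ = coreᶠ I (λ γ → representatives (I γ)) (λ γ _ → 0) (λ γ → suc (g γ)) (λ _ → 0) g p k≼
  (p ⟫ pull I representativesᶠ)
  (tableᶠ (λ γ → CVRPInstance.order (I γ)) {τ = λ _ → num 0} (orderᶠ {I = I} p) nilᶠ (constᶠ (num 0)))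
  (consᶠ nilᶠ (unaryᶠ q g≼)) (constᶠ (num 0)) q

-- In bijective binary, the numeral consisting of m ones has the value 2 ^ m - 1.
ones : ℕ → List Bool
ones m = replicate m true

suc-value-ones : ∀ m → suc (value (ones m)) ≡ 2 ^ m
suc-value-ones zero    = refl
suc-value-ones (suc m) = trans (sym (*-suc 2 (value (ones m)))) (cong (2 *_) (suc-value-ones m))

-- The factor (3 + 2^e)^c, rounded up to a number of the form 2^m - 1: its numeral is a string of
-- ones and can be written down without binary exponentiation. The 2 in the exponent comes from 3 +
-- 2^e ≤ 4 * 2^e, and the outer successor makes up for the subtracted 1.
runtime : ℕ → ℕ → ℕ
runtime c κ = value (ones (suc ((exponent κ + 2) * c)))

2^≤runtime : ∀ c κ → (3 + 2 ^ exponent κ) ^ c ≤ runtime c κ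
2^≤runtime c κ = ≤-pred (begin
  suc ((3 + 2 ^ e) ^ c)             ≤⟨ s≤s (^-monoˡ-≤ c 3+2^e≤) ⟩
  suc ((2 ^ (e + 2)) ^ c)           ≡⟨ cong suc (^-*-assoc 2 (e + 2) c) ⟩
  suc (2 ^ ((e + 2) * c))           ≤⟨ +-mono-≤ (m^n>0 2 ((e + 2) * c)) (m≤m+n (2 ^ ((e + 2) * c)) 0) ⟩
  2 ^ suc ((e + 2) * c)             ≡⟨ suc-value-ones (suc ((e + 2) * c)) ⟨
  suc (runtime c κ)                 ∎)
  where
  open ≤-Reasoning
  e = exponent κ
  3+2^e≤ : 3 + 2 ^ e ≤ 2 ^ (e + 2)
  3+2^e≤ = ≤-trans (+-monoˡ-≤ (2 ^ e) (*-monoʳ-≤ 3 (m^n>0 2 e)))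
    (≤-reflexive (trans (arithmetic (2 ^ e)) (sym (^-distribˡ-+-* 2 e 2))))
    where
    arithmetic : ∀ x → 3 * x + x ≡ x * 4
    arithmetic = solve-∀

runtime-computable : ∀ c → Computable (runtime c)
runtime-computable c = program runtimeᶠ , λ n → time runtimeᶠ n , runs runtimeᶠ n
  where
  -- Computability sets no time limit, so the measure may contain n itself, which permits the
  -- conversion of n to unary.
  μ : ℕ → ℕ
  μ n = size (encodeℕ n) + n

  nᶠ : Feasible encodeℕ μ (λ n → unary (suc n))
  nᶠ = consᶠ nilᶠ (unaryᶠ (retarget (λ n → sym (num≡ n)) (selfᶠ (≼-mono (λ n → m≤m+n _ _) ≼-refl)))
      (≼-mono (λ n → m≤n+m n _) ≼-refl))

  constUnaryᶠ : ∀ m → Feasible encodeℕ μ (λ _ → unary m)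
  constUnaryᶠ m = constᶠ (unary m)

  lengthᶠ′ : Feasible encodeℕ μ (λ n → unary (suc ((exponent n + 2) * c)))
  lengthᶠ′ = consᶠ nilᶠ (unary-*ᶠ {m = λ n → exponent n + 2} {n = λ _ → c}
    (unary-+ᶠ {m = exponent} {n = λ _ → 2}
      (unary-*ᶠ {m = λ n → suc (suc n * suc n * suc n)} {n = suc}
        (consᶠ nilᶠ (unary-*ᶠ {m = λ n → suc n * suc n} {n = suc} (unary-*ᶠ {m = suc} {n = suc} nᶠ nᶠ) nᶠ))
            nᶠ)
      (constUnaryᶠ 2))
    (constUnaryᶠ c))

  runtimeᶠ : Feasible encodeℕ μ (λ n → encodeℕ (runtime c n))
  runtimeᶠ = retarget (λ n → trans (cong encodeList (map-ones (suc ((exponent n + 2) * c))))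
    (sym (encodeℕ-value (ones (suc ((exponent n + 2) * c))))))
    (mapᶠ {η = λ _ → leaf} {A = λ _ → Tree} (λ _ → id) (λ n → replicate (suc ((exponent n + 2) * c)) leaf)
      {τ = λ _ → encodeBool true}
      nilᶠ (retarget (λ n → sym (unary-list (suc ((exponent n + 2) * c)))) lengthᶠ′) (constᶠ (leaf ∙ leaf)))
    where
    map-ones : ∀ m → map (λ _ → encodeBool true) (replicate m leaf) ≡ map encodeBool (ones m)
    map-ones zero    = refl
    map-ones (suc m) = cong (encodeBool true ∷_) (map-ones m)

*-^ : ∀ m n c → (m * n) ^ c ≡ m ^ c * n ^ c
*-^ m n zero    = refl
*-^ m n (suc c) = trans (cong (m * n *_) (*-^ m n c)) (arithmetic m n (m ^ c) (n ^ c))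
  where
  arithmetic : ∀ m n x y → m * n * (x * y) ≡ m * x * (n * y)
  arithmetic = solve-∀

-- For input size s ≥ 1 and E = 2^e, the base 2 + (s + E) is at most (3 + E) * s, so its power
-- splits into a factor depending on the parameter alone and a power of s.
fpt : (P : Problem) (κ : Problem.Instance P → ℕ) (answer : Problem.Instance P → Bool) →
      Feasible (Problem.encode P) (measure (Problem.encode P) κ) (λ I → encodeBool (answer I)) →
      (∀ I → Reflects (Problem.Yes P I) (answer I)) → FPT P κ
fpt P κ answer (feasible p t run (bounded c t≤) _) correct =
  p , runtime c , c , runtime-computable c , λ I → answer I , t I , run I , correct I , (begin
    t I                                                     ≤⟨ t≤ I ⟩
    (2 + (size (encode I) + 2 ^ exponent (κ I))) ^ c        ≤⟨ ^-monoˡ-≤ c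
        (factor (size (encode I)) (2 ^ exponent (κ I)) (size>0 (encode I))) ⟩
    ((3 + 2 ^ exponent (κ I)) * size (encode I)) ^ c        ≡⟨ *-^ (3 + 2 ^ exponent (κ I))
        (size (encode I)) c ⟩
    (3 + 2 ^ exponent (κ I)) ^ c * size (encode I) ^ c      ≤⟨ *-monoˡ-≤ (size (encode I) ^ c)
        (2^≤runtime c (κ I)) ⟩
    runtime c (κ I) * size (encode I) ^ c                   ∎)
  where
  open ≤-Reasoning
  open Problem P using (encode)
  factor : ∀ s e → 1 ≤ s → 2 + (s + e) ≤ (3 + e) * s
  factor (suc s) e _ = ≤-trans (m≤m+n _ (2 * s + e * s)) (≤-reflexive (arithmetic s e))
    where
    arithmetic : ∀ s e → 2 + (suc s + e) + (2 * s + e * s) ≡ (3 + e) * suc s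
    arithmetic = solve-∀

theorem4p4 :
    FPT LoadCVRP (λ I → LoadCVRPInstance.k I + LoadCVRPInstance.ℓ I) ×
    FPT GasCVRP (λ I → GasCVRPInstance.k I + GasCVRPInstance.g I) ×
    FPT LoadGasCVRP (λ I → LoadGasCVRPInstance.k I + LoadGasCVRPInstance.ℓ I)
theorem4p4 = load , gas , loadGas
  where
  load : FPT LoadCVRP (λ I → LoadCVRPInstance.k I + LoadCVRPInstance.ℓ I)
  load = fpt LoadCVRP κ (λ I → Core.answer (P I (r I)))
    (searchᶠ encodeLoadCVRP κ (λ I → P I (r I)) (λ I → m≤m+n (k I) (ℓ I))
      (λ I → ≤-trans (m≤n+m (ℓ I) (k I)) (n≤1+n _))
      (loadCoreᶠ id r (selfᶠ (size≼measure encodeLoadCVRP κ))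
        (budgetᶠ {I = cvrp} (leftᶠ (selfᶠ (size≼measure encodeLoadCVRP κ))))
        (κ≼measure encodeLoadCVRP κ k (λ I → ≤-trans (m≤m+n (k I) (ℓ I)) (n≤1+n _)))
        (κ≼measure encodeLoadCVRP κ ℓ (λ I → ≤-trans (m≤n+m (ℓ I) (k I)) (n≤1+n _)))))
    (λ I → fromEquivalence
      (λ yes! → let (R , light , _ , cheap) = sound I (r I) yes! in R , light , cheap)
      (λ (R , light , cheap) → complete I (r I)
          (R , light , (λ i → ≤-trans (≤sum (λ i → walkWeight I (Routing.walk R i)) i) cheap) , cheap)))
    where
    open LoadCVRPInstance
    open LoadRouting using (P; sound; complete)
    κ : LoadCVRPInstance → ℕ
    κ I = k I + ℓ I

  gas : FPT GasCVRP (λ I → GasCVRPInstance.k I + GasCVRPInstance.g I)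
  gas = fpt GasCVRP κ (λ I → Core.answer (P (cvrp I) (g I)))
    (searchᶠ encodeGasCVRP κ (λ I → P (cvrp I) (g I)) (λ I → m≤m+n (k I) (g I))
      (λ I → s≤s (m≤n+m (g I) (k I)))
      (gasCoreᶠ cvrp g (leftᶠ (selfᶠ (size≼measure encodeGasCVRP κ)))
        (retarget (λ I → sym (num≡ (g I))) (leftᶠ (rightᶠ (selfᶠ (size≼measure encodeGasCVRP κ)))))
        (κ≼measure encodeGasCVRP κ k (λ I → ≤-trans (m≤m+n (k I) (g I)) (n≤1+n _)))
        (κ≼measure encodeGasCVRP κ g (λ I → ≤-trans (m≤n+m (g I) (k I)) (n≤1+n _)))))
    (λ I → fromEquivalence (sound (cvrp I) (g I)) (complete (cvrp I) (g I)))
    where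
    open GasCVRPInstance
    open GasRouting using (P; sound; complete)
    κ : GasCVRPInstance → ℕ
    κ I = k I + g I

  loadGas : FPT LoadGasCVRP (λ I → LoadGasCVRPInstance.k I + LoadGasCVRPInstance.ℓ I)
  loadGas = fpt LoadGasCVRP κ (λ I → Core.answer (P (loadCVRP I) (g I)))
    (searchᶠ encodeLoadGasCVRP κ (λ I → P (loadCVRP I) (g I)) (λ I → m≤m+n (k I) (ℓ I))
      (λ I → ≤-trans (m≤n+m (ℓ I) (k I)) (n≤1+n _))
      (loadCoreᶠ loadCVRP g (leftᶠ (selfᶠ (size≼measure encodeLoadGasCVRP κ)))
        (retarget (λ I → sym (num≡ (g I))) (leftᶠ (rightᶠ (selfᶠ (size≼measure encodeLoadGasCVRP κ)))))
        (κ≼measure encodeLoadGasCVRP κ k (λ I → ≤-trans (m≤m+n (k I) (ℓ I)) (n≤1+n _)))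
        (κ≼measure encodeLoadGasCVRP κ ℓ (λ I → ≤-trans (m≤n+m (ℓ I) (k I)) (n≤1+n _)))))
    (λ I → fromEquivalence (sound (loadCVRP I) (g I)) (complete (loadCVRP I) (g I)))
    where
    open LoadGasCVRPInstance
    open LoadRouting using (P; sound; complete)
    κ : LoadGasCVRPInstance → ℕ
    κ I = k I + ℓ I
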